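{- Every hypergraph in $\mathcal{R}_k$ is weakly thick, and consequently satisfies Sidorenko's conjecture: for $H\in\mathcal{R}_k$, $t(H,G)\ge t(e_k,G)^{|E(H)|}$ for every finite $k$-uniform hypergraph $G$.
   Context: A $k$-uniform hypergraph has a finite vertex set and edges that are $k$-element subsets. A homomorphism $H\to G$ is a map $V(H)\to V(G)$ sending each edge of $H$ onto an edge of $G$; $t(H,G)$ is the probability that a uniformly random map $V(H)\to V(G)$ is a homomorphism; $e_k$ is the single-edge hypergraph $\{1,\dots,k\}$. $b$-hypergraphs: $M=(V,E,B)$ with $V$ finite, $E\subseteq 2^V$, $B\subseteq 2^V\times2^V$ symmetric. For $L\in E$, $X\subseteq L$: $r_{L,X}(M)$ has vertex set $V'$ = disjoint union of $V$ and $L$ with the two copies of each $x\in X$ identified (injections $\tau_1:V\to V'$, $\tau_2:L\to V'$); edges $\tau_1(K)$ ($K\in E$), $\tau_2(K)$ ($K\in E,K\subseteq L$), and $\tau_1(K_1)\cup\tau_2(K_2)$ for all $K_1,K_2\in E$ with $K_2\subseteq L$, $X\subseteq K_1\cap K_2$; relation: $\tau_1$-images of pairs in $B$, $\tau_2$-images of pairs in $B\cap(2^L\times2^L)$, and pairs $(\tau_1(K_1),\tau_2(K_2))$ (and reverses) for such $K_1,K_2$. A $k$-reflection complex is obtained from $(\{1,\dots,k\},\{\{1,\dots,k\}\},\emptyset)$ by finitely many operations $r_{L,X}$; its frame $\mathcal{F}(M)$ is the $k$-uniform hypergraph of its $k$-element edges. $\mathcal{Z}_k$ is the set of $k$-uniform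 hypergraphs whose edges are pairwise disjoint (isolated edges plus isolated vertices). $\mathcal{C}_k$ is the set of $k$-reflection complexes obtainable from the trivial one by operations $M\mapsto r_{L,X}(M)$ in which the subhypergraph of $\mathcal{F}(M)$ spanned by $X$ (vertex set $X$, edges of $\mathcal{F}(M)$ contained in $X$) lies in $\mathcal{Z}_k$. $\mathcal{R}_k$ is the set of frames of members of $\mathcal{C}_k$. Weak thickness: in $\mathbb{R}^{2^V}$, $1_S$ is the indicator of the subset $S$; $t_{A,B}=1_{A\cup B}-1_A-1_B+1_{A\cap B}$; $W_B=\mathrm{span}\{t_{A,B}:(A,B)\in B\}$; $Q_V=\mathbb{R}1_\emptyset+$ the cone of nonnegative combinations of all $t_{A,B}$ and $1_A$. For a hypergraph $H$ on $V$, $s_H(V)=-1_V+\sum_{e\in E(H)}1_e$. A $k$-reflection complex with frame $H$ is weakly thick if $s_H(V)\in W_B+Q_V$; a $k$-uniform hypergraph is weakly thick if it is the frame of a weakly thick $k$-reflection complex. -}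

module Defs where

open import Data.Bool using (Bool; true; false; _∧_; _∨_; not; if_then_else_)
open import Data.Nat using (ℕ; zero; suc; _+_; _*_; _^_; NonZero)
open import Data.Fin using (Fin)
import Data.Fin as Fin
open import Data.Vec using (Vec; []; _∷_; _++_; replicate; tabulate; lookup; toList)
open import Data.List using (List; []; _∷_; map; concatMap; filter; length; foldr)
open import Data.Bool.ListAction using (any; all)
open import Data.Nat.Base using (_≡ᵇ_)
import Data.List as List
open import Data.Product using (Σ; _×_; _,_; ∃)
open import Data.Integer using (+_)
open import Data.Rational using (ℚ; 0ℚ; 1ℚ; -_; _/_; _≤_) renaming (_+_ to _+ℚ_; _*_ to _*ℚ_)
import Data.Rational as ℚ
open import Relation.Nullary.Decidable using (⌊_⌋)
open import Relation.Binary.PropositionalEquality using (_≡_; subst)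

-- Finite sets: the vertex set of anything on n vertices is Fin n, and a
-- subset of it is a characteristic vector (Vec Bool n).

Subset : ℕ → Set
Subset n = Vec Bool n

card : ∀ {n} → Subset n → ℕ
card []          = 0
card (true  ∷ s) = suc (card s)
card (false ∷ s) = card s

_∪ˢ_ : ∀ {n} → Subset n → Subset n → Subset n
[]      ∪ˢ []      = []
(a ∷ s) ∪ˢ (b ∷ t) = (a ∨ b) ∷ (s ∪ˢ t)

_∩ˢ_ : ∀ {n} → Subset n → Subset n → Subset n
[]      ∩ˢ []      = []
(a ∷ s) ∩ˢ (b ∷ t) = (a ∧ b) ∷ (s ∩ˢ t)

_∖ˢ_ : ∀ {n} → Subset n → Subset n → Subset n
[]      ∖ˢ []      = []
(a ∷ s) ∖ˢ (b ∷ t) = (a ∧ not b) ∷ (s ∖ˢ t)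

_⊆ᵇ_ : ∀ {n} → Subset n → Subset n → Bool
[]      ⊆ᵇ []      = true
(a ∷ s) ⊆ᵇ (b ∷ t) = (not a ∨ b) ∧ (s ⊆ᵇ t)

_=ˢ_ : ∀ {n} → Subset n → Subset n → Bool
[]      =ˢ []      = true
(a ∷ s) =ˢ (b ∷ t) = ((a ∧ b) ∨ (not a ∧ not b)) ∧ (s =ˢ t)

emptyˢ : ∀ {n} → Subset n
emptyˢ = replicate _ false

fullˢ : ∀ {n} → Subset n
fullˢ = replicate _ true

allSubsets : (n : ℕ) → List (Subset n)
allSubsets zero    = [] ∷ []
allSubsets (suc n) = map (false ∷_) (allSubsets n) List.++ map (true ∷_) (allSubsets n)

-- restriction of a subset s of Fin n to the elements of D, re-indexed as a
-- subset of Fin (card D) (elements of D listed in increasing order)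
restrict : ∀ {n} (D : Subset n) → Subset n → Subset (card D)
restrict []          []      = []
restrict (true  ∷ D) (b ∷ s) = b ∷ restrict D s
restrict (false ∷ D) (b ∷ s) = restrict D s

record BHyp : Set where
  field
    n : ℕ
    E : Subset n → Bool
    B : Subset n → Subset n → Bool
open BHyp public

-- The reflection r_{L,X}(M).  New vertex set V' = V ⊔ (L ∖ X) realised as
-- Fin (n + card (L ∖ X)): the first n vertices are τ₁(V); the copy τ₂(x) of
-- x ∈ X is τ₁(x), and the copies of the elements of L ∖ X are the last
-- card (L ∖ X) vertices.
module Reflection (M : BHyp) (L X : Subset (n M)) where
  m : ℕ
  m = card (L ∖ˢ X)

  n' : ℕ
  n' = n M + m

  τ₁ : Subset (n M) → Subset n'
  τ₁ K = K ++ replicate m false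

  τ₂ : Subset (n M) → Subset n'
  τ₂ K = (K ∩ˢ X) ++ restrict (L ∖ˢ X) K

  private
    Sub = allSubsets (n M)
    existsˢ : (Subset (n M) → Bool) → Bool
    existsˢ p = any p Sub
    inL : Subset (n M) → Bool
    inL K = K ⊆ᵇ L
    glue : Subset (n M) → Subset (n M) → Bool
    glue K₁ K₂ = E M K₁ ∧ E M K₂ ∧ inL K₂ ∧ (X ⊆ᵇ (K₁ ∩ˢ K₂))

  E' : Subset n' → Bool
  E' S = existsˢ (λ K → E M K ∧ (τ₁ K =ˢ S))
       ∨ existsˢ (λ K → E M K ∧ inL K ∧ (τ₂ K =ˢ S))
       ∨ existsˢ (λ K₁ → existsˢ (λ K₂ → glue K₁ K₂ ∧ ((τ₁ K₁ ∪ˢ τ₂ K₂) =ˢ S)))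

  B' : Subset n' → Subset n' → Bool
  B' S T = existsˢ (λ A → existsˢ (λ C → B M A C ∧ (τ₁ A =ˢ S) ∧ (τ₁ C =ˢ T)))
         ∨ existsˢ (λ A → existsˢ (λ C → B M A C ∧ inL A ∧ inL C
                                        ∧ (τ₂ A =ˢ S) ∧ (τ₂ C =ˢ T)))
         ∨ existsˢ (λ K₁ → existsˢ (λ K₂ → glue K₁ K₂
                        ∧ (((τ₁ K₁ =ˢ S) ∧ (τ₂ K₂ =ˢ T)) ∨ ((τ₂ K₂ =ˢ S) ∧ (τ₁ K₁ =ˢ T)))))

  result : BHyp
  result = record { n = n' ; E = E' ; B = B' }

r : (M : BHyp) → (L X : Subset (n M)) → BHyp
r M L X = Reflection.result M L X

trivial : ℕ → BHyp
trivial k = record { n = k ; E = λ S → S =ˢ fullˢ ; B = λ _ _ → false }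

record Hyp : Set where
  field
    n : ℕ
    E : Subset n → Bool
open Hyp public

Uniform : ℕ → Hyp → Set
Uniform k H = ∀ e → Hyp.E H e ≡ true → card e ≡ k

SameHyp : Hyp → Hyp → Set
SameHyp H G = Σ (Hyp.n H ≡ Hyp.n G) λ p → ∀ e → Hyp.E H e ≡ Hyp.E G (subst Subset p e)

edges : (H : Hyp) → List (Subset (Hyp.n H))
edges H = filter (λ e → Data.Bool._≟_ (Hyp.E H e) true) (allSubsets (Hyp.n H))
  where import Data.Bool

numEdges : Hyp → ℕ
numEdges H = length (edges H)

frame : ℕ → BHyp → Hyp
frame k M = record { n = n M ; E = λ S → BHyp.E M S ∧ (card S ≡ᵇ k) }

InZ : ℕ → Hyp → Set
InZ k H = Uniform k H ×
  (∀ e f → Hyp.E H e ≡ true → Hyp.E H f ≡ true → e ≡ f ⊎ (e ∩ˢ f) ≡ emptyˢ)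
  where open import Data.Sum using (_⊎_)

spanned : (H : Hyp) → Subset (Hyp.n H) → Hyp
spanned H X = record
  { n = card X
  ; E = λ S → any (λ e → Hyp.E H e ∧ (e ⊆ᵇ X) ∧ (restrict X e =ˢ S)) (allSubsets (Hyp.n H)) }

data ReflComplex (k : ℕ) : BHyp → Set where
  base : ReflComplex k (trivial k)
  step : ∀ {M} → ReflComplex k M → (L X : Subset (n M)) →
         BHyp.E M L ≡ true → (X ⊆ᵇ L) ≡ true → ReflComplex k (r M L X)

data InC (k : ℕ) : BHyp → Set where
  base : InC k (trivial k)
  step : ∀ {M} → InC k M → (L X : Subset (n M)) →
         BHyp.E M L ≡ true → (X ⊆ᵇ L) ≡ true →
         InZ k (spanned (frame k M) X) → InC k (r M L X)

InR : ℕ → Hyp → Set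
InR k H = Σ BHyp λ M → InC k M × SameHyp (frame k M) H

-- Weak thickness.  Vectors of ℝ^(2^V) are represented as functions
-- Subset n → ℚ (coefficients taken rational).

Vect : ℕ → Set
Vect n = Subset n → ℚ

𝟙 : ∀ {n} → Subset n → Vect n
𝟙 S T = if S =ˢ T then 1ℚ else 0ℚ

infixr 6 _⊕_
infixr 7 _⊙_
_⊕_ : ∀ {n} → Vect n → Vect n → Vect n
(u ⊕ v) S = u S +ℚ v S

_⊙_ : ∀ {n} → ℚ → Vect n → Vect n
(c ⊙ v) S = c *ℚ v S

𝟘 : ∀ {n} → Vect n
𝟘 _ = 0ℚ

tv : ∀ {n} → Subset n → Subset n → Vect n
tv A C = 𝟙 (A ∪ˢ C) ⊕ ((- 1ℚ) ⊙ 𝟙 A) ⊕ ((- 1ℚ) ⊙ 𝟙 C) ⊕ 𝟙 (A ∩ˢ C)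

sumT : ∀ {n} → List (ℚ × Subset n × Subset n) → Vect n
sumT = foldr (λ { (c , A , C) v → (c ⊙ tv A C) ⊕ v }) 𝟘

sum𝟙 : ∀ {n} → List (ℚ × Subset n) → Vect n
sum𝟙 = foldr (λ { (c , A) v → (c ⊙ 𝟙 A) ⊕ v }) 𝟘

open import Data.List.Relation.Unary.All using (All)

InWQ : (M : BHyp) → Vect (n M) → Set
InWQ M v =
  Σ (List (ℚ × Subset (n M) × Subset (n M))) λ w →
  All (λ { (_ , A , C) → BHyp.B M A C ≡ true }) w ×
  Σ ℚ λ c →
  Σ (List (ℚ × Subset (n M) × Subset (n M))) λ p →
  All (λ { (a , _ , _) → 0ℚ ≤ a }) p ×
  Σ (List (ℚ × Subset (n M))) λ q →
  All (λ { (a , _) → 0ℚ ≤ a }) q ×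
  (∀ S → v S ≡ (sumT w ⊕ (c ⊙ 𝟙 emptyˢ) ⊕ sumT p ⊕ sum𝟙 q) S)

sH : (H : Hyp) → Vect (Hyp.n H)
sH H = ((- 1ℚ) ⊙ 𝟙 fullˢ) ⊕ foldr (λ e v → 𝟙 e ⊕ v) 𝟘 (edges H)

WeaklyThickComplex : ℕ → BHyp → Set
WeaklyThickComplex k M = InWQ M (sH (frame k M))

WeaklyThick : ℕ → Hyp → Set
WeaklyThick k H =
  Σ BHyp λ M → ReflComplex k M × WeaklyThickComplex k M × SameHyp (frame k M) H

allMaps : (a b : ℕ) → List (Vec (Fin b) a)
allMaps zero    b = [] ∷ []
allMaps (suc a) b = concatMap (λ f → map (_∷ f) (toList (tabulate {n = b} (λ y → y))))
                              (allMaps a b)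

image : ∀ {a b} → Vec (Fin b) a → Subset a → Subset b
image f e = tabulate (λ y → any (λ x → lookup e x ∧ ⌊ lookup f x Fin.≟ y ⌋)
                                 (toList (tabulate (λ x → x))))

isHom : (H G : Hyp) → Vec (Fin (Hyp.n G)) (Hyp.n H) → Bool
isHom H G f = all (λ e → not (Hyp.E H e) ∨ Hyp.E G (image f e)) (allSubsets (Hyp.n H))

hom : Hyp → Hyp → ℕ
hom H G = length (filter (λ f → Data.Bool._≟_ (isHom H G f) true) (allMaps (Hyp.n H) (Hyp.n G)))
  where import Data.Bool

t : (H G : Hyp) → .{{NonZero (Hyp.n G)}} → ℚ
t H G = (+ hom H G / (Hyp.n G ^ Hyp.n H)) {{m^n≢0 (Hyp.n G) (Hyp.n H)}}
  where open import Data.Nat.Properties using (m^n≢0)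

eₖ : ℕ → Hyp
eₖ k = record { n = k ; E = λ S → S =ˢ fullˢ }

_^ℚ_ : ℚ → ℕ → ℚ
x ^ℚ zero  = 1ℚ
x ^ℚ suc m = x *ℚ (x ^ℚ m)

{-# OPTIONS --safe #-}
-- Call s(K) = −1_K + Σ_{e ⊆ K} 1_e.  A glued edge K₁ ∪ K₂ of a reflection satisfies
--   s(K₁ ∪ K₂) = −t_{K₁,K₂} + s(K₁) + s(K₂) + (1_X − Σ_{e ⊆ X} 1_e),
-- and the last bracket lies in Q when the edges inside X are disjoint, so every edge K of the
-- complex, not only V, has s(K) ∈ W_B + Q by induction.
--
-- Sidorenko's inequality is proved without entropy.  Put d = t(e_k, G) and n = |V(G)|.  Starting
-- from a uniform random edge of G, each reflection couples two copies of the random homomorphism,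
-- conditionally independent given their common restriction to X, so that
-- μ_{K₁ ∪ K₂} = μ_{K₁} μ_{K₂} / μ_X for the marginals.  Hence, on every edge K,
-- n^|K| d^|E(K)| μ_K is a product of variables h = 1 / (n^|X| d^|E(X)| μ_X), and 𝔼 h ≤ 1 because
-- disjoint edges satisfy t(H[X], G) = d^|E(X)|.  By AM–GM the reciprocal R of that product
-- satisfies R + Σ h ≥ 1 + #h, so 𝔼 R ≥ 1; for K = V this bounds the number of homomorphisms.
module Submission where

open import Defs
open import Data.Bool using (Bool; true; false; _∧_; _∨_; not; if_then_else_)
import Data.Bool as Bool using (T)
import Data.Bool.Properties as Bool
open import Data.Bool.ListAction using (any; all; or; and)
open import Data.Empty using (⊥-elim)
open import Data.Fin using (Fin; zero; suc)
import Data.Fin as Fin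
import Data.Fin.Properties as Fin
open import Data.Integer using () renaming (+_ to pos)
import Data.Integer as ℤ
import Data.Integer.Properties as ℤ
open import Data.List using (List; []; _∷_; map; filter; length; foldr; concatMap; cartesianProduct)
import Data.List as List
import Data.List.Properties as List
open import Data.List.Membership.Propositional using (_∈_)
open import Data.List.Membership.Propositional.Properties
  using (∈-map⁺; ∈-map⁻; ∈-++⁺ˡ; ∈-++⁺ʳ; ∈-++⁻; ∈-filter⁺; ∈-filter⁻; ∈-cartesianProduct⁻)
open import Data.List.Membership.Propositional.Properties.WithK using (unique∧set⇒bag)
open import Data.List.Relation.Binary.BagAndSetEquality using (∼bag⇒↭)
open import Data.List.Relation.Binary.Permutation.Propositional using (_↭_)
import Data.List.Relation.Binary.Permutation.Propositional as Perm
import Data.List.Relation.Binary.Permutation.Propositional.Properties as Perm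
open import Data.List.Relation.Unary.All using (All; []; _∷_)
import Data.List.Relation.Unary.All as All
import Data.List.Relation.Unary.All.Properties as All
open import Data.List.Relation.Unary.AllPairs using ([]; _∷_)
open import Data.List.Relation.Unary.Any using (here; there)
open import Data.List.Relation.Unary.Unique.Propositional using (Unique)
import Data.List.Relation.Unary.Unique.Propositional.Properties as Unique
open import Data.Nat using (ℕ; zero; suc; _+_; _*_; _^_; NonZero; _≡ᵇ_)
import Data.Nat as ℕ
import Data.Nat.Properties as ℕ
open import Data.Product using (_×_; _,_; ∃; proj₁; proj₂)
open import Data.Rational using (ℚ; 0ℚ; 1ℚ; -_; _/_; _≤_; _<_) renaming (_+_ to _+ℚ_; _*_ to _*ℚ_; _-_ to _-ℚ_)
import Data.Rational as ℚ
import Data.Rational.Properties as ℚ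
import Data.Rational.Unnormalised as ℚᵘ
import Data.Rational.Unnormalised.Properties as ℚᵘ
open import Data.Sum using (_⊎_; inj₁; inj₂)
open import Data.Vec using (Vec; []; _∷_; _++_; lookup; tabulate; toList)
import Data.Vec
import Data.Vec.Properties as Vec
open import Function using (_∘_; id; case_of_; mk⇔)
open import Level using (0ℓ)
open import Relation.Binary.Definitions using (tri<; tri≈; tri>)
open import Relation.Binary.PropositionalEquality
open import Relation.Nullary.Decidable using (yes; no; ⌊_⌋; dec⇒maybe)
open import Tactic.RingSolver using (solve-∀)
open import Tactic.RingSolver.Core.AlmostCommutativeRing using (AlmostCommutativeRing; fromCommutativeRing)

-- Rational arithmetic and finite sums

-- Both halves are inductions over the same case analysis of the edges of a reflection. A statement
-- about V alone would not survive, because the next step may glue any two edges K₁ and K₂. Edge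
-- counts enter both halves through one inclusion-exclusion over X, used additively for s and as
-- exponents of d in the scale, so it is proved once as a permutation of lists.
--
-- Reciprocals of probabilities take the place of logarithms because they stay in ℚ: 𝔼 (1 / μ_K)
-- counts the maps on K of positive probability, hence is at most the number of homomorphisms on K.
-- AM-GM is used only for numbers with product 1, where it says that the sum is at least the number
-- of terms and involves no roots. The factors h are strongly dependent, but only their sum is
-- averaged, so it is enough that each keeps its own expectation. This is why a coupling has to
-- preserve both marginals. Dividing by powers of d forces a separate treatment of d = 0, where the
-- frame having an edge decides.

ringℚ : AlmostCommutativeRing 0ℓ 0ℓ
ringℚ = fromCommutativeRing ℚ.+-*-commutativeRing (λ x → dec⇒maybe (0ℚ ℚ.≟ x))

private variable
  A C : Set

*-pos : ∀ {p q} → 0ℚ < p → 0ℚ < q → 0ℚ < p *ℚ q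
*-pos {p} {q} 0<p 0<q =
  ℚ.positive⁻¹ (p *ℚ q) {{ℚ.pos*pos⇒pos p {{ℚ.positive 0<p}} q {{ℚ.positive 0<q}}}}

*-nonNeg : ∀ {p q} → 0ℚ ≤ p → 0ℚ ≤ q → 0ℚ ≤ p *ℚ q
*-nonNeg {p} {q} 0≤p 0≤q =
  ℚ.nonNegative⁻¹ (p *ℚ q) {{ℚ.nonNeg*nonNeg⇒nonNeg p {{ℚ.nonNegative 0≤p}} q {{ℚ.nonNegative 0≤q}}}}

+-nonNeg : ∀ {p q} → 0ℚ ≤ p → 0ℚ ≤ q → 0ℚ ≤ p +ℚ q
+-nonNeg 0≤p 0≤q = ℚ.+-mono-≤ 0≤p 0≤q

*-monoˡ-≤ : ∀ {r p q} → 0ℚ ≤ r → p ≤ q → r *ℚ p ≤ r *ℚ q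
*-monoˡ-≤ {r} 0≤r = ℚ.*-monoˡ-≤-nonNeg r {{ℚ.nonNegative 0≤r}}

*-monoʳ-≤ : ∀ {r p q} → 0ℚ ≤ r → p ≤ q → p *ℚ r ≤ q *ℚ r
*-monoʳ-≤ {r} 0≤r = ℚ.*-monoʳ-≤-nonNeg r {{ℚ.nonNegative 0≤r}}

*-cancelˡ-≤ : ∀ {r p q} → 0ℚ < r → r *ℚ p ≤ r *ℚ q → p ≤ q
*-cancelˡ-≤ {r} 0<r = ℚ.*-cancelˡ-≤-pos r {{ℚ.positive 0<r}}

0≤1 : 0ℚ ≤ 1ℚ
0≤1 = ℚ.nonNegative⁻¹ 1ℚ

0<1 : 0ℚ < 1ℚ
0<1 = ℚ.positive⁻¹ 1ℚ

-- Total inverse, with junk value 0 at nonpositive arguments.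
inv : ℚ → ℚ
inv p with 0ℚ ℚ.<? p
... | yes 0<p = (ℚ.1/ p) {{ℚ.pos⇒nonZero p {{ℚ.positive 0<p}}}}
... | no _    = 0ℚ

inv-inverseˡ : ∀ {p} → 0ℚ < p → inv p *ℚ p ≡ 1ℚ
inv-inverseˡ {p} 0<p with 0ℚ ℚ.<? p
... | yes 0<p′ = ℚ.*-inverseˡ p {{ℚ.pos⇒nonZero p {{ℚ.positive 0<p′}}}}
... | no 0≮p   = ⊥-elim (0≮p 0<p)

inv-pos : ∀ {p} → 0ℚ < p → 0ℚ < inv p
inv-pos {p} 0<p with 0ℚ ℚ.<? p
... | yes 0<p′ = ℚ.positive⁻¹ _ {{ℚ.1/pos⇒pos p {{ℚ.positive 0<p′}}}}
... | no 0≮p   = ⊥-elim (0≮p 0<p)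

-- At nonpositive `p` the junk value makes the product 0, so the bound survives. `𝔼-inv-μ` applies
-- it to a probability that may be zero.
*-inv≤1 : ∀ p → p *ℚ inv p ≤ 1ℚ
*-inv≤1 p with 0ℚ ℚ.<? p
... | yes 0<p = ℚ.≤-reflexive (ℚ.*-inverseʳ p {{ℚ.pos⇒nonZero p {{ℚ.positive 0<p}}}})
... | no _    = subst (_≤ 1ℚ) (sym (ℚ.*-zeroʳ p)) 0≤1

^ℚ-+ : ∀ x m n → x ^ℚ (m + n) ≡ (x ^ℚ m) *ℚ (x ^ℚ n)
^ℚ-+ x zero    n = sym (ℚ.*-identityˡ _)
^ℚ-+ x (suc m) n = trans (cong (x *ℚ_) (^ℚ-+ x m n)) (sym (ℚ.*-assoc x _ _))

^ℚ-pos : ∀ {x} n → 0ℚ < x → 0ℚ < x ^ℚ n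
^ℚ-pos zero    0<x = 0<1
^ℚ-pos (suc n) 0<x = *-pos 0<x (^ℚ-pos n 0<x)

-- The recursion mirrors `length`, which makes `∑-const` an induction; `ι≡/1` links it to the
-- fractions in `t`.
ι : ℕ → ℚ
ι zero    = 0ℚ
ι (suc n) = 1ℚ +ℚ ι n

ι-+ : ∀ m n → ι (m + n) ≡ ι m +ℚ ι n
ι-+ zero    n = sym (ℚ.+-identityˡ _)
ι-+ (suc m) n = trans (cong (1ℚ +ℚ_) (ι-+ m n)) (sym (ℚ.+-assoc 1ℚ (ι m) (ι n)))

ι-* : ∀ m n → ι (m * n) ≡ ι m *ℚ ι n
ι-* zero    n = sym (ℚ.*-zeroˡ (ι n))
ι-* (suc m) n = begin
  ι (n + m * n)            ≡⟨ ι-+ n (m * n) ⟩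
  ι n +ℚ ι (m * n)         ≡⟨ cong (ι n +ℚ_) (ι-* m n) ⟩
  ι n +ℚ ι m *ℚ ι n        ≡⟨ distrib (ι n) (ι m) ⟩
  (1ℚ +ℚ ι m) *ℚ ι n       ∎
  where
  open ≡-Reasoning
  distrib : ∀ x y → x +ℚ y *ℚ x ≡ (1ℚ +ℚ y) *ℚ x
  distrib = solve-∀ ringℚ

ι-^ : ∀ m n → ι (m ^ n) ≡ ι m ^ℚ n
ι-^ m zero    = refl
ι-^ m (suc n) = trans (ι-* m (m ^ n)) (cong (ι m *ℚ_) (ι-^ m n))

ι-nonNeg : ∀ n → 0ℚ ≤ ι n
ι-nonNeg zero    = ℚ.≤-refl
ι-nonNeg (suc n) = +-nonNeg 0≤1 (ι-nonNeg n)

ι-pos : ∀ n → .{{NonZero n}} → 0ℚ < ι n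
ι-pos (suc n) = ℚ.+-mono-<-≤ 0<1 (ι-nonNeg n)

ι≡/1 : ∀ n → ι n ≡ pos n / 1
ι≡/1 zero    = refl
ι≡/1 (suc n) = ℚ.toℚᵘ-injective (begin
  ℚ.toℚᵘ (1ℚ +ℚ ι n)                     ≈⟨ ℚ.toℚᵘ-homo-+ 1ℚ (ι n) ⟩
  ℚᵘ.1ℚᵘ ℚᵘ.+ ℚ.toℚᵘ (ι n)               ≡⟨ cong (λ q → ℚᵘ.1ℚᵘ ℚᵘ.+ ℚ.toℚᵘ q) (ι≡/1 n) ⟩
  ℚᵘ.1ℚᵘ ℚᵘ.+ ℚ.toℚᵘ (pos n / 1)           ≈⟨ ℚᵘ.+-congʳ ℚᵘ.1ℚᵘ (ℚ.toℚᵘ-fromℚᵘ (ℚᵘ.mkℚᵘ (pos n) 0)) ⟩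
  ℚᵘ.1ℚᵘ ℚᵘ.+ ℚᵘ.mkℚᵘ (pos n) 0            ≈⟨ ℚᵘ.*≡* (cong (ℤ._* pos 1) (cong (λ z → pos 1 ℤ.+ z) (ℤ.*-identityʳ (pos n)))) ⟩
  ℚᵘ.mkℚᵘ (pos (suc n)) 0                    ≈⟨ ℚ.toℚᵘ-fromℚᵘ (ℚᵘ.mkℚᵘ (pos (suc n)) 0) ⟨
  ℚ.toℚᵘ (pos (suc n) / 1)                   ∎)
  where open ℚᵘ.≃-Reasoning

-- Through `t-density` this turns densities into counts, so that the inequality can be proved with
-- denominators cleared.
/-*-cancel : ∀ m n .{{_ : NonZero n}} → (pos m / n) *ℚ ι n ≡ ι m
/-*-cancel m (suc n) = ℚ.toℚᵘ-injective (begin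
  ℚ.toℚᵘ ((pos m / suc n) *ℚ ι (suc n))                  ≈⟨ ℚ.toℚᵘ-homo-* (pos m / suc n) (ι (suc n)) ⟩
  ℚ.toℚᵘ (pos m / suc n) ℚᵘ.* ℚ.toℚᵘ (ι (suc n))         ≡⟨ cong (λ q → ℚ.toℚᵘ (pos m / suc n) ℚᵘ.* ℚ.toℚᵘ q) (ι≡/1 (suc n)) ⟩
  ℚ.toℚᵘ (pos m / suc n) ℚᵘ.* ℚ.toℚᵘ (pos (suc n) / 1)       ≈⟨ ℚᵘ.*-cong (ℚ.toℚᵘ-fromℚᵘ (ℚᵘ.mkℚᵘ (pos m) n)) (ℚ.toℚᵘ-fromℚᵘ (ℚᵘ.mkℚᵘ (pos (suc n)) 0)) ⟩
  ℚᵘ.mkℚᵘ (pos m) n ℚᵘ.* ℚᵘ.mkℚᵘ (pos (suc n)) 0             ≈⟨ ℚᵘ.*≡* (trans (ℤ.*-identityʳ (pos m ℤ.* pos (suc n))) (cong (λ k → pos m ℤ.* pos k) (sym (ℕ.*-identityʳ (suc n))))) ⟩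
  ℚᵘ.mkℚᵘ (pos m) 0                                      ≈⟨ ℚ.toℚᵘ-fromℚᵘ (ℚᵘ.mkℚᵘ (pos m) 0) ⟨
  ℚ.toℚᵘ (pos m / 1)                                     ≡⟨ cong ℚ.toℚᵘ (sym (ι≡/1 m)) ⟩
  ℚ.toℚᵘ (ι m)                                         ∎)
  where open ℚᵘ.≃-Reasoning

⟦_⟧ : Bool → ℚ
⟦ b ⟧ = if b then 1ℚ else 0ℚ

⟦⟧-nonNeg : ∀ b → 0ℚ ≤ ⟦ b ⟧
⟦⟧-nonNeg true  = 0≤1
⟦⟧-nonNeg false = ℚ.≤-refl

⟦⟧-∧ : ∀ a b → ⟦ a ∧ b ⟧ ≡ ⟦ a ⟧ *ℚ ⟦ b ⟧
⟦⟧-∧ true  b = sym (ℚ.*-identityˡ _)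
⟦⟧-∧ false b = sym (ℚ.*-zeroˡ ⟦ b ⟧)

-- An equality that holds only on an event may be used next to the indicator of that event.
⟦⟧-cong-* : ∀ b {x y} → (b ≡ true → x ≡ y) → ⟦ b ⟧ *ℚ x ≡ ⟦ b ⟧ *ℚ y
⟦⟧-cong-* true          e = cong (1ℚ *ℚ_) (e refl)
⟦⟧-cong-* false {x} {y} e = trans (ℚ.*-zeroˡ x) (sym (ℚ.*-zeroˡ y))

∑ : List A → (A → ℚ) → ℚ
∑ []       f = 0ℚ
∑ (x ∷ xs) f = f x +ℚ ∑ xs f

∏ : List A → (A → ℚ) → ℚ
∏ []       f = 1ℚ
∏ (x ∷ xs) f = f x *ℚ ∏ xs f

∑-cong : ∀ (xs : List A) {f g} → (∀ {x} → x ∈ xs → f x ≡ g x) → ∑ xs f ≡ ∑ xs g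
∑-cong []       e = refl
∑-cong (x ∷ xs) e = cong₂ _+ℚ_ (e (here refl)) (∑-cong xs (e ∘ there))

∑-mono : ∀ (xs : List A) {f g} → (∀ {x} → x ∈ xs → f x ≤ g x) → ∑ xs f ≤ ∑ xs g
∑-mono []       e = ℚ.≤-refl
∑-mono (x ∷ xs) e = ℚ.+-mono-≤ (e (here refl)) (∑-mono xs (e ∘ there))

∑-zero : ∀ (xs : List A) → ∑ xs (λ _ → 0ℚ) ≡ 0ℚ
∑-zero []       = refl
∑-zero (x ∷ xs) = trans (ℚ.+-identityˡ _) (∑-zero xs)

∑-nonNeg : ∀ (xs : List A) {f} → (∀ {x} → x ∈ xs → 0ℚ ≤ f x) → 0ℚ ≤ ∑ xs f
∑-nonNeg xs e = subst (_≤ ∑ xs _) (∑-zero xs) (∑-mono xs e)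

term≤∑ : ∀ (xs : List A) {f y} → (∀ {x} → x ∈ xs → 0ℚ ≤ f x) → y ∈ xs → f y ≤ ∑ xs f
term≤∑ (x ∷ xs) {f} e (here refl) =
  subst (_≤ ∑ (x ∷ xs) f) (ℚ.+-identityʳ (f x)) (ℚ.+-monoʳ-≤ (f x) (∑-nonNeg xs (e ∘ there)))
term≤∑ (x ∷ xs) {f} {y} e (there m) =
  subst (_≤ ∑ (x ∷ xs) f) (ℚ.+-identityˡ (f y)) (ℚ.+-mono-≤ (e (here refl)) (term≤∑ xs (e ∘ there) m))

∑-+ : ∀ (xs : List A) f g → ∑ xs (λ x → f x +ℚ g x) ≡ ∑ xs f +ℚ ∑ xs g
∑-+ []       f g = refl
∑-+ (x ∷ xs) f g = trans (cong (f x +ℚ g x +ℚ_) (∑-+ xs f g)) (interchange (f x) (g x) _ _)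
  where
  interchange : ∀ a b c d → (a +ℚ b) +ℚ (c +ℚ d) ≡ (a +ℚ c) +ℚ (b +ℚ d)
  interchange = solve-∀ ringℚ

∑-*ˡ : ∀ (xs : List A) c f → ∑ xs (λ x → c *ℚ f x) ≡ c *ℚ ∑ xs f
∑-*ˡ []       c f = sym (ℚ.*-zeroʳ c)
∑-*ˡ (x ∷ xs) c f = trans (cong (c *ℚ f x +ℚ_) (∑-*ˡ xs c f)) (sym (ℚ.*-distribˡ-+ c _ _))

∑-*ʳ : ∀ (xs : List A) c f → ∑ xs (λ x → f x *ℚ c) ≡ ∑ xs f *ℚ c
∑-*ʳ xs c f = trans (∑-cong xs (λ {x} _ → ℚ.*-comm (f x) c)) (trans (∑-*ˡ xs c f) (ℚ.*-comm c _))

∑-swap : ∀ (xs : List A) (ys : List C) (f : A → C → ℚ) → ∑ xs (λ x → ∑ ys (f x)) ≡ ∑ ys (λ y → ∑ xs (λ x → f x y))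
∑-swap []       ys f = sym (∑-zero ys)
∑-swap (x ∷ xs) ys f = trans (cong (∑ ys (f x) +ℚ_) (∑-swap xs ys f)) (sym (∑-+ ys (f x) _))

∑-++ : ∀ (xs ys : List A) f → ∑ (xs List.++ ys) f ≡ ∑ xs f +ℚ ∑ ys f
∑-++ []       ys f = sym (ℚ.+-identityˡ _)
∑-++ (x ∷ xs) ys f = trans (cong (f x +ℚ_) (∑-++ xs ys f)) (sym (ℚ.+-assoc (f x) _ _))

∑-map : ∀ (g : A → C) (xs : List A) f → ∑ (map g xs) f ≡ ∑ xs (f ∘ g)
∑-map g []       f = refl
∑-map g (x ∷ xs) f = cong (f (g x) +ℚ_) (∑-map g xs f)

∑-↭ : ∀ {xs ys : List A} → xs ↭ ys → ∀ f → ∑ xs f ≡ ∑ ys f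
∑-↭ Perm.refl          f = refl
∑-↭ (Perm.prep x p)    f = cong (f x +ℚ_) (∑-↭ p f)
∑-↭ (Perm.swap x y p)  f = trans (cong (λ s → f x +ℚ (f y +ℚ s)) (∑-↭ p f)) (swap (f x) (f y) _)
  where
  swap : ∀ a b c → a +ℚ (b +ℚ c) ≡ b +ℚ (a +ℚ c)
  swap = solve-∀ ringℚ
∑-↭ (Perm.trans p q)   f = trans (∑-↭ p f) (∑-↭ q f)

∑-concatMap : ∀ (g : A → List C) (xs : List A) f → ∑ (concatMap g xs) f ≡ ∑ xs (λ x → ∑ (g x) f)
∑-concatMap g []       f = refl
∑-concatMap g (x ∷ xs) f = trans (∑-++ (g x) _ f) (cong (∑ (g x) f +ℚ_) (∑-concatMap g xs f))

∑-cartesianProduct : ∀ (xs : List A) (ys : List C) f →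
  ∑ (cartesianProduct xs ys) f ≡ ∑ xs (λ x → ∑ ys (λ y → f (x , y)))
∑-cartesianProduct []       ys f = refl
∑-cartesianProduct (x ∷ xs) ys f =
  trans (∑-++ (map (x ,_) ys) _ f) (cong₂ _+ℚ_ (∑-map (x ,_) ys f) (∑-cartesianProduct xs ys f))

∑-filter : ∀ (p : A → Bool) (xs : List A) f →
  ∑ (filter (λ x → p x Bool.≟ true) xs) f ≡ ∑ xs (λ x → ⟦ p x ⟧ *ℚ f x)
∑-filter p []       f = refl
∑-filter p (x ∷ xs) f with p x
... | true  = cong₂ _+ℚ_ (sym (ℚ.*-identityˡ (f x))) (∑-filter p xs f)
... | false = trans (∑-filter p xs f) (trans (sym (ℚ.+-identityˡ _)) (cong (_+ℚ _) (sym (ℚ.*-zeroˡ (f x)))))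

∑-const : ∀ (xs : List A) c → ∑ xs (λ _ → c) ≡ ι (length xs) *ℚ c
∑-const []       c = sym (ℚ.*-zeroˡ c)
∑-const (x ∷ xs) c = trans (cong (c +ℚ_) (∑-const xs c)) (distrib c (ι (length xs)))
  where
  distrib : ∀ c l → c +ℚ l *ℚ c ≡ (1ℚ +ℚ l) *ℚ c
  distrib = solve-∀ ringℚ

∏-++ : ∀ (xs ys : List A) f → ∏ (xs List.++ ys) f ≡ ∏ xs f *ℚ ∏ ys f
∏-++ []       ys f = sym (ℚ.*-identityˡ _)
∏-++ (x ∷ xs) ys f = trans (cong (f x *ℚ_) (∏-++ xs ys f)) (sym (ℚ.*-assoc (f x) _ _))

∏-map : ∀ (g : A → C) (xs : List A) f → ∏ (map g xs) f ≡ ∏ xs (f ∘ g)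
∏-map g []       f = refl
∏-map g (x ∷ xs) f = cong (f (g x) *ℚ_) (∏-map g xs f)

∏-pos : ∀ (xs : List A) {f} → All (λ x → 0ℚ < f x) xs → 0ℚ < ∏ xs f
∏-pos []       []       = 0<1
∏-pos (x ∷ xs) (p ∷ ps) = *-pos p (∏-pos xs ps)

-- AM-GM without roots, for positive rationals with product one

module AM-GM where
  private
    0≤q-p : ∀ {p q} → p ≤ q → 0ℚ ≤ q -ℚ p
    0≤q-p {p} {q} p≤q = subst (_≤ q -ℚ p) (ℚ.+-inverseʳ p) (ℚ.+-monoˡ-≤ (- p) p≤q)

    +-cancel-≤ : ∀ {p q} → 0ℚ ≤ q -ℚ p → p ≤ q
    +-cancel-≤ {p} {q} h = subst₂ _≤_ (ℚ.+-identityˡ p) (minus-plus p q) (ℚ.+-monoˡ-≤ p h)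
      where
      minus-plus : ∀ p q → (q -ℚ p) +ℚ p ≡ q
      minus-plus = solve-∀ ringℚ

    -- (c − 1)(1 − b) ≥ 0
    merge : ∀ {c b} → 1ℚ ≤ c → b ≤ 1ℚ → 1ℚ +ℚ c *ℚ b ≤ c +ℚ b
    merge {c} {b} 1≤c b≤1 =
      +-cancel-≤ (subst (0ℚ ≤_) (expand c b) (*-nonNeg (0≤q-p 1≤c) (0≤q-p b≤1)))
      where
      expand : ∀ c b → (c -ℚ 1ℚ) *ℚ (1ℚ -ℚ b) ≡ (c +ℚ b) -ℚ (1ℚ +ℚ c *ℚ b)
      expand = solve-∀ ringℚ

    Small : ℚ → Set
    Small b = 0ℚ < b × b ≤ 1ℚ

    product≤1 : ∀ bs → All Small bs → ∏ bs id ≤ 1ℚ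
    product≤1 []       []              = ℚ.≤-refl
    product≤1 (b ∷ bs) ((0<b , b≤1) ∷ sm) =
      ℚ.≤-trans (*-monoˡ-≤ (ℚ.<⇒≤ 0<b) (product≤1 bs sm)) (subst (_≤ 1ℚ) (sym (ℚ.*-identityʳ b)) b≤1)

    0<small : ∀ bs → All Small bs → 0ℚ < ∏ bs id
    0<small bs sm = ∏-pos bs (All.map proj₁ sm)

    1≤factors : ∀ {x y} → 0ℚ < x → 0ℚ < y → x ≤ 1ℚ → y ≤ 1ℚ → 1ℚ ≤ x *ℚ y → 1ℚ ≤ x × 1ℚ ≤ y
    1≤factors {x} {y} 0<x 0<y x≤1 y≤1 1≤xy =
      ℚ.≤-trans 1≤xy (subst (x *ℚ y ≤_) (ℚ.*-identityʳ x) (*-monoˡ-≤ (ℚ.<⇒≤ 0<x) y≤1)) ,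
      ℚ.≤-trans 1≤xy (subst (x *ℚ y ≤_) (ℚ.*-identityˡ y) (*-monoʳ-≤ (ℚ.<⇒≤ 0<y) x≤1))

    -- Factors at most 1 whose product is at least 1 must each be at least 1.
    all-small : ∀ bs → All Small bs → 1ℚ ≤ ∏ bs id → ι (length bs) ≤ ∑ bs id
    all-small []       _                    h = ℚ.≤-refl
    all-small (b ∷ bs) ((0<b , b≤1) ∷ sm) h =
      let 1≤b , 1≤∏ = 1≤factors 0<b (0<small bs sm) b≤1 (product≤1 bs sm) h
      in ℚ.+-mono-≤ 1≤b (all-small bs sm 1≤∏)

    all-large : ∀ as → All (1ℚ ≤_) as → ι (length as) ≤ ∑ as id
    all-large []       []       = ℚ.≤-refl
    all-large (a ∷ as) (p ∷ ps) = ℚ.+-mono-≤ p (all-large as ps)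

    -- A large and a small factor may be replaced by their product and 1 without
    -- increasing the sum; c accumulates such products.
    go : ∀ c as bs → 0ℚ < c → All (1ℚ ≤_) as → All Small bs →
         1ℚ ≤ c *ℚ (∏ as id *ℚ ∏ bs id) →
         1ℚ +ℚ (ι (length as) +ℚ ι (length bs)) ≤ c +ℚ (∑ as id +ℚ ∑ bs id)
    -- `c` is paired with an entry on the other side of 1, so each call shortens one list. Once that
    -- list is empty, everything left lies on the same side as `c`: large entries are bounded
    -- termwise, small ones are forced up to 1 by the product.
    go c as bs 0<c la sm h with ℚ.≤-total 1ℚ c
    go c as [] 0<c la sm h | inj₁ 1≤c =
      ℚ.+-mono-≤ 1≤c (ℚ.+-monoˡ-≤ 0ℚ (all-large as la))
    go c as (b ∷ bs) 0<c la ((0<b , b≤1) ∷ sm) h | inj₁ 1≤c = begin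
      1ℚ +ℚ (ι (length as) +ℚ (1ℚ +ℚ ι (length bs)))  ≡⟨ pull 1ℚ (ι (length as)) 1ℚ (ι (length bs)) ⟩
      1ℚ +ℚ (1ℚ +ℚ (ι (length as) +ℚ ι (length bs)))
        ≤⟨ ℚ.+-monoʳ-≤ 1ℚ (go (c *ℚ b) as bs (*-pos 0<c 0<b) la sm (subst (1ℚ ≤_) (regroup c (∏ as id) b (∏ bs id)) h)) ⟩
      1ℚ +ℚ (c *ℚ b +ℚ (∑ as id +ℚ ∑ bs id))          ≡⟨ ℚ.+-assoc 1ℚ (c *ℚ b) _ ⟨
      (1ℚ +ℚ c *ℚ b) +ℚ (∑ as id +ℚ ∑ bs id)          ≤⟨ ℚ.+-monoˡ-≤ _ (merge 1≤c b≤1) ⟩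
      (c +ℚ b) +ℚ (∑ as id +ℚ ∑ bs id)                ≡⟨ push c b (∑ as id) (∑ bs id) ⟩
      c +ℚ (∑ as id +ℚ (b +ℚ ∑ bs id))                ∎
      where
      open ℚ.≤-Reasoning
      pull : ∀ o x p y → o +ℚ (x +ℚ (p +ℚ y)) ≡ o +ℚ (p +ℚ (x +ℚ y))
      pull = solve-∀ ringℚ
      regroup : ∀ c x b y → c *ℚ (x *ℚ (b *ℚ y)) ≡ (c *ℚ b) *ℚ (x *ℚ y)
      regroup = solve-∀ ringℚ
      push : ∀ c b x y → (c +ℚ b) +ℚ (x +ℚ y) ≡ c +ℚ (x +ℚ (b +ℚ y))
      push = solve-∀ ringℚ
    go c [] bs 0<c la sm h | inj₂ c≤1 =
      let 1≤c , 1≤∏ = 1≤factors 0<c (0<small bs sm) c≤1 (product≤1 bs sm)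
                        (subst (λ q → 1ℚ ≤ c *ℚ q) (ℚ.*-identityˡ _) h)
      in ℚ.+-mono-≤ 1≤c (ℚ.+-monoʳ-≤ 0ℚ (all-small bs sm 1≤∏))
    go c (a ∷ as) bs 0<c (1≤a ∷ la) sm h | inj₂ c≤1 = begin
      1ℚ +ℚ ((1ℚ +ℚ ι (length as)) +ℚ ι (length bs))  ≡⟨ cong (1ℚ +ℚ_) (ℚ.+-assoc 1ℚ (ι (length as)) _) ⟩
      1ℚ +ℚ (1ℚ +ℚ (ι (length as) +ℚ ι (length bs)))
        ≤⟨ ℚ.+-monoʳ-≤ 1ℚ (go (a *ℚ c) as bs (*-pos (ℚ.<-≤-trans 0<1 1≤a) 0<c) la sm (subst (1ℚ ≤_) (regroup c a (∏ as id) (∏ bs id)) h)) ⟩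
      1ℚ +ℚ (a *ℚ c +ℚ (∑ as id +ℚ ∑ bs id))          ≡⟨ ℚ.+-assoc 1ℚ (a *ℚ c) _ ⟨
      (1ℚ +ℚ a *ℚ c) +ℚ (∑ as id +ℚ ∑ bs id)          ≤⟨ ℚ.+-monoˡ-≤ _ (merge 1≤a c≤1) ⟩
      (a +ℚ c) +ℚ (∑ as id +ℚ ∑ bs id)                ≡⟨ push a c (∑ as id) (∑ bs id) ⟩
      c +ℚ ((a +ℚ ∑ as id) +ℚ ∑ bs id)                ∎
      where
      open ℚ.≤-Reasoning
      regroup : ∀ c a x y → c *ℚ ((a *ℚ x) *ℚ y) ≡ (a *ℚ c) *ℚ (x *ℚ y)
      regroup = solve-∀ ringℚ
      push : ∀ a c x y → (a +ℚ c) +ℚ (x +ℚ y) ≡ c +ℚ ((a +ℚ x) +ℚ y)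
      push = solve-∀ ringℚ

    -- Moves each entry of `xs` to the list for its side of 1, carrying the product bound along,
    -- until `go` applies; `c` is kept apart as the initial accumulator.
    distribute : ∀ c as bs xs → 0ℚ < c → All (1ℚ ≤_) as → All Small bs → All (0ℚ <_) xs →
         1ℚ ≤ c *ℚ (∏ as id *ℚ (∏ bs id *ℚ ∏ xs id)) →
         1ℚ +ℚ (ι (length as) +ℚ (ι (length bs) +ℚ ι (length xs))) ≤ c +ℚ (∑ as id +ℚ (∑ bs id +ℚ ∑ xs id))
    distribute c as bs [] 0<c la sm ps h =
      subst₂ _≤_ (cong (λ q → 1ℚ +ℚ (ι (length as) +ℚ q)) (sym (ℚ.+-identityʳ _)))
                 (cong (λ q → c +ℚ (∑ as id +ℚ q)) (sym (ℚ.+-identityʳ _)))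
        (go c as bs 0<c la sm (subst (λ q → 1ℚ ≤ c *ℚ (∏ as id *ℚ q)) (ℚ.*-identityʳ _) h))
    distribute c as bs (x ∷ xs) 0<c la sm (0<x ∷ ps) h with ℚ.≤-total 1ℚ x
    ... | inj₁ 1≤x = subst₂ _≤_ (cong (1ℚ +ℚ_) (move+ 1ℚ (ι (length as)) (ι (length bs)) (ι (length xs))))
                                (cong (c +ℚ_) (move+ x (∑ as id) (∑ bs id) (∑ xs id)))
        (distribute c (x ∷ as) bs xs 0<c (1≤x ∷ la) sm ps
          (subst (λ q → 1ℚ ≤ c *ℚ q) (sym (move* x (∏ as id) (∏ bs id) (∏ xs id))) h))
      where
      move+ : ∀ x a b y → (x +ℚ a) +ℚ (b +ℚ y) ≡ a +ℚ (b +ℚ (x +ℚ y))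
      move+ = solve-∀ ringℚ
      move* : ∀ x a b y → (x *ℚ a) *ℚ (b *ℚ y) ≡ a *ℚ (b *ℚ (x *ℚ y))
      move* = solve-∀ ringℚ
    ... | inj₂ x≤1 = subst₂ _≤_ (cong (λ q → 1ℚ +ℚ (ι (length as) +ℚ q)) (move+ 1ℚ (ι (length bs)) (ι (length xs))))
                                (cong (λ q → c +ℚ (∑ as id +ℚ q)) (move+ x (∑ bs id) (∑ xs id)))
        (distribute c as (x ∷ bs) xs 0<c la ((0<x , x≤1) ∷ sm) ps
          (subst (λ q → 1ℚ ≤ c *ℚ (∏ as id *ℚ q)) (sym (move* x (∏ bs id) (∏ xs id))) h))
      where
      move+ : ∀ x b y → (x +ℚ b) +ℚ y ≡ b +ℚ (x +ℚ y)
      move+ = solve-∀ ringℚ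
      move* : ∀ x b y → (x *ℚ b) *ℚ y ≡ b *ℚ (x *ℚ y)
      move* = solve-∀ ringℚ

  -- The geometric mean of `c` and the entries of `xs` is 1, so AM-GM compares their sum with their
  -- number. Keeping `c` apart singles out the term whose expectation will be bounded below.
  product-one⇒length≤sum : ∀ c xs → 0ℚ < c → All (0ℚ <_) xs → c *ℚ ∏ xs id ≡ 1ℚ →
                           1ℚ +ℚ ι (length xs) ≤ c +ℚ ∑ xs id
  product-one⇒length≤sum c xs 0<c ps h =
    subst₂ _≤_ (cong (1ℚ +ℚ_) (zeros (ι (length xs)))) (cong (c +ℚ_) (zeros (∑ xs id)))
      (distribute c [] [] xs 0<c [] [] ps (ℚ.≤-reflexive (sym (trans (cong (c *ℚ_) (ones (∏ xs id))) h))))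
    where
    zeros : ∀ q → 0ℚ +ℚ (0ℚ +ℚ q) ≡ q
    zeros = solve-∀ ringℚ
    ones : ∀ q → 1ℚ *ℚ (1ℚ *ℚ q) ≡ q
    ones = solve-∀ ringℚ

-- Subsets

∧-true⁻ : ∀ {a b} → a ∧ b ≡ true → a ≡ true × b ≡ true
∧-true⁻ {true} {true} refl = refl , refl

∧-true⁺ : ∀ {a b} → a ≡ true → b ≡ true → a ∧ b ≡ true
∧-true⁺ refl refl = refl

∨-true⁻ : ∀ {a b} → a ∨ b ≡ true → a ≡ true ⊎ b ≡ true
∨-true⁻ {true}  h = inj₁ refl
∨-true⁻ {false} h = inj₂ h

∨-true⁺ˡ : ∀ {a b} → a ≡ true → a ∨ b ≡ true
∨-true⁺ˡ refl = refl

∨-true⁺ʳ : ∀ {a b} → b ≡ true → a ∨ b ≡ true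
∨-true⁺ʳ {a} refl = Bool.∨-zeroʳ a

bool-ext : ∀ {a b} → (a ≡ true → b ≡ true) → (b ≡ true → a ≡ true) → a ≡ b
bool-ext {true}          f g = sym (f refl)
bool-ext {false} {true}  f g = g refl
bool-ext {false} {false} f g = refl

any⁺ : ∀ {A : Set} (p : A → Bool) {xs x} → x ∈ xs → p x ≡ true → any p xs ≡ true
any⁺ p (here refl) h = ∨-true⁺ˡ h
any⁺ p {y ∷ _} (there m) h = ∨-true⁺ʳ {p y} (any⁺ p m h)

any⁻ : ∀ {A : Set} (p : A → Bool) xs → any p xs ≡ true → ∃ λ x → x ∈ xs × p x ≡ true
any⁻ p (x ∷ xs) h with ∨-true⁻ {p x} h
... | inj₁ px = x , here refl , px
... | inj₂ h′ = let y , m , py = any⁻ p xs h′ in y , there m , py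

all⁺ : ∀ {A : Set} (p : A → Bool) xs → (∀ {x} → x ∈ xs → p x ≡ true) → all p xs ≡ true
all⁺ p []       f = refl
all⁺ p (x ∷ xs) f = ∧-true⁺ (f (here refl)) (all⁺ p xs (f ∘ there))

all⁻ : ∀ {A : Set} (p : A → Bool) {xs x} → all p xs ≡ true → x ∈ xs → p x ≡ true
all⁻ p h (here refl) = proj₁ (∧-true⁻ h)
all⁻ p {y ∷ _} h (there m) = all⁻ p (proj₂ (∧-true⁻ {p y} h)) m

infix 4 _⊆_
_⊆_ : ∀ {n} → Subset n → Subset n → Set
S ⊆ T = S ⊆ᵇ T ≡ true

=ˢ⇒≡ : ∀ {n} (S T : Subset n) → (S =ˢ T) ≡ true → S ≡ T
=ˢ⇒≡ []          []          h = refl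
=ˢ⇒≡ (true ∷ S)  (true ∷ T)  h = cong (true ∷_) (=ˢ⇒≡ S T h)
=ˢ⇒≡ (false ∷ S) (false ∷ T) h = cong (false ∷_) (=ˢ⇒≡ S T h)

=ˢ-refl : ∀ {n} (S : Subset n) → (S =ˢ S) ≡ true
=ˢ-refl []          = refl
=ˢ-refl (true ∷ S)  = =ˢ-refl S
=ˢ-refl (false ∷ S) = =ˢ-refl S

⊆-refl : ∀ {n} (S : Subset n) → S ⊆ S
⊆-refl []          = refl
⊆-refl (true ∷ S)  = ⊆-refl S
⊆-refl (false ∷ S) = ⊆-refl S

⊆-reflexive : ∀ {n} {S T : Subset n} → S ≡ T → S ⊆ T
⊆-reflexive {S = S} refl = ⊆-refl S

⊆-trans : ∀ {n} {S T U : Subset n} → S ⊆ T → T ⊆ U → S ⊆ U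
⊆-trans {S = []}        {[]}         {[]}        p q = refl
⊆-trans {S = true ∷ S}  {true ∷ T}   {true ∷ U}  p q = ⊆-trans {S = S} p q
⊆-trans {S = false ∷ S} {true ∷ T}   {true ∷ U}  p q = ⊆-trans {S = S} p q
⊆-trans {S = false ∷ S} {false ∷ T}  {u ∷ U}     p q = ⊆-trans {S = S} p q

⊆-antisym : ∀ {n} {S T : Subset n} → S ⊆ T → T ⊆ S → S ≡ T
⊆-antisym {S = []}        {[]}        p q = refl
⊆-antisym {S = true ∷ S}  {true ∷ T}  p q = cong (true ∷_) (⊆-antisym p q)
⊆-antisym {S = false ∷ S} {false ∷ T} p q = cong (false ∷_) (⊆-antisym p q)

⊆-full : ∀ {n} (S : Subset n) → S ⊆ fullˢ
⊆-full []          = refl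
⊆-full (true ∷ S)  = ⊆-full S
⊆-full (false ∷ S) = ⊆-full S

∅-⊆ : ∀ {n} (S : Subset n) → emptyˢ ⊆ S
∅-⊆ []      = refl
∅-⊆ (_ ∷ S) = ∅-⊆ S

∩-⊆ˡ : ∀ {n} (S T : Subset n) → (S ∩ˢ T) ⊆ S
∩-⊆ˡ []          []          = refl
∩-⊆ˡ (true ∷ S)  (true ∷ T)  = ∩-⊆ˡ S T
∩-⊆ˡ (true ∷ S)  (false ∷ T) = ∩-⊆ˡ S T
∩-⊆ˡ (false ∷ S) (_ ∷ T)     = ∩-⊆ˡ S T

∩-comm : ∀ {n} (S T : Subset n) → S ∩ˢ T ≡ T ∩ˢ S
∩-comm []      []      = refl
∩-comm (a ∷ S) (b ∷ T) = cong₂ _∷_ (Bool.∧-comm a b) (∩-comm S T)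

∩-⊆ʳ : ∀ {n} (S T : Subset n) → (S ∩ˢ T) ⊆ T
∩-⊆ʳ S T = subst (_⊆ T) (∩-comm T S) (∩-⊆ˡ T S)

⊆⇒∩ : ∀ {n} {S T : Subset n} → S ⊆ T → S ∩ˢ T ≡ S
⊆⇒∩ {S = []}        {[]}        h = refl
⊆⇒∩ {S = true ∷ S}  {true ∷ T}  h = cong (true ∷_) (⊆⇒∩ h)
⊆⇒∩ {S = false ∷ S} {_ ∷ T}     h = cong (false ∷_) (⊆⇒∩ {S = S} h)

∩-monoˡ : ∀ {n} {S T : Subset n} (U : Subset n) → S ⊆ T → (S ∩ˢ U) ⊆ (T ∩ˢ U)
∩-monoˡ {S = []}        {[]}       []          h = refl
∩-monoˡ {S = true ∷ S}  {true ∷ T} (true ∷ U)  h = ∩-monoˡ {S = S} U h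
∩-monoˡ {S = true ∷ S}  {true ∷ T} (false ∷ U) h = ∩-monoˡ {S = S} U h
∩-monoˡ {S = false ∷ S} {_ ∷ T}    (_ ∷ U)     h = ∩-monoˡ {S = S} U h

⊆-∪ˡ : ∀ {n} (S T : Subset n) → S ⊆ (S ∪ˢ T)
⊆-∪ˡ []          []      = refl
⊆-∪ˡ (true ∷ S)  (_ ∷ T) = ⊆-∪ˡ S T
⊆-∪ˡ (false ∷ S) (_ ∷ T) = ⊆-∪ˡ S T

∪-comm : ∀ {n} (S T : Subset n) → S ∪ˢ T ≡ T ∪ˢ S
∪-comm []      []      = refl
∪-comm (a ∷ S) (b ∷ T) = cong₂ _∷_ (Bool.∨-comm a b) (∪-comm S T)

⊆-∪ʳ : ∀ {n} (S T : Subset n) → T ⊆ (S ∪ˢ T)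
⊆-∪ʳ S T = subst (T ⊆_) (∪-comm T S) (⊆-∪ˡ T S)

⊆⇒∪ : ∀ {n} {S T : Subset n} → T ⊆ S → S ∪ˢ T ≡ S
⊆⇒∪ {S = []}        {[]}        h = refl
⊆⇒∪ {S = true ∷ S}  {_ ∷ T}     h = cong (true ∷_) (⊆⇒∪ (tail-⊆ T h))
  where
  tail-⊆ : ∀ {n b} {S : Subset n} T → ((b ∷ T) ⊆ (true ∷ S)) → T ⊆ S
  tail-⊆ {b = true}  T h = h
  tail-⊆ {b = false} T h = h
⊆⇒∪ {S = false ∷ S} {false ∷ T} h = cong (false ∷_) (⊆⇒∪ {S = S} h)

∪-identityˡ : ∀ {n} (S : Subset n) → emptyˢ ∪ˢ S ≡ S
∪-identityˡ []      = refl
∪-identityˡ (_ ∷ S) = cong (_ ∷_) (∪-identityˡ S)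

∩-zeroˡ : ∀ {n} (S : Subset n) → emptyˢ ∩ˢ S ≡ emptyˢ
∩-zeroˡ []      = refl
∩-zeroˡ (_ ∷ S) = cong (false ∷_) (∩-zeroˡ S)

∩-distribʳ-∪ : ∀ {n} (S T U : Subset n) → (S ∪ˢ T) ∩ˢ U ≡ (S ∩ˢ U) ∪ˢ (T ∩ˢ U)
∩-distribʳ-∪ []      []      []      = refl
∩-distribʳ-∪ (a ∷ S) (b ∷ T) (c ∷ U) = cong₂ _∷_ (Bool.∧-distribʳ-∨ c a b) (∩-distribʳ-∪ S T U)

∩-distribʳ-∩ : ∀ {n} (S T U : Subset n) → (S ∩ˢ T) ∩ˢ U ≡ (S ∩ˢ U) ∩ˢ (T ∩ˢ U)
∩-distribʳ-∩ []          []      []          = refl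
∩-distribʳ-∩ (true ∷ S)  (b ∷ T) (c ∷ U)     = cong₂ _∷_ (absorb b c) (∩-distribʳ-∩ S T U)
  where
  absorb : ∀ b c → b ∧ c ≡ c ∧ (b ∧ c)
  absorb b true  = refl
  absorb b false = Bool.∧-zeroʳ b
∩-distribʳ-∩ (false ∷ S) (_ ∷ T) (_ ∷ U)     = cong (false ∷_) (∩-distribʳ-∩ S T U)

++-∪ : ∀ {m n} (S T : Subset m) (S′ T′ : Subset n) → (S ++ S′) ∪ˢ (T ++ T′) ≡ (S ∪ˢ T) ++ (S′ ∪ˢ T′)
++-∪ []      []      S′ T′ = refl
++-∪ (_ ∷ S) (_ ∷ T) S′ T′ = cong (_ ∷_) (++-∪ S T S′ T′)

++-∩ : ∀ {m n} (S T : Subset m) (S′ T′ : Subset n) → (S ++ S′) ∩ˢ (T ++ T′) ≡ (S ∩ˢ T) ++ (S′ ∩ˢ T′)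
++-∩ []      []      S′ T′ = refl
++-∩ (_ ∷ S) (_ ∷ T) S′ T′ = cong (_ ∷_) (++-∩ S T S′ T′)

++-⊆ᵇ : ∀ {m n} (S T : Subset m) {S′ T′ : Subset n} → (S ++ S′) ⊆ᵇ (T ++ T′) ≡ (S ⊆ᵇ T) ∧ (S′ ⊆ᵇ T′)
++-⊆ᵇ []      []      = refl
++-⊆ᵇ (a ∷ S) (b ∷ T) = trans (cong ((not a ∨ b) ∧_) (++-⊆ᵇ S T)) (sym (Bool.∧-assoc (not a ∨ b) _ _))

++-⊆⁺ : ∀ {m n} {S T : Subset m} {S′ T′ : Subset n} → S ⊆ T → S′ ⊆ T′ → (S ++ S′) ⊆ (T ++ T′)
++-⊆⁺ {S = S} {T} p q = trans (++-⊆ᵇ S T) (∧-true⁺ p q)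

++-⊆⁻ : ∀ {m n} (S T : Subset m) {S′ T′ : Subset n} → (S ++ S′) ⊆ (T ++ T′) → S ⊆ T × S′ ⊆ T′
++-⊆⁻ S T h = ∧-true⁻ (trans (sym (++-⊆ᵇ S T)) h)

++-full : ∀ m n → fullˢ {m} ++ fullˢ {n} ≡ fullˢ
++-full zero    n = refl
++-full (suc m) n = cong (true ∷_) (++-full m n)

++-empty : ∀ m n → emptyˢ {m} ++ emptyˢ {n} ≡ emptyˢ
++-empty zero    n = refl
++-empty (suc m) n = cong (false ∷_) (++-empty m n)

restrict-∪ : ∀ {n} (D S T : Subset n) → restrict D (S ∪ˢ T) ≡ restrict D S ∪ˢ restrict D T
restrict-∪ []          []      []      = refl
restrict-∪ (true ∷ D)  (_ ∷ S) (_ ∷ T) = cong (_ ∷_) (restrict-∪ D S T)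
restrict-∪ (false ∷ D) (_ ∷ S) (_ ∷ T) = restrict-∪ D S T

restrict-∩ : ∀ {n} (D S T : Subset n) → restrict D (S ∩ˢ T) ≡ restrict D S ∩ˢ restrict D T
restrict-∩ []          []      []      = refl
restrict-∩ (true ∷ D)  (_ ∷ S) (_ ∷ T) = cong (_ ∷_) (restrict-∩ D S T)
restrict-∩ (false ∷ D) (_ ∷ S) (_ ∷ T) = restrict-∩ D S T

restrict-∅ : ∀ {n} (D : Subset n) → restrict D emptyˢ ≡ emptyˢ
restrict-∅ []          = refl
restrict-∅ (true ∷ D)  = cong (false ∷_) (restrict-∅ D)
restrict-∅ (false ∷ D) = restrict-∅ D

restrict-⊆ᵇ : ∀ {n} (D S T : Subset n) → restrict D S ⊆ᵇ restrict D T ≡ (S ∩ˢ D) ⊆ᵇ T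
restrict-⊆ᵇ []          []          []      = refl
restrict-⊆ᵇ (true ∷ D)  (true ∷ S)  (b ∷ T) = cong (b ∧_) (restrict-⊆ᵇ D S T)
restrict-⊆ᵇ (true ∷ D)  (false ∷ S) (_ ∷ T) = restrict-⊆ᵇ D S T
restrict-⊆ᵇ (false ∷ D) (true ∷ S)  (_ ∷ T) = restrict-⊆ᵇ D S T
restrict-⊆ᵇ (false ∷ D) (false ∷ S) (_ ∷ T) = restrict-⊆ᵇ D S T

restrict-injective : ∀ {n} {D S T : Subset n} → S ⊆ D → T ⊆ D → restrict D S ≡ restrict D T → S ≡ T
restrict-injective {D = D} {S} {T} S⊆D T⊆D e = ⊆-antisym (half S T S⊆D e) (half T S T⊆D (sym e))
  where
  half : ∀ S T → S ⊆ D → restrict D S ≡ restrict D T → S ⊆ T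
  half S T S⊆D e = subst (_⊆ T) (⊆⇒∩ {S = S} {D} S⊆D) (trans (sym (restrict-⊆ᵇ D S T)) (⊆-reflexive e))

-- A second copy consists of two blocks, the trace on `X` and the restriction to `L ∖ˢ X`. For
-- subsets of `L` the two blocks together decide inclusion.
⊆-split : ∀ {n} {S L T : Subset n} (X : Subset n) →
          S ⊆ L → (S ∩ˢ X) ⊆ T → (S ∩ˢ (L ∖ˢ X)) ⊆ T → S ⊆ T
⊆-split {S = []}        {[]}       {[]}        []          l p q = refl
⊆-split {S = true ∷ S}  {true ∷ L} {true ∷ T}  (true ∷ X)  l p q = ⊆-split {S = S} X l p q
⊆-split {S = true ∷ S}  {true ∷ L} {true ∷ T}  (false ∷ X) l p q = ⊆-split {S = S} X l p q
⊆-split {S = false ∷ S} {_ ∷ L}    {_ ∷ T}     (_ ∷ X)     l p q = ⊆-split {S = S} X l p q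

restrict-∖-∅ : ∀ {n} {S X : Subset n} (L : Subset n) → S ⊆ X → restrict (L ∖ˢ X) S ≡ emptyˢ
restrict-∖-∅ {S = []}        {[]}        []          h = refl
restrict-∖-∅ {S = true ∷ S}  {true ∷ X}  (true ∷ L)  h = restrict-∖-∅ {S = S} L h
restrict-∖-∅ {S = true ∷ S}  {true ∷ X}  (false ∷ L) h = restrict-∖-∅ {S = S} L h
restrict-∖-∅ {S = false ∷ S} {true ∷ X}  (true ∷ L)  h = restrict-∖-∅ {S = S} L h
restrict-∖-∅ {S = false ∷ S} {false ∷ X} (true ∷ L)  h = cong (false ∷_) (restrict-∖-∅ {S = S} L h)
restrict-∖-∅ {S = false ∷ S} {_ ∷ X}     (false ∷ L) h = restrict-∖-∅ {S = S} L h

restrict-∖-full : ∀ {n} (L X : Subset n) → restrict (L ∖ˢ X) L ≡ fullˢ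
restrict-∖-full []          []          = refl
restrict-∖-full (true ∷ L)  (true ∷ X)  = restrict-∖-full L X
restrict-∖-full (true ∷ L)  (false ∷ X) = cong (true ∷_) (restrict-∖-full L X)
restrict-∖-full (false ∷ L) (_ ∷ X)     = restrict-∖-full L X

⊆-∖ : ∀ {n} {S T X : Subset n} → S ⊆ X → T ∩ˢ S ≡ emptyˢ → S ⊆ (X ∖ˢ T)
⊆-∖ {S = []}        {[]}        {[]}       h e = refl
⊆-∖ {S = true ∷ S}  {true ∷ T}  {_ ∷ X}    h e = case Vec.∷-injectiveˡ e of λ ()
⊆-∖ {S = true ∷ S}  {false ∷ T} {true ∷ X} h e = ⊆-∖ {S = S} h (Vec.∷-injectiveʳ e)
⊆-∖ {S = false ∷ S} {_ ∷ T}     {_ ∷ X}    h e = ⊆-∖ {S = S} h (Vec.∷-injectiveʳ e)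

∪-∖ : ∀ {n} {S X : Subset n} → S ⊆ X → S ∪ˢ (X ∖ˢ S) ≡ X
∪-∖ {S = []}        {[]}        h = refl
∪-∖ {S = true ∷ S}  {true ∷ X}  h = cong (true ∷_) (∪-∖ h)
∪-∖ {S = false ∷ S} {true ∷ X}  h = cong (true ∷_) (∪-∖ {S = S} h)
∪-∖ {S = false ∷ S} {false ∷ X} h = cong (false ∷_) (∪-∖ {S = S} h)

∩-∖ : ∀ {n} (S X : Subset n) → S ∩ˢ (X ∖ˢ S) ≡ emptyˢ
∩-∖ []          []          = refl
∩-∖ (true ∷ S)  (true ∷ X)  = cong (false ∷_) (∩-∖ S X)
∩-∖ (true ∷ S)  (false ∷ X) = cong (false ∷_) (∩-∖ S X)
∩-∖ (false ∷ S) (_ ∷ X)     = cong (false ∷_) (∩-∖ S X)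

card-++ : ∀ {m n} (S : Subset m) {T : Subset n} → card (S ++ T) ≡ card S + card T
card-++ []          = refl
card-++ (true ∷ S)  = cong suc (card-++ S)
card-++ (false ∷ S) = card-++ S

card-∅ : ∀ n → card (emptyˢ {n}) ≡ 0
card-∅ zero    = refl
card-∅ (suc n) = card-∅ n

card-full : ∀ n → card (fullˢ {n}) ≡ n
card-full zero    = refl
card-full (suc n) = cong suc (card-full n)

card≡0⇒∅ : ∀ {n} (S : Subset n) → card S ≡ 0 → S ≡ emptyˢ
card≡0⇒∅ []          e = refl
card≡0⇒∅ (false ∷ S) e = cong (false ∷_) (card≡0⇒∅ S e)

card-split : ∀ {n} {S L : Subset n} (X : Subset n) → S ⊆ L →
             card (S ∩ˢ X) + card (restrict (L ∖ˢ X) S) ≡ card S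
card-split {S = []}        {[]}        []          h = refl
card-split {S = true ∷ S}  {true ∷ L}  (true ∷ X)  h = cong suc (card-split {S = S} X h)
card-split {S = true ∷ S}  {true ∷ L}  (false ∷ X) h = trans (ℕ.+-suc _ _) (cong suc (card-split {S = S} X h))
card-split {S = false ∷ S} {true ∷ L}  (true ∷ X)  h = card-split {S = S} X h
card-split {S = false ∷ S} {true ∷ L}  (false ∷ X) h = card-split {S = S} X h
card-split {S = false ∷ S} {false ∷ L} (_ ∷ X)     h = card-split {S = S} X h

∈-allSubsets : ∀ {n} (S : Subset n) → S ∈ allSubsets n
∈-allSubsets []          = here refl
∈-allSubsets (false ∷ S) = ∈-++⁺ˡ (∈-map⁺ (false ∷_) (∈-allSubsets S))
∈-allSubsets {suc n} (true ∷ S) = ∈-++⁺ʳ (map (false ∷_) (allSubsets n)) (∈-map⁺ (true ∷_) (∈-allSubsets S))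

allSubsets-unique : ∀ n → Unique (allSubsets n)
allSubsets-unique zero    = [] ∷ []
allSubsets-unique (suc n) =
  Unique.++⁺ (Unique.map⁺ Vec.∷-injectiveʳ (allSubsets-unique n))
             (Unique.map⁺ Vec.∷-injectiveʳ (allSubsets-unique n))
             disjoint
  where
  disjoint : ∀ {S} → S ∈ map (false ∷_) (allSubsets n) × S ∈ map (true ∷_) (allSubsets n) → _
  disjoint (p , q) with ∈-map⁻ (false ∷_) p | ∈-map⁻ (true ∷_) q
  ... | _ , _ , refl | _ , _ , ()

map-unique : ∀ {A C : Set} (f : A → C) {xs} → (∀ {x y} → x ∈ xs → y ∈ xs → f x ≡ f y → x ≡ y) →
             Unique xs → Unique (map f xs)
map-unique f inj []       = []
map-unique f {x ∷ xs} inj (x∉ ∷ u) =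
  All.map⁺ (All.tabulate λ m e → All.lookup x∉ m (inj (here refl) (there m) e)) ∷
  map-unique f (λ p q → inj (there p) (there q)) u

-- Edge sets are kept as duplicate-free lists. An identity between them is proved by two inclusions
-- and then passes to sums by `∑-↭` and to lengths by `↭-length`.
unique-↭ : ∀ {A : Set} {xs ys : List A} → Unique xs → Unique ys →
           (∀ {x} → x ∈ xs → x ∈ ys) → (∀ {x} → x ∈ ys → x ∈ xs) → xs ↭ ys
unique-↭ u v f g = ∼bag⇒↭ (unique∧set⇒bag u v (mk⇔ f g))

-- Maps and their images

vertices : ∀ b → List (Fin b)
vertices b = toList (tabulate (λ y → y))

any-tabulate : ∀ {A : Set} {n} (p : A → Bool) (g : Fin n → A) →
              any p (toList (tabulate g)) ≡ any (p ∘ g) (vertices n)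
any-tabulate p g = begin
  any p (toList (tabulate g))                        ≡⟨ cong (any p ∘ toList) (Vec.tabulate-∘ g id) ⟩
  any p (toList (Data.Vec.map g (tabulate id)))      ≡⟨ cong (any p) (Vec.toList-map g (tabulate id)) ⟩
  any p (map g (vertices _))                         ≡⟨ cong or (List.map-∘ {g = p} {f = g} (vertices _)) ⟨
  any (p ∘ g) (vertices _)                           ∎
  where open ≡-Reasoning

length-vertices : ∀ b → length (vertices b) ≡ b
length-vertices b = Vec.length-toList (tabulate {n = b} (λ y → y))

-- Acts on maps as `restrict` acts on subsets, with the same re-indexing.
select : ∀ {A : Set} {n} (D : Subset n) → Vec A n → Vec A (card D)
select []          []      = []
select (true ∷ D)  (u ∷ x) = u ∷ select D x
select (false ∷ D) (_ ∷ x) = select D x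

-- The membership test of `image` as a structural recursion over both vectors, which suits induction
-- on concatenations and restrictions.
hit : ∀ {b n} → Vec (Fin b) n → Subset n → Fin b → Bool
hit []      []      v = false
hit (u ∷ f) (a ∷ e) v = (a ∧ ⌊ u Fin.≟ v ⌋) ∨ hit f e v

image≡hit : ∀ {b n} (f : Vec (Fin b) n) e → image f e ≡ tabulate (hit f e)
image≡hit f e = Vec.tabulate-cong (pointwise f e)
  where
  pointwise : ∀ {b n} (f : Vec (Fin b) n) e v →
    any (λ x → lookup e x ∧ ⌊ lookup f x Fin.≟ v ⌋) (vertices n) ≡ hit f e v
  pointwise []      []      v = refl
  pointwise (u ∷ f) (a ∷ e) v = cong ((a ∧ ⌊ u Fin.≟ v ⌋) ∨_)
    (trans (any-tabulate (λ x → lookup (a ∷ e) x ∧ ⌊ lookup (u ∷ f) x Fin.≟ v ⌋) suc) (pointwise f e v))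

hit-++ : ∀ {b m n} (f : Vec (Fin b) m) (g : Vec (Fin b) n) S T v →
         hit (f ++ g) (S ++ T) v ≡ hit f S v ∨ hit g T v
hit-++ []      g []      T v = refl
hit-++ (u ∷ f) g (a ∷ S) T v =
  trans (cong ((a ∧ ⌊ u Fin.≟ v ⌋) ∨_) (hit-++ f g S T v)) (sym (Bool.∨-assoc (a ∧ ⌊ u Fin.≟ v ⌋) _ _))

hit-∅ : ∀ {b n} (f : Vec (Fin b) n) v → hit f emptyˢ v ≡ false
hit-∅ []      v = refl
hit-∅ (u ∷ f) v = hit-∅ f v

hit-select : ∀ {b n} (D : Subset n) (f : Vec (Fin b) n) S v →
             hit (select D f) (restrict D S) v ≡ hit f (S ∩ˢ D) v
hit-select []          []      []      v = refl
hit-select (true ∷ D)  (u ∷ f) (a ∷ S) v =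
  cong₂ (λ c → (c ∧ ⌊ u Fin.≟ v ⌋) ∨_) (sym (Bool.∧-identityʳ a)) (hit-select D f S v)
hit-select (false ∷ D) (u ∷ f) (a ∷ S) v =
  trans (hit-select D f S v) (cong (λ c → (c ∧ ⌊ u Fin.≟ v ⌋) ∨ hit f (S ∩ˢ D) v) (sym (Bool.∧-zeroʳ a)))

hit-split : ∀ {b n} (f : Vec (Fin b) n) {S L : Subset n} (X : Subset n) v → S ⊆ L →
            hit f (S ∩ˢ X) v ∨ hit f (S ∩ˢ (L ∖ˢ X)) v ≡ hit f S v
hit-split []      {[]}        {[]}        []          v h = refl
hit-split (u ∷ f) {true ∷ S}  {true ∷ L}  (true ∷ X)  v h =
  trans (Bool.∨-assoc ⌊ u Fin.≟ v ⌋ _ _) (cong (⌊ u Fin.≟ v ⌋ ∨_) (hit-split f {S} X v h))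
hit-split (u ∷ f) {true ∷ S}  {true ∷ L}  (false ∷ X) v h =
  trans (shift (hit f (S ∩ˢ X) v) ⌊ u Fin.≟ v ⌋ _) (cong (⌊ u Fin.≟ v ⌋ ∨_) (hit-split f {S} X v h))
  where
  shift : ∀ a b c → a ∨ (b ∨ c) ≡ b ∨ (a ∨ c)
  shift true  b c = sym (Bool.∨-zeroʳ b)
  shift false b c = refl
hit-split (u ∷ f) {false ∷ S} {_ ∷ L}     (_ ∷ X)     v h = hit-split f {S} X v h

-- The event that two maps have the same restriction to a set. With it, marginal laws on all sets
-- are expressed over a single space of total maps.
agree : ∀ {b n} → Subset n → Vec (Fin b) n → Vec (Fin b) n → Bool
agree []      []      []      = true
agree (a ∷ S) (u ∷ x) (v ∷ y) = (not a ∨ ⌊ u Fin.≟ v ⌋) ∧ agree S x y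

≟-refl : ∀ {b} (u : Fin b) → ⌊ u Fin.≟ u ⌋ ≡ true
≟-refl u with u Fin.≟ u
... | yes _ = refl
... | no u≢u = ⊥-elim (u≢u refl)

≟⇒≡ : ∀ {b} {u v : Fin b} → ⌊ u Fin.≟ v ⌋ ≡ true → u ≡ v
≟⇒≡ {u = u} {v} h with u Fin.≟ v
... | yes e = e

agree-refl : ∀ {b n} S (x : Vec (Fin b) n) → agree S x x ≡ true
agree-refl []          []      = refl
agree-refl (true ∷ S)  (u ∷ x) = ∧-true⁺ (≟-refl u) (agree-refl S x)
agree-refl (false ∷ S) (u ∷ x) = agree-refl S x

agree-sym : ∀ {b n} S {x y : Vec (Fin b) n} → agree S x y ≡ true → agree S y x ≡ true
agree-sym []          {[]}    {[]}    h = refl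
agree-sym (true ∷ S)  {u ∷ x} {v ∷ y} h with ∧-true⁻ {⌊ u Fin.≟ v ⌋} h
... | p , q = ∧-true⁺ (subst (λ w → ⌊ v Fin.≟ w ⌋ ≡ true) (sym (≟⇒≡ p)) (≟-refl v)) (agree-sym S q)
agree-sym (false ∷ S) {u ∷ x} {v ∷ y} h = agree-sym S h

agree-trans : ∀ {b n} S {x y z : Vec (Fin b) n} →
              agree S x y ≡ true → agree S y z ≡ true → agree S x z ≡ true
agree-trans []          {[]}    {[]}    {[]}    g h = refl
agree-trans (true ∷ S)  {u ∷ x} {v ∷ y} {w ∷ z} g h with ∧-true⁻ {⌊ u Fin.≟ v ⌋} g | ∧-true⁻ {⌊ v Fin.≟ w ⌋} h
... | p , q | p′ , q′ =
  ∧-true⁺ (subst (λ t → ⌊ u Fin.≟ t ⌋ ≡ true) (≟⇒≡ p′) p) (agree-trans S q q′)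
agree-trans (false ∷ S) {u ∷ x} {v ∷ y} {w ∷ z} g h = agree-trans S g h

agree-swap : ∀ {b n} S (x y : Vec (Fin b) n) → agree S x y ≡ agree S y x
agree-swap S x y = bool-ext (agree-sym S) (agree-sym S)

agree-cong : ∀ {b n} S {x x′ y y′ : Vec (Fin b) n} →
             agree S x x′ ≡ true → agree S y y′ ≡ true → agree S x y ≡ agree S x′ y′
agree-cong S p q = bool-ext
  (λ h → agree-trans S (agree-sym S p) (agree-trans S h q))
  (λ h → agree-trans S p (agree-trans S h (agree-sym S q)))

agree-⊆ : ∀ {b n} {S T : Subset n} {x y : Vec (Fin b) n} → S ⊆ T → agree T x y ≡ true → agree S x y ≡ true
agree-⊆ {S = []}        {[]}       {[]}    {[]}    i h = refl
agree-⊆ {S = true ∷ S}  {true ∷ T} {u ∷ x} {v ∷ y} i h with ∧-true⁻ {⌊ u Fin.≟ v ⌋} h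
... | p , q = ∧-true⁺ p (agree-⊆ {S = S} i q)
agree-⊆ {S = false ∷ S} {t ∷ T}    {u ∷ x} {v ∷ y} i h = agree-⊆ {S = S} i (proj₂ (∧-true⁻ {not t ∨ ⌊ u Fin.≟ v ⌋} h))

agree-∅ : ∀ {b n} (x y : Vec (Fin b) n) → agree emptyˢ x y ≡ true
agree-∅ []      []      = refl
agree-∅ (_ ∷ x) (_ ∷ y) = agree-∅ x y

agree-full⇒≡ : ∀ {b n} {x y : Vec (Fin b) n} → agree fullˢ x y ≡ true → x ≡ y
agree-full⇒≡ {x = []}    {[]}    h = refl
agree-full⇒≡ {x = u ∷ x} {v ∷ y} h with ∧-true⁻ {⌊ u Fin.≟ v ⌋} h
... | p , q = cong₂ _∷_ (≟⇒≡ p) (agree-full⇒≡ q)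

agree-++ : ∀ {b m n} S (T : Subset n) (x y : Vec (Fin b) m) (z w : Vec (Fin b) n) →
           agree (S ++ T) (x ++ z) (y ++ w) ≡ agree S x y ∧ agree T z w
agree-++ []      T []      []      z w = refl
agree-++ (a ∷ S) T (u ∷ x) (v ∷ y) z w =
  trans (cong ((not a ∨ ⌊ u Fin.≟ v ⌋) ∧_) (agree-++ S T x y z w)) (sym (Bool.∧-assoc (not a ∨ ⌊ u Fin.≟ v ⌋) _ _))

agree-select : ∀ {b n} (D S : Subset n) (x y : Vec (Fin b) n) →
               agree (restrict D S) (select D x) (select D y) ≡ agree (S ∩ˢ D) x y
agree-select []          []          []      []      = refl
agree-select (true ∷ D)  (true ∷ S)  (u ∷ x) (v ∷ y) = cong (⌊ u Fin.≟ v ⌋ ∧_) (agree-select D S x y)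
agree-select (true ∷ D)  (false ∷ S) (u ∷ x) (v ∷ y) = agree-select D S x y
agree-select (false ∷ D) (true ∷ S)  (u ∷ x) (v ∷ y) = agree-select D S x y
agree-select (false ∷ D) (false ∷ S) (u ∷ x) (v ∷ y) = agree-select D S x y

agree-split : ∀ {b n} {S L : Subset n} (X : Subset n) (x y : Vec (Fin b) n) → S ⊆ L →
              agree (S ∩ˢ X) x y ∧ agree (S ∩ˢ (L ∖ˢ X)) x y ≡ agree S x y
agree-split {S = S} {L} X x y S⊆L = bool-ext
  (λ h → let p , q = ∧-true⁻ h in join S L X x y S⊆L p q)
  (λ h → ∧-true⁺ (agree-⊆ {S = S ∩ˢ X} {S} (∩-⊆ˡ S X) h) (agree-⊆ {S = S ∩ˢ (L ∖ˢ X)} {S} (∩-⊆ˡ S (L ∖ˢ X)) h))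
  where
  join : ∀ {b n} (S L X : Subset n) (x y : Vec (Fin b) n) → S ⊆ L →
         agree (S ∩ˢ X) x y ≡ true → agree (S ∩ˢ (L ∖ˢ X)) x y ≡ true → agree S x y ≡ true
  join []          []         []          []      []      i p q = refl
  join (true ∷ S)  (true ∷ L) (true ∷ X)  (u ∷ x) (v ∷ y) i p q =
    let p₁ , p₂ = ∧-true⁻ {⌊ u Fin.≟ v ⌋} p in ∧-true⁺ p₁ (join S L X x y i p₂ q)
  join (true ∷ S)  (true ∷ L) (false ∷ X) (u ∷ x) (v ∷ y) i p q =
    let q₁ , q₂ = ∧-true⁻ {⌊ u Fin.≟ v ⌋} q in ∧-true⁺ q₁ (join S L X x y i p q₂)
  join (false ∷ S) (_ ∷ L)    (_ ∷ X)     (u ∷ x) (v ∷ y) i p q = join S L X x y i p q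

hit-agree : ∀ {b n} S {x y : Vec (Fin b) n} v → agree S x y ≡ true → hit x S v ≡ hit y S v
hit-agree []          {[]}    {[]}    v h = refl
hit-agree (true ∷ S)  {u ∷ x} {w ∷ y} v h with ∧-true⁻ {⌊ u Fin.≟ w ⌋} h
... | p , q = cong₂ (λ t → ⌊ t Fin.≟ v ⌋ ∨_) (≟⇒≡ p) (hit-agree S v q)
hit-agree (false ∷ S) {u ∷ x} {w ∷ y} v h = hit-agree S v h

image-agree : ∀ {b n} S {x y : Vec (Fin b) n} → agree S x y ≡ true → image x S ≡ image y S
image-agree S {x} {y} h =
  trans (image≡hit x S) (trans (Vec.tabulate-cong (λ v → hit-agree S v h)) (sym (image≡hit y S)))

image-select : ∀ {b n} (D : Subset n) (x : Vec (Fin b) n) → image (select D x) fullˢ ≡ image x D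
image-select D x = begin
  image (select D x) fullˢ                     ≡⟨ image≡hit (select D x) fullˢ ⟩
  tabulate (hit (select D x) fullˢ)            ≡⟨ cong (tabulate ∘ hit (select D x)) (restrict-self D) ⟨
  tabulate (hit (select D x) (restrict D D))   ≡⟨ Vec.tabulate-cong (hit-select D x D) ⟩
  tabulate (hit x (D ∩ˢ D))                    ≡⟨ cong (tabulate ∘ hit x) (⊆⇒∩ {S = D} (⊆-refl D)) ⟩
  tabulate (hit x D)                           ≡⟨ image≡hit x D ⟨
  image x D                                    ∎
  where
  open ≡-Reasoning
  restrict-self : ∀ {n} (D : Subset n) → restrict D D ≡ fullˢ
  restrict-self []          = refl
  restrict-self (true ∷ D)  = cong (true ∷_) (restrict-self D)
  restrict-self (false ∷ D) = restrict-self D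

-- Counting maps and independence of disjoint coordinates

∑-allMaps-suc : ∀ a b (F : Vec (Fin b) (suc a) → ℚ) →
  ∑ (allMaps (suc a) b) F ≡ ∑ (allMaps a b) (λ f → ∑ (vertices b) (λ v → F (v ∷ f)))
∑-allMaps-suc a b F =
  trans (∑-concatMap (λ f → map (_∷ f) (vertices b)) (allMaps a b) F)
        (∑-cong (allMaps a b) (λ {f} _ → ∑-map (_∷ f) (vertices b) F))

∑-vertices-const : ∀ b c → ∑ (vertices b) (λ _ → c) ≡ ι b *ℚ c
∑-vertices-const b c = trans (∑-const (vertices b) c) (cong (λ l → ι l *ℚ c) (length-vertices b))

∑-allMaps-const : ∀ a b c → ∑ (allMaps a b) (λ _ → c) ≡ (ι b ^ℚ a) *ℚ c
∑-allMaps-const zero    b c = trans (ℚ.+-identityʳ c) (sym (ℚ.*-identityˡ c))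
∑-allMaps-const (suc a) b c = begin
  ∑ (allMaps (suc a) b) (λ _ → c)                        ≡⟨ ∑-allMaps-suc a b (λ _ → c) ⟩
  ∑ (allMaps a b) (λ _ → ∑ (vertices b) (λ _ → c))       ≡⟨ ∑-allMaps-const a b (∑ (vertices b) (λ _ → c)) ⟩
  (ι b ^ℚ a) *ℚ ∑ (vertices b) (λ _ → c)                 ≡⟨ cong ((ι b ^ℚ a) *ℚ_) (∑-vertices-const b c) ⟩
  (ι b ^ℚ a) *ℚ (ι b *ℚ c)                               ≡⟨ shuffle (ι b ^ℚ a) (ι b) c ⟩
  (ι b *ℚ (ι b ^ℚ a)) *ℚ c                               ∎
  where
  open ≡-Reasoning
  shuffle : ∀ p q c → p *ℚ (q *ℚ c) ≡ (q *ℚ p) *ℚ c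
  shuffle = solve-∀ ringℚ

-- A map on `D` extends in b^(n - |D|) ways; multiplying by b^|D| avoids both subtraction and
-- division.
∑-select : ∀ {b n} (D : Subset n) (P : Vec (Fin b) (card D) → ℚ) →
  (ι b ^ℚ card D) *ℚ ∑ (allMaps n b) (P ∘ select D) ≡ (ι b ^ℚ n) *ℚ ∑ (allMaps (card D) b) P
∑-select []               P = refl
∑-select {b} {suc n} (true ∷ D) P = begin
  (ι b *ℚ (ι b ^ℚ card D)) *ℚ ∑ (allMaps (suc n) b) (P ∘ select (true ∷ D))
    ≡⟨ cong ((ι b *ℚ (ι b ^ℚ card D)) *ℚ_) (∑-allMaps-suc n b _) ⟩
  (ι b *ℚ (ι b ^ℚ card D)) *ℚ ∑ (allMaps n b) (λ f → ∑ (vertices b) (λ v → P (v ∷ select D f)))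
    ≡⟨ ℚ.*-assoc (ι b) (ι b ^ℚ card D) _ ⟩
  ι b *ℚ ((ι b ^ℚ card D) *ℚ ∑ (allMaps n b) (λ f → ∑ (vertices b) (λ v → P (v ∷ select D f))))
    ≡⟨ cong (ι b *ℚ_) (∑-select D (λ z → ∑ (vertices b) (λ v → P (v ∷ z)))) ⟩
  ι b *ℚ ((ι b ^ℚ n) *ℚ ∑ (allMaps (card D) b) (λ f → ∑ (vertices b) (λ v → P (v ∷ f))))
    ≡⟨ ℚ.*-assoc (ι b) (ι b ^ℚ n) _ ⟨
  (ι b *ℚ (ι b ^ℚ n)) *ℚ ∑ (allMaps (card D) b) (λ f → ∑ (vertices b) (λ v → P (v ∷ f)))
    ≡⟨ cong ((ι b *ℚ (ι b ^ℚ n)) *ℚ_) (∑-allMaps-suc (card D) b P) ⟨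
  (ι b *ℚ (ι b ^ℚ n)) *ℚ ∑ (allMaps (suc (card D)) b) P ∎
  where open ≡-Reasoning
∑-select {b} {suc n} (false ∷ D) P = begin
  (ι b ^ℚ card D) *ℚ ∑ (allMaps (suc n) b) (P ∘ select (false ∷ D))
    ≡⟨ cong ((ι b ^ℚ card D) *ℚ_) (trans (∑-allMaps-suc n b _)
         (trans (∑-cong (allMaps n b) (λ {f} _ → ∑-vertices-const b (P (select D f)))) (∑-*ˡ (allMaps n b) (ι b) (P ∘ select D)))) ⟩
  (ι b ^ℚ card D) *ℚ (ι b *ℚ ∑ (allMaps n b) (P ∘ select D))
    ≡⟨ shuffle (ι b ^ℚ card D) (ι b) _ ⟩
  ι b *ℚ ((ι b ^ℚ card D) *ℚ ∑ (allMaps n b) (P ∘ select D))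
    ≡⟨ cong (ι b *ℚ_) (∑-select D P) ⟩
  ι b *ℚ ((ι b ^ℚ n) *ℚ ∑ (allMaps (card D) b) P)
    ≡⟨ ℚ.*-assoc (ι b) (ι b ^ℚ n) _ ⟨
  (ι b *ℚ (ι b ^ℚ n)) *ℚ ∑ (allMaps (card D) b) P ∎
  where
  open ≡-Reasoning
  shuffle : ∀ p q c → p *ℚ (q *ℚ c) ≡ q *ℚ (p *ℚ c)
  shuffle = solve-∀ ringℚ

∑-⟦≟⟧ : ∀ b (u : Fin b) c → ∑ (vertices b) (λ v → ⟦ ⌊ v Fin.≟ u ⌋ ⟧ *ℚ c) ≡ c
∑-⟦≟⟧ (suc b) u c = trans (tabulate-id u) (point u)
  where
  tabulate-id : ∀ u → ∑ (vertices (suc b)) (λ v → ⟦ ⌊ v Fin.≟ u ⌋ ⟧ *ℚ c)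
              ≡ ⟦ ⌊ zero Fin.≟ u ⌋ ⟧ *ℚ c +ℚ ∑ (vertices b) (λ v → ⟦ ⌊ Fin.suc v Fin.≟ u ⌋ ⟧ *ℚ c)
  tabulate-id u = cong (⟦ ⌊ zero Fin.≟ u ⌋ ⟧ *ℚ c +ℚ_)
    (trans (cong (λ vs → ∑ vs (λ v → ⟦ ⌊ v Fin.≟ u ⌋ ⟧ *ℚ c))
                 (trans (cong toList (Vec.tabulate-∘ suc id)) (Vec.toList-map suc (tabulate id))))
           (∑-map suc (vertices b) _))
  point : ∀ u → ⟦ ⌊ zero Fin.≟ u ⌋ ⟧ *ℚ c +ℚ ∑ (vertices b) (λ v → ⟦ ⌊ Fin.suc v Fin.≟ u ⌋ ⟧ *ℚ c) ≡ c
  point zero    = trans (cong₂ _+ℚ_ (ℚ.*-identityˡ c)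
                    (trans (∑-cong (vertices b) (λ _ → ℚ.*-zeroˡ c)) (∑-zero (vertices b)))) (ℚ.+-identityʳ c)
  point (suc u) = trans (cong₂ _+ℚ_ (ℚ.*-zeroˡ c) (trans (∑-cong (vertices b) (λ {v} _ → cong (λ t → ⟦ t ⟧ *ℚ c) (suc-≟ v u))) (∑-⟦≟⟧ b u c))) (ℚ.+-identityˡ c)
    where
    suc-≟ : ∀ (v u : Fin b) → ⌊ Fin.suc v Fin.≟ suc u ⌋ ≡ ⌊ v Fin.≟ u ⌋
    suc-≟ v u with v Fin.≟ u
    ... | yes _ = refl
    ... | no _  = refl

-- The maps agreeing with `x` on `S` are its b^(n - |S|) modifications outside `S`, counted in the
-- same cleared form.
∑-agree : ∀ {b n} S (x : Vec (Fin b) n) →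
          (ι b ^ℚ card S) *ℚ ∑ (allMaps n b) (λ y → ⟦ agree S y x ⟧) ≡ ι b ^ℚ n
∑-agree []               []      = refl
∑-agree {b} {suc n} (true ∷ S) (u ∷ x) = begin
  (ι b *ℚ (ι b ^ℚ card S)) *ℚ ∑ (allMaps (suc n) b) (λ y → ⟦ agree (true ∷ S) y (u ∷ x) ⟧)
    ≡⟨ cong ((ι b *ℚ (ι b ^ℚ card S)) *ℚ_) (trans (∑-allMaps-suc n b _)
         (∑-cong (allMaps n b) (λ {y} _ → trans (∑-cong (vertices b) (λ {v} _ → ⟦⟧-∧ ⌊ v Fin.≟ u ⌋ (agree S y x))) (∑-⟦≟⟧ b u _)))) ⟩
  (ι b *ℚ (ι b ^ℚ card S)) *ℚ ∑ (allMaps n b) (λ y → ⟦ agree S y x ⟧)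
    ≡⟨ ℚ.*-assoc (ι b) (ι b ^ℚ card S) _ ⟩
  ι b *ℚ ((ι b ^ℚ card S) *ℚ ∑ (allMaps n b) (λ y → ⟦ agree S y x ⟧))
    ≡⟨ cong (ι b *ℚ_) (∑-agree S x) ⟩
  ι b *ℚ (ι b ^ℚ n) ∎
  where open ≡-Reasoning
∑-agree {b} {suc n} (false ∷ S) (u ∷ x) = begin
  (ι b ^ℚ card S) *ℚ ∑ (allMaps (suc n) b) (λ y → ⟦ agree (false ∷ S) y (u ∷ x) ⟧)
    ≡⟨ cong ((ι b ^ℚ card S) *ℚ_) (trans (∑-allMaps-suc n b _)
         (trans (∑-cong (allMaps n b) (λ {y} _ → ∑-vertices-const b ⟦ agree S y x ⟧)) (∑-*ˡ (allMaps n b) (ι b) _))) ⟩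
  (ι b ^ℚ card S) *ℚ (ι b *ℚ ∑ (allMaps n b) (λ y → ⟦ agree S y x ⟧))
    ≡⟨ shuffle (ι b ^ℚ card S) (ι b) _ ⟩
  ι b *ℚ ((ι b ^ℚ card S) *ℚ ∑ (allMaps n b) (λ y → ⟦ agree S y x ⟧))
    ≡⟨ cong (ι b *ℚ_) (∑-agree S x) ⟩
  ι b *ℚ (ι b ^ℚ n) ∎
  where
  open ≡-Reasoning
  shuffle : ∀ p q c → p *ℚ (q *ℚ c) ≡ q *ℚ (p *ℚ c)
  shuffle = solve-∀ ringℚ

mix : ∀ {A : Set} {n} → Subset n → Vec A n → Vec A n → Vec A n
mix []          []      []      = []
mix (true ∷ S)  (u ∷ x) (v ∷ y) = u ∷ mix S x y
mix (false ∷ S) (u ∷ x) (v ∷ y) = v ∷ mix S x y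

agree-mixˡ : ∀ {b n} S (x y : Vec (Fin b) n) → agree S (mix S x y) x ≡ true
agree-mixˡ []          []      []      = refl
agree-mixˡ (true ∷ S)  (u ∷ x) (v ∷ y) = ∧-true⁺ (≟-refl u) (agree-mixˡ S x y)
agree-mixˡ (false ∷ S) (u ∷ x) (v ∷ y) = agree-mixˡ S x y

agree-mixʳ : ∀ {b n} S T (x y : Vec (Fin b) n) → S ∩ˢ T ≡ emptyˢ → agree T (mix S x y) y ≡ true
agree-mixʳ []          []          []      []      e = refl
agree-mixʳ (true ∷ S)  (true ∷ T)  (u ∷ x) (v ∷ y) e = case Vec.∷-injectiveˡ e of λ ()
agree-mixʳ (true ∷ S)  (false ∷ T) (u ∷ x) (v ∷ y) e = agree-mixʳ S T x y (Vec.∷-injectiveʳ e)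
agree-mixʳ (false ∷ S) (true ∷ T)  (u ∷ x) (v ∷ y) e = ∧-true⁺ (≟-refl v) (agree-mixʳ S T x y (Vec.∷-injectiveʳ e))
agree-mixʳ (false ∷ S) (false ∷ T) (u ∷ x) (v ∷ y) e = agree-mixʳ S T x y (Vec.∷-injectiveʳ e)

-- (y , z) ↦ (mix S y z , mix S z y) permutes the pairs of maps.
∑-mix : ∀ {b n} S (H : Vec (Fin b) n → Vec (Fin b) n → ℚ) →
  ∑ (allMaps n b) (λ y → ∑ (allMaps n b) (λ z → H (mix S y z) (mix S z y))) ≡
  ∑ (allMaps n b) (λ y → ∑ (allMaps n b) (H y))
∑-mix []              H = refl
∑-mix {b} {suc n} (s ∷ S) H = begin
  ∑ (allMaps (suc n) b) (λ y → ∑ (allMaps (suc n) b) (λ z → H (mix (s ∷ S) y z) (mix (s ∷ S) z y)))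
    ≡⟨ unfold (λ y z → H (mix (s ∷ S) y z) (mix (s ∷ S) z y)) ⟩
  ∑ V (λ u → ∑ V (λ v → ∑ Y (λ y → ∑ Y (λ z → H (mix (s ∷ S) (u ∷ y) (v ∷ z)) (mix (s ∷ S) (v ∷ z) (u ∷ y))))))
    ≡⟨ head s ⟩
  ∑ V (λ u → ∑ V (λ v → ∑ Y (λ y → ∑ Y (λ z → H (u ∷ mix S y z) (v ∷ mix S z y)))))
    ≡⟨ ∑-cong V (λ {u} _ → ∑-cong V (λ {v} _ → ∑-mix S (λ y z → H (u ∷ y) (v ∷ z)))) ⟩
  ∑ V (λ u → ∑ V (λ v → ∑ Y (λ y → ∑ Y (λ z → H (u ∷ y) (v ∷ z)))))
    ≡⟨ unfold H ⟨
  ∑ (allMaps (suc n) b) (λ y → ∑ (allMaps (suc n) b) (H y)) ∎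
  where
  open ≡-Reasoning
  V = vertices b
  Y = allMaps n b
  unfold : ∀ (F : Vec (Fin b) (suc n) → Vec (Fin b) (suc n) → ℚ) →
    ∑ (allMaps (suc n) b) (λ y → ∑ (allMaps (suc n) b) (F y)) ≡
    ∑ V (λ u → ∑ V (λ v → ∑ Y (λ y → ∑ Y (λ z → F (u ∷ y) (v ∷ z)))))
  unfold F = begin
    ∑ (allMaps (suc n) b) (λ y → ∑ (allMaps (suc n) b) (F y))
      ≡⟨ ∑-allMaps-suc n b _ ⟩
    ∑ Y (λ y → ∑ V (λ u → ∑ (allMaps (suc n) b) (F (u ∷ y))))
      ≡⟨ ∑-swap Y V (λ y u → ∑ (allMaps (suc n) b) (F (u ∷ y))) ⟩
    ∑ V (λ u → ∑ Y (λ y → ∑ (allMaps (suc n) b) (F (u ∷ y))))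
      ≡⟨ ∑-cong V (λ {u} _ → ∑-cong Y (λ {y} _ → trans (∑-allMaps-suc n b (F (u ∷ y))) (∑-swap Y V (λ z v → F (u ∷ y) (v ∷ z))))) ⟩
    ∑ V (λ u → ∑ Y (λ y → ∑ V (λ v → ∑ Y (λ z → F (u ∷ y) (v ∷ z)))))
      ≡⟨ ∑-cong V (λ {u} _ → ∑-swap Y V (λ y v → ∑ Y (λ z → F (u ∷ y) (v ∷ z)))) ⟩
    ∑ V (λ u → ∑ V (λ v → ∑ Y (λ y → ∑ Y (λ z → F (u ∷ y) (v ∷ z))))) ∎
  head : ∀ s →
    ∑ V (λ u → ∑ V (λ v → ∑ Y (λ y → ∑ Y (λ z → H (mix (s ∷ S) (u ∷ y) (v ∷ z)) (mix (s ∷ S) (v ∷ z) (u ∷ y)))))) ≡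
    ∑ V (λ u → ∑ V (λ v → ∑ Y (λ y → ∑ Y (λ z → H (u ∷ mix S y z) (v ∷ mix S z y)))))
  head true  = refl
  -- At a coordinate outside `S` mixing exchanges the two head values, which exchanging the two
  -- outer sums undoes.
  head false = ∑-swap V V (λ u v → ∑ Y (λ y → ∑ Y (λ z → H (v ∷ mix S y z) (u ∷ mix S z y))))

-- A dummy second map `z` is summed over and `∑-mix` is read backwards; afterwards `F` sees only `y`
-- and `G` only `z`, and the double sum is a product.
∑-independent : ∀ {b n} S T (F G : Vec (Fin b) n → ℚ) → S ∩ˢ T ≡ emptyˢ →
  (∀ {x y} → agree S x y ≡ true → F x ≡ F y) → (∀ {x y} → agree T x y ≡ true → G x ≡ G y) →
  (ι b ^ℚ n) *ℚ ∑ (allMaps n b) (λ y → F y *ℚ G y) ≡ ∑ (allMaps n b) F *ℚ ∑ (allMaps n b) G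
∑-independent {b} {n} S T F G disj F-local G-local = begin
  (ι b ^ℚ n) *ℚ ∑ Y (λ y → F y *ℚ G y)                         ≡⟨ ∑-*ˡ Y (ι b ^ℚ n) _ ⟨
  ∑ Y (λ y → (ι b ^ℚ n) *ℚ (F y *ℚ G y))                       ≡⟨ ∑-cong Y (λ {y} _ → ∑-allMaps-const n b (F y *ℚ G y)) ⟨
  ∑ Y (λ y → ∑ Y (λ _ → F y *ℚ G y))                           ≡⟨ ∑-mix S (λ y _ → F y *ℚ G y) ⟨
  ∑ Y (λ y → ∑ Y (λ z → F (mix S y z) *ℚ G (mix S y z)))
    ≡⟨ ∑-cong Y (λ {y} _ → ∑-cong Y (λ {z} _ → cong₂ _*ℚ_ (F-local (agree-mixˡ S y z)) (G-local (agree-mixʳ S T y z disj)))) ⟩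
  ∑ Y (λ y → ∑ Y (λ z → F y *ℚ G z))                           ≡⟨ ∑-cong Y (λ {y} _ → ∑-*ˡ Y (F y) G) ⟩
  ∑ Y (λ y → F y *ℚ ∑ Y G)                                     ≡⟨ ∑-*ʳ Y (∑ Y G) F ⟩
  ∑ Y F *ℚ ∑ Y G                                               ∎
  where
  open ≡-Reasoning
  Y = allMaps n b

-- Edges of a reflection

≡ᵇ-true⁻ : ∀ {m n} → (m ≡ᵇ n) ≡ true → m ≡ n
≡ᵇ-true⁻ {m} {n} h = ℕ.≡ᵇ⇒≡ m n (subst Bool.T (sym h) _)

≡ᵇ-true⁺ : ∀ {m n} → m ≡ n → (m ≡ᵇ n) ≡ true
≡ᵇ-true⁺ {zero}  refl = refl
≡ᵇ-true⁺ {suc m} refl = ≡ᵇ-true⁺ {m} refl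

edgesIn : (k : ℕ) (M : BHyp) → Subset (BHyp.n M) → List (Subset (BHyp.n M))
edgesIn k M K = filter (λ e → (Hyp.E (frame k M) e ∧ (e ⊆ᵇ K)) Bool.≟ true) (allSubsets (BHyp.n M))

∈-edgesIn⁻ : ∀ {k} M K {e} → e ∈ edgesIn k M K → BHyp.E M e ≡ true × card e ≡ k × e ⊆ K
∈-edgesIn⁻ M K {e} e∈ =
  let p , q = ∧-true⁻ {_} {e ⊆ᵇ K} (proj₂ (∈-filter⁻ (λ e → _ Bool.≟ true) {xs = allSubsets (BHyp.n M)} e∈))
      p₁ , p₂ = ∧-true⁻ p
  in p₁ , ≡ᵇ-true⁻ p₂ , q

∈-edgesIn⁺ : ∀ {k} M K {e} → BHyp.E M e ≡ true → card e ≡ k → e ⊆ K → e ∈ edgesIn k M K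
∈-edgesIn⁺ M K {e} p c q =
  ∈-filter⁺ (λ e → _ Bool.≟ true) (∈-allSubsets e) (∧-true⁺ (∧-true⁺ p (≡ᵇ-true⁺ c)) q)

edgesIn-unique : ∀ k M K → Unique (edgesIn k M K)
edgesIn-unique k M K = Unique.filter⁺ (λ e → _ Bool.≟ true) (allSubsets-unique (BHyp.n M))

edgesIn-full : ∀ k M → edgesIn k M fullˢ ↭ edges (frame k M)
edgesIn-full k M = unique-↭ (edgesIn-unique k M fullˢ)
  (Unique.filter⁺ (λ e → _ Bool.≟ true) (allSubsets-unique (BHyp.n M)))
  (λ {e} e∈ → let p , c , _ = ∈-edgesIn⁻ M fullˢ e∈ in
    ∈-filter⁺ (λ e → _ Bool.≟ true) (∈-allSubsets e) (∧-true⁺ p (≡ᵇ-true⁺ c)))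
  (λ {e} e∈ → let p , c = ∧-true⁻ (proj₂ (∈-filter⁻ (λ e → _ Bool.≟ true) {xs = allSubsets (BHyp.n M)} e∈)) in
    ∈-edgesIn⁺ M fullˢ p (≡ᵇ-true⁻ c) (⊆-full e))

Disjoint : ∀ {n} → List (Subset n) → Set
Disjoint es = ∀ {e f} → e ∈ es → f ∈ es → e ≡ f ⊎ e ∩ˢ f ≡ emptyˢ

-- The spanned hypergraph lives on re-indexed vertices. `restrict` is injective on subsets of `X`,
-- so its dichotomy pulls back to the original edges.
InZ⇒Disjoint : ∀ {k} M X → InZ k (spanned (frame k M) X) → Disjoint (edgesIn k M X)
InZ⇒Disjoint {k} M X (_ , dichotomy) {e} {f} e∈ f∈ =
  case dichotomy (restrict X e) (restrict X f) (spans e∈) (spans f∈) of λ where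
    (inj₁ eq) → inj₁ (restrict-injective e⊆X f⊆X eq)
    (inj₂ eq) → inj₂ (restrict-injective {D = X} e∩f⊆X (∅-⊆ X)
                  (trans (restrict-∩ X e f) (trans eq (sym (restrict-∅ X)))))
  where
  e⊆X = proj₂ (proj₂ (∈-edgesIn⁻ M X e∈))
  f⊆X = proj₂ (proj₂ (∈-edgesIn⁻ M X f∈))
  e∩f⊆X : (e ∩ˢ f) ⊆ X
  e∩f⊆X = ⊆-trans {S = e ∩ˢ f} {e} (∩-⊆ˡ e f) e⊆X
  spans : ∀ {e} → e ∈ edgesIn k M X → Hyp.E (spanned (frame k M) X) (restrict X e) ≡ true
  spans {e} e∈ = let p , c , e⊆X = ∈-edgesIn⁻ M X e∈ in
    any⁺ _ (∈-allSubsets e) (∧-true⁺ (∧-true⁺ p (≡ᵇ-true⁺ c)) (∧-true⁺ e⊆X (=ˢ-refl (restrict X e))))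

-- What the inductions need: V is an edge, so statements about all edges specialise to V; no edge
-- has fewer than `k` elements, so gluing creates no new frame edge; the frame has an edge, which
-- settles density zero.
record Wellformed (k : ℕ) (M : BHyp) : Set where
  field
    full-edge : BHyp.E M fullˢ ≡ true
    min-card  : ∀ K → BHyp.E M K ≡ true → k ℕ.≤ card K
    non-empty : ∃ λ e → e ∈ edgesIn k M fullˢ

module Step {k : ℕ} {M : BHyp} (wf : Wellformed k M) (L X : Subset (BHyp.n M))
            (L∈E : BHyp.E M L ≡ true) (X⊆L : X ⊆ L) where
  open Reflection M L X public
  open Wellformed wf

  N : ℕ
  N = BHyp.n M

  M′ : BHyp
  M′ = r M L X

  D : Subset N
  D = L ∖ˢ X

  τ₁-∅ : τ₁ emptyˢ ≡ emptyˢ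
  τ₁-∅ = ++-empty N m

  τ₂-∅ : τ₂ emptyˢ ≡ emptyˢ
  τ₂-∅ = trans (cong₂ _++_ (∩-zeroˡ X) (restrict-∅ D)) (++-empty N m)

  τ₁-∪ : ∀ S T → τ₁ (S ∪ˢ T) ≡ τ₁ S ∪ˢ τ₁ T
  τ₁-∪ S T = sym (trans (++-∪ S T emptyˢ emptyˢ) (cong ((S ∪ˢ T) ++_) (∪-identityˡ emptyˢ)))

  τ₁-∩ : ∀ S T → τ₁ (S ∩ˢ T) ≡ τ₁ S ∩ˢ τ₁ T
  τ₁-∩ S T = sym (trans (++-∩ S T emptyˢ emptyˢ) (cong ((S ∩ˢ T) ++_) (∩-zeroˡ emptyˢ)))

  τ₂-∪ : ∀ S T → τ₂ (S ∪ˢ T) ≡ τ₂ S ∪ˢ τ₂ T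
  τ₂-∪ S T = trans (cong₂ _++_ (∩-distribʳ-∪ S T X) (restrict-∪ D S T))
                   (sym (++-∪ (S ∩ˢ X) (T ∩ˢ X) (restrict D S) (restrict D T)))

  τ₂-∩ : ∀ S T → τ₂ (S ∩ˢ T) ≡ τ₂ S ∩ˢ τ₂ T
  τ₂-∩ S T = trans (cong₂ _++_ (∩-distribʳ-∩ S T X) (restrict-∩ D S T))
                   (sym (++-∩ (S ∩ˢ X) (T ∩ˢ X) (restrict D S) (restrict D T)))

  τ₁-mono : ∀ {S T} → S ⊆ T → τ₁ S ⊆ τ₁ T
  τ₁-mono {S} {T} h = ++-⊆⁺ {S = S} {T} h (⊆-refl (emptyˢ {m}))

  τ₁-mono⁻ : ∀ {S T} → τ₁ S ⊆ τ₁ T → S ⊆ T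
  τ₁-mono⁻ {S} {T} h = proj₁ (++-⊆⁻ S T h)

  restrict-mono : ∀ {S T} → S ⊆ T → restrict D S ⊆ restrict D T
  restrict-mono {S} {T} h =
    trans (restrict-⊆ᵇ D S T) (⊆-trans {S = S ∩ˢ D} {S} (∩-⊆ˡ S D) h)

  τ₂-mono : ∀ {S T} → S ⊆ T → τ₂ S ⊆ τ₂ T
  τ₂-mono {S} {T} h = ++-⊆⁺ {S = S ∩ˢ X} {T ∩ˢ X} (∩-monoˡ {S = S} {T} X h) (restrict-mono {S} {T} h)

  restrict⊆⇒⊆ : ∀ {S T} → S ⊆ L → (S ∩ˢ X) ⊆ T → restrict D S ⊆ restrict D T → S ⊆ T
  restrict⊆⇒⊆ {S} {T} S⊆L p q = ⊆-split {S = S} X S⊆L p (trans (sym (restrict-⊆ᵇ D S T)) q)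

  τ₂-mono⁻ : ∀ {S T} → S ⊆ L → τ₂ S ⊆ τ₂ T → S ⊆ T
  τ₂-mono⁻ {S} {T} S⊆L h = let p , q = ++-⊆⁻ (S ∩ˢ X) (T ∩ˢ X) h in
    restrict⊆⇒⊆ {S} S⊆L (⊆-trans {S = S ∩ˢ X} {T ∩ˢ X} p (∩-⊆ˡ T X)) q

  τ₁-injective : ∀ {S T} → τ₁ S ≡ τ₁ T → S ≡ T
  τ₁-injective {S} {T} = Vec.++-injectiveˡ S T

  τ₂-injective : ∀ {S T} → S ⊆ L → T ⊆ L → τ₂ S ≡ τ₂ T → S ≡ T
  τ₂-injective {S} {T} S⊆L T⊆L e =
    ⊆-antisym (τ₂-mono⁻ {S} {T} S⊆L (⊆-reflexive e)) (τ₂-mono⁻ {T} {S} T⊆L (⊆-reflexive (sym e)))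

  τ₁≡τ₂ : ∀ {S} → S ⊆ X → τ₁ S ≡ τ₂ S
  τ₁≡τ₂ {S} S⊆X = cong₂ _++_ (sym (⊆⇒∩ {S = S} S⊆X)) (sym (restrict-∖-∅ {S = S} L S⊆X))

  -- The two copies meet only in `X`: a first copy has no new vertices, so the restriction of `S` to
  -- `L ∖ˢ X` must be empty.
  τ₂⊆τ₁⇒⊆X : ∀ {S T} → S ⊆ L → τ₂ S ⊆ τ₁ T → S ⊆ X
  τ₂⊆τ₁⇒⊆X {S} {T} S⊆L h = restrict⊆⇒⊆ {S} {X} S⊆L (∩-⊆ʳ S X)
    (⊆-trans {S = restrict D S} {emptyˢ} (proj₂ (++-⊆⁻ (S ∩ˢ X) T h)) (∅-⊆ (restrict D X)))

  τ₁⊆τ₂⇒⊆X : ∀ {S T} → τ₁ S ⊆ τ₂ T → S ⊆ X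
  τ₁⊆τ₂⇒⊆X {S} {T} h =
    ⊆-trans {S = S} {T ∩ˢ X} (proj₁ (++-⊆⁻ S (T ∩ˢ X) h)) (∩-⊆ʳ T X)

  card-τ₁ : ∀ S → card (τ₁ S) ≡ card S
  card-τ₁ S = trans (card-++ S) (trans (cong (card S +_) (card-∅ m)) (ℕ.+-identityʳ _))

  card-τ₂ : ∀ {S} → S ⊆ L → card (τ₂ S) ≡ card S
  card-τ₂ {S} S⊆L = trans (card-++ (S ∩ˢ X)) (card-split {S = S} X S⊆L)

  module Union {K₁ K₂ : Subset N} (K₂⊆L : K₂ ⊆ L) (X⊆K₁∩K₂ : X ⊆ (K₁ ∩ˢ K₂)) where
    X⊆K₁ : X ⊆ K₁
    X⊆K₁ = ⊆-trans {S = X} X⊆K₁∩K₂ (∩-⊆ˡ K₁ K₂)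

    X⊆K₂ : X ⊆ K₂
    X⊆K₂ = ⊆-trans {S = X} X⊆K₁∩K₂ (∩-⊆ʳ K₁ K₂)

    K₂∩X : K₂ ∩ˢ X ≡ X
    K₂∩X = trans (∩-comm K₂ X) (⊆⇒∩ X⊆K₂)

    union≡ : τ₁ K₁ ∪ˢ τ₂ K₂ ≡ K₁ ++ restrict D K₂
    union≡ = trans (++-∪ K₁ (K₂ ∩ˢ X) emptyˢ (restrict D K₂))
      (cong₂ _++_ (trans (cong (K₁ ∪ˢ_) K₂∩X) (⊆⇒∪ X⊆K₁)) (∪-identityˡ (restrict D K₂)))

    intersection≡ : τ₁ K₁ ∩ˢ τ₂ K₂ ≡ τ₁ X
    intersection≡ = trans (++-∩ K₁ (K₂ ∩ˢ X) emptyˢ (restrict D K₂))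
      (cong₂ _++_ (trans (cong (K₁ ∩ˢ_) K₂∩X) (trans (∩-comm K₁ X) (⊆⇒∩ X⊆K₁))) (∩-zeroˡ (restrict D K₂)))

    card-union : card (τ₁ K₁ ∪ˢ τ₂ K₂) + card X ≡ card K₁ + card K₂
    card-union = begin
      card (τ₁ K₁ ∪ˢ τ₂ K₂) + card X                     ≡⟨ cong (λ S → card S + card X) union≡ ⟩
      card (K₁ ++ restrict D K₂) + card X                ≡⟨ cong (_+ card X) (card-++ K₁) ⟩
      card K₁ + card (restrict D K₂) + card X            ≡⟨ ℕ.+-assoc (card K₁) _ _ ⟩
      card K₁ + (card (restrict D K₂) + card X)          ≡⟨ cong (card K₁ +_) (ℕ.+-comm _ (card X)) ⟩
      card K₁ + (card X + card (restrict D K₂))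
        ≡⟨ cong (λ S → card K₁ + (card S + card (restrict D K₂))) K₂∩X ⟨
      card K₁ + (card (K₂ ∩ˢ X) + card (restrict D K₂))  ≡⟨ cong (card K₁ +_) (card-split {S = K₂} X K₂⊆L) ⟩
      card K₁ + card K₂                                  ∎
      where open ≡-Reasoning

    -- Gluing adds exactly the elements of `K₂` outside `X`, so a union no larger than `K₁` adds
    -- nothing.
    card≤⇒union≡τ₁ : card (τ₁ K₁ ∪ˢ τ₂ K₂) ℕ.≤ card K₁ → τ₁ K₁ ≡ τ₁ K₁ ∪ˢ τ₂ K₂
    card≤⇒union≡τ₁ h = trans (cong (K₁ ++_) (sym (card≡0⇒∅ (restrict D K₂) zero-card))) (sym union≡)
      where
      zero-card : card (restrict D K₂) ≡ 0
      zero-card = ℕ.n≤0⇒n≡0 (ℕ.+-cancelˡ-≤ (card K₁) _ _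
        (ℕ.≤-trans (ℕ.≤-reflexive (sym (trans (cong card union≡) (card-++ K₁))))
          (ℕ.≤-trans h (ℕ.≤-reflexive (sym (ℕ.+-identityʳ _))))))

    τ₁⊆union : ∀ {S} → S ⊆ K₁ → τ₁ S ⊆ (τ₁ K₁ ∪ˢ τ₂ K₂)
    τ₁⊆union {S} h = subst (τ₁ S ⊆_) (sym union≡) (++-⊆⁺ {S = S} {K₁} h (∅-⊆ (restrict D K₂)))

    τ₁⊆union⁻ : ∀ {S} → τ₁ S ⊆ (τ₁ K₁ ∪ˢ τ₂ K₂) → S ⊆ K₁
    τ₁⊆union⁻ {S} h = proj₁ (++-⊆⁻ S K₁ (subst (τ₁ S ⊆_) union≡ h))

    τ₂⊆union : ∀ {S} → S ⊆ K₂ → τ₂ S ⊆ (τ₁ K₁ ∪ˢ τ₂ K₂)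
    τ₂⊆union {S} h = subst (τ₂ S ⊆_) (sym union≡)
      (++-⊆⁺ {S = S ∩ˢ X} {K₁} (⊆-trans {S = S ∩ˢ X} {X} (∩-⊆ʳ S X) X⊆K₁) (restrict-mono {S} {K₂} h))

    τ₂⊆union⁻ : ∀ {S} → S ⊆ L → τ₂ S ⊆ (τ₁ K₁ ∪ˢ τ₂ K₂) → S ⊆ K₂
    τ₂⊆union⁻ {S} S⊆L h = restrict⊆⇒⊆ {S} {K₂} S⊆L (⊆-trans {S = S ∩ˢ X} {X} (∩-⊆ʳ S X) X⊆K₂)
      (proj₂ (++-⊆⁻ (S ∩ˢ X) K₁ (subst (τ₂ S ⊆_) union≡ h)))

  -- Records which clause of `E'` an edge comes from. The Boolean search is decoded once, in `view`,
  -- and later inductions match on this type.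
  data View : Subset n' → Set where
    left  : ∀ {K} → BHyp.E M K ≡ true → View (τ₁ K)
    right : ∀ {K} → BHyp.E M K ≡ true → K ⊆ L → View (τ₂ K)
    union : ∀ {K₁ K₂} → BHyp.E M K₁ ≡ true → BHyp.E M K₂ ≡ true → K₂ ⊆ L →
            X ⊆ (K₁ ∩ˢ K₂) → View (τ₁ K₁ ∪ˢ τ₂ K₂)

  view : ∀ {S} → E' S ≡ true → View S
  view {S} h with ∨-true⁻ h
  ... | inj₁ h₁ with any⁻ _ (allSubsets N) h₁
  ...   | K , _ , p with ∧-true⁻ {BHyp.E M K} p
  ...     | K∈E , e = subst View (=ˢ⇒≡ _ S e) (left K∈E)
  view {S} h | inj₂ h′ with ∨-true⁻ h′
  ... | inj₁ h₂ with any⁻ _ (allSubsets N) h₂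
  ...   | K , _ , p with ∧-true⁻ {BHyp.E M K} p
  ...     | K∈E , q with ∧-true⁻ {K ⊆ᵇ L} q
  ...       | K⊆L , e = subst View (=ˢ⇒≡ _ S e) (right K∈E K⊆L)
  view {S} h | inj₂ h′ | inj₂ h₃ with any⁻ _ (allSubsets N) h₃
  ... | K₁ , _ , p with any⁻ _ (allSubsets N) p
  ...   | K₂ , _ , q with ∧-true⁻ q
  ...     | g , e with ∧-true⁻ {BHyp.E M K₁} g
  ...       | K₁∈E , g′ with ∧-true⁻ {BHyp.E M K₂} g′
  ...         | K₂∈E , g″ with ∧-true⁻ {K₂ ⊆ᵇ L} g″
  ...           | K₂⊆L , X⊆ = subst View (=ˢ⇒≡ _ S e) (union K₁∈E K₂∈E K₂⊆L X⊆)

  private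
    -- The search operators and predicates of `E'` and `B'` are private or anonymous where they are
    -- defined. These named versions unfold to the same terms, so that witnesses can be supplied to
    -- them.
    some : (Subset N → Bool) → Bool
    some p = any p (allSubsets N)

    some⁺ : ∀ (p : Subset N → Bool) {K} → p K ≡ true → some p ≡ true
    some⁺ p {K} = any⁺ p (∈-allSubsets K)

    glue : Subset N → Subset N → Bool
    glue K₁ K₂ = BHyp.E M K₁ ∧ BHyp.E M K₂ ∧ (K₂ ⊆ᵇ L) ∧ (X ⊆ᵇ (K₁ ∩ˢ K₂))

    glue⁺ : ∀ {K₁ K₂} → BHyp.E M K₁ ≡ true → BHyp.E M K₂ ≡ true → K₂ ⊆ L →
            X ⊆ (K₁ ∩ˢ K₂) → glue K₁ K₂ ≡ true
    glue⁺ p q i j = ∧-true⁺ p (∧-true⁺ q (∧-true⁺ i j))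

    e₁ e₂ : Subset n' → Subset N → Bool
    e₁ S K = BHyp.E M K ∧ (τ₁ K =ˢ S)
    e₂ S K = BHyp.E M K ∧ (K ⊆ᵇ L) ∧ (τ₂ K =ˢ S)

    e₃ : Subset n' → Subset N → Subset N → Bool
    e₃ S K₁ K₂ = glue K₁ K₂ ∧ ((τ₁ K₁ ∪ˢ τ₂ K₂) =ˢ S)

    b₁ b₂ b₃ : Subset n' → Subset n' → Subset N → Subset N → Bool
    b₁ S T A C = BHyp.B M A C ∧ (τ₁ A =ˢ S) ∧ (τ₁ C =ˢ T)
    b₂ S T A C = BHyp.B M A C ∧ (A ⊆ᵇ L) ∧ (C ⊆ᵇ L) ∧ (τ₂ A =ˢ S) ∧ (τ₂ C =ˢ T)
    b₃ S T K₁ K₂ = glue K₁ K₂ ∧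
      (((τ₁ K₁ =ˢ S) ∧ (τ₂ K₂ =ˢ T)) ∨ ((τ₂ K₂ =ˢ S) ∧ (τ₁ K₁ =ˢ T)))

  E'-left : ∀ {K} → BHyp.E M K ≡ true → E' (τ₁ K) ≡ true
  E'-left {K} p = ∨-true⁺ˡ (some⁺ (e₁ (τ₁ K)) (∧-true⁺ p (=ˢ-refl (τ₁ K))))

  E'-right : ∀ {K} → BHyp.E M K ≡ true → K ⊆ L → E' (τ₂ K) ≡ true
  E'-right {K} p K⊆L = ∨-true⁺ʳ {some (e₁ (τ₂ K))} (∨-true⁺ˡ
    (some⁺ (e₂ (τ₂ K)) (∧-true⁺ p (∧-true⁺ K⊆L (=ˢ-refl (τ₂ K))))))

  E'-union : ∀ {K₁ K₂} → BHyp.E M K₁ ≡ true → BHyp.E M K₂ ≡ true → K₂ ⊆ L →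
             X ⊆ (K₁ ∩ˢ K₂) → E' (τ₁ K₁ ∪ˢ τ₂ K₂) ≡ true
  E'-union {K₁} {K₂} p q i j = ∨-true⁺ʳ {some (e₁ U)} (∨-true⁺ʳ {some (e₂ U)}
    (some⁺ (λ K₁ → some (e₃ U K₁)) (some⁺ (e₃ U K₁) (∧-true⁺ (glue⁺ p q i j) (=ˢ-refl U)))))
    where U = τ₁ K₁ ∪ˢ τ₂ K₂

  B'-left : ∀ {S T} → BHyp.B M S T ≡ true → B' (τ₁ S) (τ₁ T) ≡ true
  B'-left {S} {T} p = ∨-true⁺ˡ (some⁺ (λ A → some (b₁ (τ₁ S) (τ₁ T) A)) (some⁺ (b₁ (τ₁ S) (τ₁ T) S)
    (∧-true⁺ p (∧-true⁺ (=ˢ-refl (τ₁ S)) (=ˢ-refl (τ₁ T))))))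

  B'-right : ∀ {S T} → BHyp.B M S T ≡ true → S ⊆ L → T ⊆ L → B' (τ₂ S) (τ₂ T) ≡ true
  B'-right {S} {T} p S⊆L T⊆L = ∨-true⁺ʳ {some (λ A → some (b₁ (τ₂ S) (τ₂ T) A))} (∨-true⁺ˡ
    (some⁺ (λ A → some (b₂ (τ₂ S) (τ₂ T) A)) (some⁺ (b₂ (τ₂ S) (τ₂ T) S)
      (∧-true⁺ p (∧-true⁺ S⊆L (∧-true⁺ T⊆L (∧-true⁺ (=ˢ-refl (τ₂ S)) (=ˢ-refl (τ₂ T)))))))))

  B'-union : ∀ {K₁ K₂} → BHyp.E M K₁ ≡ true → BHyp.E M K₂ ≡ true → K₂ ⊆ L →
             X ⊆ (K₁ ∩ˢ K₂) → B' (τ₁ K₁) (τ₂ K₂) ≡ true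
  B'-union {K₁} {K₂} p q i j =
    ∨-true⁺ʳ {some (λ A → some (b₁ S T A))} (∨-true⁺ʳ {some (λ A → some (b₂ S T A))}
      (some⁺ (λ A → some (b₃ S T A)) (some⁺ (b₃ S T K₁)
        (∧-true⁺ (glue⁺ p q i j) (∨-true⁺ˡ (∧-true⁺ (=ˢ-refl S) (=ˢ-refl T)))))))
    where
    S = τ₁ K₁
    T = τ₂ K₂

  data FrameView : Subset n' → Set where
    left  : ∀ {e} → BHyp.E M e ≡ true → card e ≡ k → FrameView (τ₁ e)
    right : ∀ {e} → BHyp.E M e ≡ true → card e ≡ k → e ⊆ L → FrameView (τ₂ e)

  -- An edge glued from two pieces has k elements only if it is its own first piece.
  frameView : ∀ {S} → E' S ≡ true → card S ≡ k → FrameView S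
  frameView p c with view p
  ... | left {K} K∈E = left K∈E (trans (sym (card-τ₁ K)) c)
  ... | right {K} K∈E K⊆L = right K∈E (trans (sym (card-τ₂ {K} K⊆L)) c) K⊆L
  ... | union {K₁} {K₂} K₁∈E _ K₂⊆L X⊆ =
    subst FrameView τ₁≡ (left K₁∈E (trans (sym (card-τ₁ K₁)) (trans (cong card τ₁≡) c)))
    where
    τ₁≡ : τ₁ K₁ ≡ τ₁ K₁ ∪ˢ τ₂ K₂
    τ₁≡ = Union.card≤⇒union≡τ₁ {K₁} {K₂} K₂⊆L X⊆ (ℕ.≤-trans (ℕ.≤-reflexive c) (min-card K₁ K₁∈E))

  wellformed : Wellformed k M′
  wellformed = record
    -- The new vertex set is glued from the edges V and `L`.
    { full-edge = subst (λ S → E' S ≡ true) full≡ (E'-union full-edge L∈E (⊆-refl L) X⊆full∩L)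
    ; min-card  = λ K p → bound (view p)
    ; non-empty = let e , e∈ = non-empty ; p , c , _ = ∈-edgesIn⁻ M fullˢ e∈ in
        τ₁ e , ∈-edgesIn⁺ M′ fullˢ (E'-left p) (trans (card-τ₁ e) c) (⊆-full (τ₁ e))
    }
    where
    X⊆full∩L : X ⊆ (fullˢ ∩ˢ L)
    X⊆full∩L = subst (X ⊆_) (trans (sym (⊆⇒∩ (⊆-full L))) (∩-comm L fullˢ)) X⊆L
    full≡ : τ₁ fullˢ ∪ˢ τ₂ L ≡ fullˢ
    full≡ = trans (Union.union≡ {fullˢ} {L} (⊆-refl L) X⊆full∩L)
                  (trans (cong (fullˢ ++_) (restrict-∖-full L X)) (++-full N m))
    bound : ∀ {K} → View K → k ℕ.≤ card K
    bound (left {K} p) = subst (k ℕ.≤_) (sym (card-τ₁ K)) (min-card K p)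
    bound (right {K} p K⊆L) = subst (k ℕ.≤_) (sym (card-τ₂ {K} K⊆L)) (min-card K p)
    bound (union {K₁} {K₂} p _ K₂⊆L X⊆) = ℕ.≤-trans (min-card K₁ p)
      (subst (card K₁ ℕ.≤_) (sym (trans (cong card (Union.union≡ {K₁} {K₂} K₂⊆L X⊆)) (card-++ K₁))) (ℕ.m≤m+n _ _))

  -- A second copy contained in `τ₁ K` comes from `X`, where the copies coincide, so reflecting adds
  -- no edge inside an old set.
  edgesIn-left : ∀ K → edgesIn k M′ (τ₁ K) ↭ map τ₁ (edgesIn k M K)
  edgesIn-left K = unique-↭ (edgesIn-unique k M′ (τ₁ K))
    (Unique.map⁺ τ₁-injective (edgesIn-unique k M K)) to from
    where
    to : ∀ {S} → S ∈ edgesIn k M′ (τ₁ K) → S ∈ map τ₁ (edgesIn k M K)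
    to S∈ with ∈-edgesIn⁻ M′ (τ₁ K) S∈
    ... | p , c , i with frameView p c
    ... | left {e} e∈E c′ = ∈-map⁺ τ₁ (∈-edgesIn⁺ M K e∈E c′ (τ₁-mono⁻ {e} {K} i))
    ... | right {e} e∈E c′ e⊆L = subst (_∈ _) τ≡
      (∈-map⁺ τ₁ (∈-edgesIn⁺ M K e∈E c′ (τ₁-mono⁻ {e} {K} (subst (_⊆ τ₁ K) (sym τ≡) i))))
      where τ≡ = τ₁≡τ₂ {e} (τ₂⊆τ₁⇒⊆X {e} {K} e⊆L i)
    from : ∀ {S} → S ∈ map τ₁ (edgesIn k M K) → S ∈ edgesIn k M′ (τ₁ K)
    from S∈ with ∈-map⁻ τ₁ S∈
    ... | e , e∈ , refl with ∈-edgesIn⁻ M K e∈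
    ... | p , c , i = ∈-edgesIn⁺ M′ (τ₁ K) (E'-left p) (trans (card-τ₁ e) c) (τ₁-mono {e} {K} i)

  edgesIn-right : ∀ {K} → K ⊆ L → edgesIn k M′ (τ₂ K) ↭ map τ₂ (edgesIn k M K)
  edgesIn-right {K} K⊆L = unique-↭ (edgesIn-unique k M′ (τ₂ K))
    (map-unique τ₂ (λ p q → τ₂-injective (in-L p) (in-L q)) (edgesIn-unique k M K)) to from
    where
    in-L : ∀ {e} → e ∈ edgesIn k M K → e ⊆ L
    in-L {e} e∈ = ⊆-trans {S = e} {K} (proj₂ (proj₂ (∈-edgesIn⁻ M K e∈))) K⊆L
    to : ∀ {S} → S ∈ edgesIn k M′ (τ₂ K) → S ∈ map τ₂ (edgesIn k M K)
    to S∈ with ∈-edgesIn⁻ M′ (τ₂ K) S∈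
    ... | p , c , i with frameView p c
    ... | right {e} e∈E c′ e⊆L = ∈-map⁺ τ₂ (∈-edgesIn⁺ M K e∈E c′ (τ₂-mono⁻ {e} {K} e⊆L i))
    ... | left {e} e∈E c′ = subst (_∈ _) (sym τ≡)
      (∈-map⁺ τ₂ (∈-edgesIn⁺ M K e∈E c′
        (τ₂-mono⁻ {e} {K} (⊆-trans {S = e} {X} e⊆X X⊆L) (subst (_⊆ τ₂ K) τ≡ i))))
      where
      e⊆X = τ₁⊆τ₂⇒⊆X {e} {K} i
      τ≡  = τ₁≡τ₂ {e} e⊆X
    from : ∀ {S} → S ∈ map τ₂ (edgesIn k M K) → S ∈ edgesIn k M′ (τ₂ K)
    from S∈ with ∈-map⁻ τ₂ S∈
    ... | e , e∈ , refl with ∈-edgesIn⁻ M K e∈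
    ... | p , c , i = ∈-edgesIn⁺ M′ (τ₂ K) (E'-right p (in-L e∈))
                        (trans (card-τ₂ {e} (in-L e∈)) c) (τ₂-mono {e} {K} i)

  -- Inclusion-exclusion, with the edges inside `X` moved to the left to avoid a difference of
  -- lists: such an edge occurs in both `K₁` and `K₂`, and its two copies are one edge of the union.
  edgesIn-union : ∀ {K₁ K₂} → K₂ ⊆ L → X ⊆ (K₁ ∩ˢ K₂) →
    edgesIn k M′ (τ₁ K₁ ∪ˢ τ₂ K₂) List.++ map τ₁ (edgesIn k M X) ↭
    map τ₁ (edgesIn k M K₁) List.++ map τ₂ (edgesIn k M K₂)
  edgesIn-union {K₁} {K₂} K₂⊆L X⊆ = begin
    F′ List.++ map τ₁ FX                             ↭⟨ Perm.++⁺ʳ (map τ₁ FX) F′↭ ⟩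
    (map τ₁ F₁ List.++ map τ₂ rest) List.++ map τ₁ FX
      ≡⟨ List.++-assoc (map τ₁ F₁) (map τ₂ rest) (map τ₁ FX) ⟩
    map τ₁ F₁ List.++ (map τ₂ rest List.++ map τ₁ FX)
      ≡⟨ cong (λ es → map τ₁ F₁ List.++ (map τ₂ rest List.++ es)) (List.map-cong-local (All.tabulate λ {e} e∈ → τ₁≡τ₂ {e} (in-X e∈))) ⟩
    map τ₁ F₁ List.++ (map τ₂ rest List.++ map τ₂ FX)
      ≡⟨ cong (map τ₁ F₁ List.++_) (List.map-++ τ₂ rest FX) ⟨
    map τ₁ F₁ List.++ map τ₂ (rest List.++ FX)       ↭⟨ Perm.++⁺ˡ (map τ₁ F₁) (Perm.map⁺ τ₂ F₂↭) ⟨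
    map τ₁ F₁ List.++ map τ₂ F₂                      ∎
    where
    open Perm.PermutationReasoning
    open Union {K₁} {K₂} K₂⊆L X⊆
    F′ = edgesIn k M′ (τ₁ K₁ ∪ˢ τ₂ K₂)
    FX = edgesIn k M X
    F₁ = edgesIn k M K₁
    F₂ = edgesIn k M K₂
    -- Edges of `K₂` inside `X` are already present as first copies; only the others are new.
    outside? = λ e → not (e ⊆ᵇ X) Bool.≟ true
    rest = filter outside? F₂
    in-X : ∀ {e} → e ∈ FX → e ⊆ X
    in-X e∈ = proj₂ (proj₂ (∈-edgesIn⁻ M X e∈))
    in-L : ∀ {e} → e ∈ F₂ → e ⊆ L
    in-L {e} e∈ = ⊆-trans {S = e} {K₂} (proj₂ (proj₂ (∈-edgesIn⁻ M K₂ e∈))) K₂⊆L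
    ∈-rest⁻ : ∀ {e} → e ∈ rest → e ∈ F₂ × not (e ⊆ᵇ X) ≡ true
    ∈-rest⁻ = ∈-filter⁻ outside? {xs = F₂}
    not-both : ∀ {A : Set} {b} → b ≡ true → not b ≡ true → A
    not-both refl ()

    F₂↭ : F₂ ↭ rest List.++ FX
    F₂↭ = unique-↭ (edgesIn-unique k M K₂)
      (Unique.++⁺ (Unique.filter⁺ outside? (edgesIn-unique k M K₂)) (edgesIn-unique k M X)
        (λ (p , q) → not-both (in-X q) (proj₂ (∈-rest⁻ p))))
      to from
      where
      to : ∀ {e} → e ∈ F₂ → e ∈ rest List.++ FX
      to {e} e∈ with e ⊆ᵇ X in e⊆X
      ... | false = ∈-++⁺ˡ (∈-filter⁺ outside? e∈ (cong not e⊆X))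
      ... | true  = let p , c , _ = ∈-edgesIn⁻ M K₂ e∈ in ∈-++⁺ʳ rest (∈-edgesIn⁺ M X p c e⊆X)
      from : ∀ {e} → e ∈ rest List.++ FX → e ∈ F₂
      from {e} e∈ with ∈-++⁻ rest e∈
      ... | inj₁ e∈rest = proj₁ (∈-rest⁻ e∈rest)
      ... | inj₂ e∈FX = let p , c , i = ∈-edgesIn⁻ M X e∈FX in
                        ∈-edgesIn⁺ M K₂ p c (⊆-trans {S = e} {X} i X⊆K₂)

    F′↭ : F′ ↭ map τ₁ F₁ List.++ map τ₂ rest
    F′↭ = unique-↭ (edgesIn-unique k M′ (τ₁ K₁ ∪ˢ τ₂ K₂))
      (Unique.++⁺ (Unique.map⁺ τ₁-injective (edgesIn-unique k M K₁))
        (map-unique τ₂ (λ p q → τ₂-injective (in-L (proj₁ (∈-rest⁻ p))) (in-L (proj₁ (∈-rest⁻ q))))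
          (Unique.filter⁺ outside? (edgesIn-unique k M K₂)))
        disjoint)
      to from
      where
      disjoint : ∀ {S} → S ∈ map τ₁ F₁ × S ∈ map τ₂ rest → _
      disjoint (p , q) with ∈-map⁻ τ₁ p | ∈-map⁻ τ₂ q
      ... | e , _ , refl | f , f∈ , eq =
        not-both (τ₂⊆τ₁⇒⊆X {f} {e} (in-L (proj₁ (∈-rest⁻ f∈))) (⊆-reflexive (sym eq))) (proj₂ (∈-rest⁻ f∈))
      to : ∀ {S} → S ∈ F′ → S ∈ map τ₁ F₁ List.++ map τ₂ rest
      to S∈ with ∈-edgesIn⁻ M′ (τ₁ K₁ ∪ˢ τ₂ K₂) S∈
      ... | p , c , i with frameView p c
      ... | left {e} e∈E c′ = ∈-++⁺ˡ (∈-map⁺ τ₁ (∈-edgesIn⁺ M K₁ e∈E c′ (τ₁⊆union⁻ {e} i)))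
      ... | right {e} e∈E c′ e⊆L with e ⊆ᵇ X in e⊆X
      ...   | false = ∈-++⁺ʳ (map τ₁ F₁) (∈-map⁺ τ₂ (∈-filter⁺ outside?
                        (∈-edgesIn⁺ M K₂ e∈E c′ (τ₂⊆union⁻ {e} e⊆L i)) (cong not e⊆X)))
      ...   | true  = ∈-++⁺ˡ (subst (_∈ map τ₁ F₁) (τ₁≡τ₂ {e} e⊆X)
                        (∈-map⁺ τ₁ (∈-edgesIn⁺ M K₁ e∈E c′ (⊆-trans {S = e} {X} e⊆X X⊆K₁))))
      from : ∀ {S} → S ∈ map τ₁ F₁ List.++ map τ₂ rest → S ∈ F′
      from S∈ with ∈-++⁻ (map τ₁ F₁) S∈
      ... | inj₁ S∈₁ with ∈-map⁻ τ₁ S∈₁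
      ...   | e , e∈ , refl with ∈-edgesIn⁻ M K₁ e∈
      ...     | p , c , i = ∈-edgesIn⁺ M′ (τ₁ K₁ ∪ˢ τ₂ K₂) (E'-left p) (trans (card-τ₁ e) c) (τ₁⊆union {e} i)
      from S∈ | inj₂ S∈₂ with ∈-map⁻ τ₂ S∈₂
      ...   | e , e∈ , refl with ∈-edgesIn⁻ M K₂ (proj₁ (∈-rest⁻ e∈))
      ...     | p , c , i = ∈-edgesIn⁺ M′ (τ₁ K₁ ∪ˢ τ₂ K₂) (E'-right p e⊆L)
                              (trans (card-τ₂ {e} e⊆L) c) (τ₂⊆union {e} i)
        where e⊆L = in-L (proj₁ (∈-rest⁻ e∈))

trivial-edgesIn : ∀ k → edgesIn k (trivial k) fullˢ ↭ fullˢ ∷ []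
trivial-edgesIn k = unique-↭ (edgesIn-unique k (trivial k) fullˢ) ([] ∷ [])
  (λ {e} e∈ → here (=ˢ⇒≡ e fullˢ (proj₁ (∈-edgesIn⁻ (trivial k) fullˢ e∈))))
  (λ { (here refl) → ∈-edgesIn⁺ (trivial k) fullˢ (=ˢ-refl (fullˢ {k})) (card-full k) (⊆-full (fullˢ {k})) })

trivial-wellformed : ∀ k → Wellformed k (trivial k)
trivial-wellformed k = record
  { full-edge = =ˢ-refl (fullˢ {k})
  ; min-card  = λ K p → ℕ.≤-reflexive (sym (trans (cong card (=ˢ⇒≡ K fullˢ p)) (card-full k)))
  ; non-empty = fullˢ , ∈-edgesIn⁺ (trivial k) fullˢ (=ˢ-refl (fullˢ {k})) (card-full k) (⊆-full (fullˢ {k}))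
  }

InC⇒Wellformed : ∀ {k M} → InC k M → Wellformed k M
InC⇒Wellformed base = trivial-wellformed _
InC⇒Wellformed (step M∈C L X L∈E X⊆L _) = Step.wellformed (InC⇒Wellformed M∈C) L X L∈E X⊆L

-- Weak thickness

Term₂ Term₁ : ℕ → Set
Term₂ n = ℚ × Subset n × Subset n
Term₁ n = ℚ × Subset n

-- A vector of ℝ^(2^V) is tested against an arbitrary φ, extended linearly from 1_S ↦ φ S;
-- this turns the images under τ₁ and τ₂ into compositions φ ∘ τ₁ and φ ∘ τ₂.
tφ : ∀ {n} → (Subset n → ℚ) → Subset n → Subset n → ℚ
tφ φ A C = φ (A ∪ˢ C) +ℚ ((- 1ℚ) *ℚ φ A +ℚ ((- 1ℚ) *ℚ φ C +ℚ φ (A ∩ˢ C)))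

eval₂ : ∀ {n} → (Subset n → ℚ) → List (Term₂ n) → ℚ
eval₂ φ ts = ∑ ts (λ (c , A , C) → c *ℚ tφ φ A C)

eval₁ : ∀ {n} → (Subset n → ℚ) → List (Term₁ n) → ℚ
eval₁ φ ts = ∑ ts (λ (c , A) → c *ℚ φ A)

map₂ : ∀ {m n} → (Subset m → Subset n) → Term₂ m → Term₂ n
map₂ τ (c , A , C) = c , τ A , τ C

map₁ : ∀ {m n} → (Subset m → Subset n) → Term₁ m → Term₁ n
map₁ τ (c , A) = c , τ A

NonNeg₂ : ∀ {n} → List (Term₂ n) → Set
NonNeg₂ = All (λ { (c , _ , _) → 0ℚ ≤ c })

NonNeg₁ : ∀ {n} → List (Term₁ n) → Set
NonNeg₁ = All (λ { (c , _) → 0ℚ ≤ c })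

-- A certificate for s(K) ∈ W_B + Q. The pairs in `w` must lie inside `K` because a reflection gives
-- second copies only to pairs of B inside `L`; this is what lets `τ₂` carry the certificate of an
-- edge contained in `L`.
record Thick (k : ℕ) (M : BHyp) (K : Subset (BHyp.n M)) : Set where
  field
    w        : List (Term₂ (BHyp.n M))
    w-in-B   : All (λ (_ , A , C) → BHyp.B M A C ≡ true × A ⊆ K × C ⊆ K) w
    c        : ℚ
    p        : List (Term₂ (BHyp.n M))
    p-nonNeg : NonNeg₂ p
    q        : List (Term₁ (BHyp.n M))
    q-nonNeg : NonNeg₁ q
    eval     : ∀ φ → ∑ (edgesIn k M K) φ -ℚ φ K ≡
                 eval₂ φ w +ℚ (c *ℚ φ emptyˢ +ℚ (eval₂ φ p +ℚ eval₁ φ q))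

-- Membership in Q. The coefficient `c` has no sign condition, since Q contains the whole line
-- spanned by 1_∅.
record ConeQ {n} (F : (Subset n → ℚ) → ℚ) : Set where
  field
    c        : ℚ
    p        : List (Term₂ n)
    p-nonNeg : NonNeg₂ p
    q        : List (Term₁ n)
    q-nonNeg : NonNeg₁ q
    eval     : ∀ φ → F φ ≡ c *ℚ φ emptyˢ +ℚ (eval₂ φ p +ℚ eval₁ φ q)

-- Peel off the edges one at a time: t_{e, X∖e} = 1_X − 1_e − 1_{X∖e} + 1_∅.
disjoint⇒ConeQ : ∀ {n} (es : List (Subset n)) X → Unique es → (∀ {e} → e ∈ es → e ⊆ X) → Disjoint es →
                 ConeQ (λ φ → φ X -ℚ ∑ es φ)
disjoint⇒ConeQ [] X _ _ _ = record
  { c = 0ℚ ; p = [] ; p-nonNeg = [] ; q = (1ℚ , X) ∷ [] ; q-nonNeg = 0≤1 ∷ []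
  ; eval = λ φ → arith (φ X) (φ emptyˢ) }
  where
  arith : ∀ x y → x -ℚ 0ℚ ≡ 0ℚ *ℚ y +ℚ (0ℚ +ℚ (1ℚ *ℚ x +ℚ 0ℚ))
  arith = solve-∀ ringℚ
disjoint⇒ConeQ (e ∷ es) X (e∉ ∷ u) inX disj = record
  { c = IH.c -ℚ 1ℚ ; p = (1ℚ , e , X ∖ˢ e) ∷ IH.p ; p-nonNeg = 0≤1 ∷ IH.p-nonNeg
  ; q = IH.q ; q-nonNeg = IH.q-nonNeg ; eval = eval }
  where
  apart : ∀ {f} → f ∈ es → e ∩ˢ f ≡ emptyˢ
  apart f∈ = case disj (here refl) (there f∈) of λ where
    (inj₁ e≡f) → ⊥-elim (All.lookup e∉ f∈ e≡f)
    (inj₂ ∅)   → ∅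
  -- Disjointness puts the remaining edges inside `X ∖ˢ e`, where the induction continues.
  module IH = ConeQ (disjoint⇒ConeQ es (X ∖ˢ e) u
    (λ {f} f∈ → ⊆-∖ {S = f} {e} (inX (there f∈)) (apart f∈))
    (λ e∈ f∈ → disj (there e∈) (there f∈)))
  arith : ∀ x e y s z c p q → y -ℚ s ≡ c *ℚ z +ℚ (p +ℚ q) →
          x -ℚ (e +ℚ s) ≡ (c -ℚ 1ℚ) *ℚ z +ℚ ((1ℚ *ℚ (x +ℚ ((- 1ℚ) *ℚ e +ℚ ((- 1ℚ) *ℚ y +ℚ z))) +ℚ p) +ℚ q)
  arith x e y s z c p q h = trans (lhs x e y s) (trans (cong (λ t → ((x -ℚ e) -ℚ y) +ℚ t) h) (rhs x e y z c p q))
    where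
    lhs : ∀ x e y s → x -ℚ (e +ℚ s) ≡ ((x -ℚ e) -ℚ y) +ℚ (y -ℚ s)
    lhs = solve-∀ ringℚ
    rhs : ∀ x e y z c p q → ((x -ℚ e) -ℚ y) +ℚ (c *ℚ z +ℚ (p +ℚ q)) ≡
      (c -ℚ 1ℚ) *ℚ z +ℚ ((1ℚ *ℚ (x +ℚ ((- 1ℚ) *ℚ e +ℚ ((- 1ℚ) *ℚ y +ℚ z))) +ℚ p) +ℚ q)
    rhs = solve-∀ ringℚ
  eval : ∀ φ → φ X -ℚ (φ e +ℚ ∑ es φ) ≡
    (IH.c -ℚ 1ℚ) *ℚ φ emptyˢ +ℚ ((1ℚ *ℚ tφ φ e (X ∖ˢ e) +ℚ eval₂ φ IH.p) +ℚ eval₁ φ IH.q)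
  eval φ = trans (arith (φ X) (φ e) (φ (X ∖ˢ e)) (∑ es φ) (φ emptyˢ) IH.c (eval₂ φ IH.p) (eval₁ φ IH.q) (IH.eval φ))
    (cong₂ (λ S T → (IH.c -ℚ 1ℚ) *ℚ φ emptyˢ +ℚ
        ((1ℚ *ℚ (φ S +ℚ ((- 1ℚ) *ℚ φ e +ℚ ((- 1ℚ) *ℚ φ (X ∖ˢ e) +ℚ φ T))) +ℚ eval₂ φ IH.p) +ℚ eval₁ φ IH.q))
      (sym (∪-∖ (inX (here refl)))) (sym (∩-∖ e X)))

-- A map preserving unions and intersections sends t_{A,C} to t_{τA,τC}; both embeddings of the
-- reflection do.
eval₂-map : ∀ {m n} (τ : Subset m → Subset n) →
  (∀ S T → τ (S ∪ˢ T) ≡ τ S ∪ˢ τ T) → (∀ S T → τ (S ∩ˢ T) ≡ τ S ∩ˢ τ T) →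
  ∀ φ ts → eval₂ φ (map (map₂ τ) ts) ≡ eval₂ (φ ∘ τ) ts
eval₂-map τ τ-∪ τ-∩ φ ts = trans (∑-map (map₂ τ) ts _)
  (∑-cong ts (λ { {c , A , C} _ → cong₂ (λ U I → c *ℚ (φ U +ℚ ((- 1ℚ) *ℚ φ (τ A) +ℚ ((- 1ℚ) *ℚ φ (τ C) +ℚ φ I))))
    (sym (τ-∪ A C)) (sym (τ-∩ A C)) }))

module ThickStep {k M} (wf : Wellformed k M) (L X : Subset (BHyp.n M))
                 (L∈E : BHyp.E M L ≡ true) (X⊆L : X ⊆ L) where
  open Step wf L X L∈E X⊆L

  eval₂-τ₁ : ∀ φ ts → eval₂ φ (map (map₂ τ₁) ts) ≡ eval₂ (φ ∘ τ₁) ts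
  eval₂-τ₁ = eval₂-map τ₁ τ₁-∪ τ₁-∩

  eval₂-τ₂ : ∀ φ ts → eval₂ φ (map (map₂ τ₂) ts) ≡ eval₂ (φ ∘ τ₂) ts
  eval₂-τ₂ = eval₂-map τ₂ τ₂-∪ τ₂-∩

  eval₁-map : ∀ (τ : Subset N → Subset n') φ ts → eval₁ φ (map (map₁ τ) ts) ≡ eval₁ (φ ∘ τ) ts
  eval₁-map τ φ ts = ∑-map (map₁ τ) ts _

  transport : ∀ {K} (τ : Subset N → Subset n') → (τ emptyˢ ≡ emptyˢ) →
    (∀ φ ts → eval₂ φ (map (map₂ τ) ts) ≡ eval₂ (φ ∘ τ) ts) →
    (∀ {A C} → BHyp.B M A C ≡ true × A ⊆ K × C ⊆ K → B' (τ A) (τ C) ≡ true × τ A ⊆ τ K × τ C ⊆ τ K) →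
    edgesIn k M′ (τ K) ↭ map τ (edgesIn k M K) →
    Thick k M K → Thick k M′ (τ K)
  transport {K} τ τ-∅ eval₂-τ τ-B perm th = record
    { w = map (map₂ τ) w ; w-in-B = All.map⁺ (All.map τ-B w-in-B)
    ; c = c
    ; p = map (map₂ τ) p ; p-nonNeg = All.map⁺ p-nonNeg
    ; q = map (map₁ τ) q ; q-nonNeg = All.map⁺ q-nonNeg
    ; eval = λ φ → begin
        ∑ (edgesIn k M′ (τ K)) φ -ℚ φ (τ K)
          ≡⟨ cong (_-ℚ φ (τ K)) (trans (∑-↭ perm φ) (∑-map τ (edgesIn k M K) φ)) ⟩
        ∑ (edgesIn k M K) (φ ∘ τ) -ℚ φ (τ K)
          ≡⟨ eval (φ ∘ τ) ⟩
        eval₂ (φ ∘ τ) w +ℚ (c *ℚ φ (τ emptyˢ) +ℚ (eval₂ (φ ∘ τ) p +ℚ eval₁ (φ ∘ τ) q))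
          ≡⟨ cong₂ _+ℚ_ (eval₂-τ φ w) (cong₂ _+ℚ_ (cong (λ S → c *ℚ φ S) (sym τ-∅))
               (cong₂ _+ℚ_ (eval₂-τ φ p) (eval₁-map τ φ q))) ⟨
        eval₂ φ (map (map₂ τ) w) +ℚ (c *ℚ φ emptyˢ +ℚ (eval₂ φ (map (map₂ τ) p) +ℚ eval₁ φ (map (map₁ τ) q))) ∎
    }
    where
    open ≡-Reasoning
    open Thick th

  thick-left : ∀ {K} → Thick k M K → Thick k M′ (τ₁ K)
  thick-left {K} = transport τ₁ τ₁-∅ eval₂-τ₁
    (λ {A} {C} (b , A⊆K , C⊆K) → B'-left {A} {C} b , τ₁-mono {A} {K} A⊆K , τ₁-mono {C} {K} C⊆K)
    (edgesIn-left K)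

  thick-right : ∀ {K} → K ⊆ L → Thick k M K → Thick k M′ (τ₂ K)
  thick-right {K} K⊆L = transport τ₂ τ₂-∅ eval₂-τ₂
    (λ {A} {C} (b , A⊆K , C⊆K) →
      B'-right {A} {C} b (⊆-trans {S = A} {K} A⊆K K⊆L) (⊆-trans {S = C} {K} C⊆K K⊆L) ,
      τ₂-mono {A} {K} A⊆K , τ₂-mono {C} {K} C⊆K)
    (edgesIn-right {K} K⊆L)

  thick-union : ∀ {K₁ K₂} → BHyp.E M K₁ ≡ true → BHyp.E M K₂ ≡ true → K₂ ⊆ L → X ⊆ (K₁ ∩ˢ K₂) →
    ConeQ (λ φ → φ X -ℚ ∑ (edgesIn k M X) φ) →
    Thick k M K₁ → Thick k M K₂ → Thick k M′ (τ₁ K₁ ∪ˢ τ₂ K₂)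
  thick-union {K₁} {K₂} K₁∈E K₂∈E K₂⊆L X⊆ cone th₁ th₂ = record
    -- The two copies are related in the reflection by definition. The coefficient -1 is admissible
    -- because W_B is a span, not a cone.
    { w = (- 1ℚ , τ₁ K₁ , τ₂ K₂) ∷ map (map₂ τ₁) T₁.w List.++ map (map₂ τ₂) T₂.w
    ; w-in-B =
        (B'-union {K₁} {K₂} K₁∈E K₂∈E K₂⊆L X⊆ , ⊆-∪ˡ (τ₁ K₁) (τ₂ K₂) , ⊆-∪ʳ (τ₁ K₁) (τ₂ K₂)) ∷
        All.++⁺
          (All.map⁺ (All.map (λ { {_ , A , C} (b , A⊆ , C⊆) → B'-left {A} {C} b , τ₁⊆union {A} A⊆ , τ₁⊆union {C} C⊆ }) T₁.w-in-B))
          (All.map⁺ (All.map (λ { {_ , A , C} (b , A⊆ , C⊆) →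
            B'-right {A} {C} b (⊆-trans {S = A} {K₂} A⊆ K₂⊆L) (⊆-trans {S = C} {K₂} C⊆ K₂⊆L) ,
            τ₂⊆union {A} A⊆ , τ₂⊆union {C} C⊆ }) T₂.w-in-B))
    ; c = T₁.c +ℚ T₂.c +ℚ Q.c
    ; p = map (map₂ τ₁) T₁.p List.++ map (map₂ τ₂) T₂.p List.++ map (map₂ τ₁) Q.p
    ; p-nonNeg = All.++⁺ (All.map⁺ T₁.p-nonNeg) (All.++⁺ (All.map⁺ T₂.p-nonNeg) (All.map⁺ Q.p-nonNeg))
    ; q = map (map₁ τ₁) T₁.q List.++ map (map₁ τ₂) T₂.q List.++ map (map₁ τ₁) Q.q
    ; q-nonNeg = All.++⁺ (All.map⁺ T₁.q-nonNeg) (All.++⁺ (All.map⁺ T₂.q-nonNeg) (All.map⁺ Q.q-nonNeg))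
    ; eval = eval
    }
    where
    open ≡-Reasoning
    open Union {K₁} {K₂} K₂⊆L X⊆
    module T₁ = Thick th₁
    module T₂ = Thick th₂
    module Q = ConeQ cone
    U = τ₁ K₁ ∪ˢ τ₂ K₂
    module _ (φ : Subset n' → ℚ) where
      φ₁ = φ ∘ τ₁
      φ₂ = φ ∘ τ₂
      S′ = ∑ (edgesIn k M′ U) φ
      S₁ = ∑ (edgesIn k M K₁) φ₁
      S₂ = ∑ (edgesIn k M K₂) φ₂
      SX = ∑ (edgesIn k M X) φ₁

      sums : S′ +ℚ SX ≡ S₁ +ℚ S₂
      sums = begin
        S′ +ℚ SX                                  ≡⟨ cong (S′ +ℚ_) (∑-map τ₁ (edgesIn k M X) φ) ⟨
        S′ +ℚ ∑ (map τ₁ (edgesIn k M X)) φ        ≡⟨ ∑-++ (edgesIn k M′ U) _ φ ⟨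
        ∑ (edgesIn k M′ U List.++ map τ₁ (edgesIn k M X)) φ
                                                  ≡⟨ ∑-↭ (edgesIn-union {K₁} {K₂} K₂⊆L X⊆) φ ⟩
        ∑ (map τ₁ (edgesIn k M K₁) List.++ map τ₂ (edgesIn k M K₂)) φ
                                                  ≡⟨ ∑-++ (map τ₁ (edgesIn k M K₁)) _ φ ⟩
        ∑ (map τ₁ (edgesIn k M K₁)) φ +ℚ ∑ (map τ₂ (edgesIn k M K₂)) φ
                                                  ≡⟨ cong₂ _+ℚ_ (∑-map τ₁ (edgesIn k M K₁) φ) (∑-map τ₂ (edgesIn k M K₂) φ) ⟩
        S₁ +ℚ S₂                                  ∎

      -- Here `x` is the value at the intersection of the copies, which is `τ₁ X`. The 1_X inside
      -- the t-vector cancels the 1_X of the correction, and the edge terms balance by `sums`.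
      combine : ∀ s u s₁ s₂ sx k₁ k₂ x → s +ℚ sx ≡ s₁ +ℚ s₂ →
        s -ℚ u ≡ (- 1ℚ) *ℚ (u +ℚ ((- 1ℚ) *ℚ k₁ +ℚ ((- 1ℚ) *ℚ k₂ +ℚ x))) +ℚ ((s₁ -ℚ k₁) +ℚ ((s₂ -ℚ k₂) +ℚ (x -ℚ sx)))
      combine s u s₁ s₂ sx k₁ k₂ x h = trans (lhs s u sx) (trans (cong (λ t → (t -ℚ sx) -ℚ u) h) (rhs s₁ s₂ sx u k₁ k₂ x))
        where
        lhs : ∀ s u sx → s -ℚ u ≡ ((s +ℚ sx) -ℚ sx) -ℚ u
        lhs = solve-∀ ringℚ
        rhs : ∀ s₁ s₂ sx u k₁ k₂ x → ((s₁ +ℚ s₂) -ℚ sx) -ℚ u ≡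
          (- 1ℚ) *ℚ (u +ℚ ((- 1ℚ) *ℚ k₁ +ℚ ((- 1ℚ) *ℚ k₂ +ℚ x))) +ℚ ((s₁ -ℚ k₁) +ℚ ((s₂ -ℚ k₂) +ℚ (x -ℚ sx)))
        rhs = solve-∀ ringℚ

      regroup : ∀ t z w₁ c₁ p₁ q₁ w₂ c₂ p₂ q₂ c₃ p₃ q₃ →
        t +ℚ ((w₁ +ℚ (c₁ *ℚ z +ℚ (p₁ +ℚ q₁))) +ℚ ((w₂ +ℚ (c₂ *ℚ z +ℚ (p₂ +ℚ q₂))) +ℚ (c₃ *ℚ z +ℚ (p₃ +ℚ q₃)))) ≡
        (t +ℚ (w₁ +ℚ w₂)) +ℚ ((c₁ +ℚ c₂ +ℚ c₃) *ℚ z +ℚ ((p₁ +ℚ (p₂ +ℚ p₃)) +ℚ (q₁ +ℚ (q₂ +ℚ q₃))))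
      regroup = solve-∀ ringℚ

      z = φ emptyˢ
      t₀ = (- 1ℚ) *ℚ tφ φ (τ₁ K₁) (τ₂ K₂)

      eval : S′ -ℚ φ U ≡
        eval₂ φ ((- 1ℚ , τ₁ K₁ , τ₂ K₂) ∷ map (map₂ τ₁) T₁.w List.++ map (map₂ τ₂) T₂.w) +ℚ
        ((T₁.c +ℚ T₂.c +ℚ Q.c) *ℚ z +ℚ
         (eval₂ φ (map (map₂ τ₁) T₁.p List.++ map (map₂ τ₂) T₂.p List.++ map (map₂ τ₁) Q.p) +ℚ
          eval₁ φ (map (map₁ τ₁) T₁.q List.++ map (map₁ τ₂) T₂.q List.++ map (map₁ τ₁) Q.q)))
      eval = begin
        S′ -ℚ φ U
          ≡⟨ combine S′ (φ U) S₁ S₂ SX (φ₁ K₁) (φ₂ K₂) (φ₁ X) sums ⟩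
        (- 1ℚ) *ℚ (φ U +ℚ ((- 1ℚ) *ℚ φ₁ K₁ +ℚ ((- 1ℚ) *ℚ φ₂ K₂ +ℚ φ₁ X))) +ℚ
          ((S₁ -ℚ φ₁ K₁) +ℚ ((S₂ -ℚ φ₂ K₂) +ℚ (φ₁ X -ℚ SX)))
          ≡⟨ cong₂ _+ℚ_ (cong (λ S → (- 1ℚ) *ℚ (φ U +ℚ ((- 1ℚ) *ℚ φ₁ K₁ +ℚ ((- 1ℚ) *ℚ φ₂ K₂ +ℚ φ S)))) (sym intersection≡))
               (cong₂ _+ℚ_ (trans (T₁.eval φ₁) (cong (λ S → eval₂ φ₁ T₁.w +ℚ (T₁.c *ℚ φ S +ℚ (eval₂ φ₁ T₁.p +ℚ eval₁ φ₁ T₁.q))) τ₁-∅))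
               (cong₂ _+ℚ_ (trans (T₂.eval φ₂) (cong (λ S → eval₂ φ₂ T₂.w +ℚ (T₂.c *ℚ φ S +ℚ (eval₂ φ₂ T₂.p +ℚ eval₁ φ₂ T₂.q))) τ₂-∅))
                           (trans (Q.eval φ₁) (cong (λ S → Q.c *ℚ φ S +ℚ (eval₂ φ₁ Q.p +ℚ eval₁ φ₁ Q.q)) τ₁-∅)))) ⟩
        t₀ +ℚ ((eval₂ φ₁ T₁.w +ℚ (T₁.c *ℚ z +ℚ (eval₂ φ₁ T₁.p +ℚ eval₁ φ₁ T₁.q))) +ℚ
          ((eval₂ φ₂ T₂.w +ℚ (T₂.c *ℚ z +ℚ (eval₂ φ₂ T₂.p +ℚ eval₁ φ₂ T₂.q))) +ℚ
           (Q.c *ℚ z +ℚ (eval₂ φ₁ Q.p +ℚ eval₁ φ₁ Q.q))))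
          ≡⟨ regroup t₀ z (eval₂ φ₁ T₁.w) T₁.c (eval₂ φ₁ T₁.p) (eval₁ φ₁ T₁.q)
               (eval₂ φ₂ T₂.w) T₂.c (eval₂ φ₂ T₂.p) (eval₁ φ₂ T₂.q) Q.c (eval₂ φ₁ Q.p) (eval₁ φ₁ Q.q) ⟩
        (t₀ +ℚ (eval₂ φ₁ T₁.w +ℚ eval₂ φ₂ T₂.w)) +ℚ ((T₁.c +ℚ T₂.c +ℚ Q.c) *ℚ z +ℚ
          ((eval₂ φ₁ T₁.p +ℚ (eval₂ φ₂ T₂.p +ℚ eval₂ φ₁ Q.p)) +ℚ (eval₁ φ₁ T₁.q +ℚ (eval₁ φ₂ T₂.q +ℚ eval₁ φ₁ Q.q))))
          ≡⟨ cong₂ _+ℚ_ (cong (t₀ +ℚ_) (trans (∑-++ (map (map₂ τ₁) T₁.w) _ _) (cong₂ _+ℚ_ (eval₂-τ₁ φ T₁.w) (eval₂-τ₂ φ T₂.w))))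
               (cong ((T₁.c +ℚ T₂.c +ℚ Q.c) *ℚ z +ℚ_) (cong₂ _+ℚ_
                 (trans (∑-++ (map (map₂ τ₁) T₁.p) _ _) (cong₂ _+ℚ_ (eval₂-τ₁ φ T₁.p)
                   (trans (∑-++ (map (map₂ τ₂) T₂.p) _ _) (cong₂ _+ℚ_ (eval₂-τ₂ φ T₂.p) (eval₂-τ₁ φ Q.p)))))
                 (trans (∑-++ (map (map₁ τ₁) T₁.q) _ _) (cong₂ _+ℚ_ (eval₁-map τ₁ φ T₁.q)
                   (trans (∑-++ (map (map₁ τ₂) T₂.q) _ _) (cong₂ _+ℚ_ (eval₁-map τ₂ φ T₂.q) (eval₁-map τ₁ φ Q.q))))))) ⟨
        _ ∎

InC⇒Thick : ∀ {k M} → InC k M → ∀ {K} → BHyp.E M K ≡ true → Thick k M K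
InC⇒Thick {k} base {K} p with =ˢ⇒≡ K fullˢ p
-- The only frame edge of the trivial complex is V, so s(V) = 0 and the certificate is empty.
... | refl = record
  { w = [] ; w-in-B = [] ; c = 0ℚ ; p = [] ; p-nonNeg = [] ; q = [] ; q-nonNeg = []
  ; eval = λ φ → trans (cong (_-ℚ φ fullˢ) (∑-↭ (trivial-edgesIn k) φ)) (cancel (φ fullˢ) (φ emptyˢ)) }
  where
  cancel : ∀ x y → (x +ℚ 0ℚ) -ℚ x ≡ 0ℚ +ℚ (0ℚ *ℚ y +ℚ (0ℚ +ℚ 0ℚ))
  cancel = solve-∀ ringℚ
InC⇒Thick {k} (step {M} M∈C L X L∈E X⊆L X∈Z) {K} p = thick (view p)
  where
  wf = InC⇒Wellformed M∈C
  open Step wf L X L∈E X⊆L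
  open ThickStep wf L X L∈E X⊆L
  cone = disjoint⇒ConeQ (edgesIn k M X) X (edgesIn-unique k M X)
           (λ e∈ → proj₂ (proj₂ (∈-edgesIn⁻ M X e∈))) (InZ⇒Disjoint M X X∈Z)
  thick : ∀ {K} → View K → Thick k (r M L X) K
  thick (left {K} K∈E)       = thick-left (InC⇒Thick M∈C K∈E)
  thick (right {K} K∈E K⊆L)  = thick-right K⊆L (InC⇒Thick M∈C K∈E)
  thick (union {K₁} {K₂} K₁∈E K₂∈E K₂⊆L X⊆) =
    thick-union {K₁} {K₂} K₁∈E K₂∈E K₂⊆L X⊆ cone (InC⇒Thick M∈C K₁∈E) (InC⇒Thick M∈C K₂∈E)

sumT≡eval₂ : ∀ {n} (ts : List (Term₂ n)) S → sumT ts S ≡ eval₂ (λ A → 𝟙 A S) ts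
sumT≡eval₂ []                S = refl
sumT≡eval₂ ((c , A , C) ∷ ts) S = cong (c *ℚ tv A C S +ℚ_) (sumT≡eval₂ ts S)

sum𝟙≡eval₁ : ∀ {n} (ts : List (Term₁ n)) S → sum𝟙 ts S ≡ eval₁ (λ A → 𝟙 A S) ts
sum𝟙≡eval₁ []             S = refl
sum𝟙≡eval₁ ((c , A) ∷ ts) S = cong (c *ℚ 𝟙 A S +ℚ_) (sum𝟙≡eval₁ ts S)

foldr-𝟙 : ∀ {n} (es : List (Subset n)) S → foldr (λ e v → 𝟙 e ⊕ v) 𝟘 es S ≡ ∑ es (λ A → 𝟙 A S)
foldr-𝟙 []       S = refl
foldr-𝟙 (e ∷ es) S = cong (𝟙 e S +ℚ_) (foldr-𝟙 es S)

InC⇒WeaklyThick : ∀ {k M} → InC k M → WeaklyThickComplex k M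
InC⇒WeaklyThick {k} {M} M∈C =
  w , All.map proj₁ w-in-B , c , p , p-nonNeg , q , q-nonNeg , pointwise
  where
  open Thick (InC⇒Thick M∈C (Wellformed.full-edge (InC⇒Wellformed M∈C)))
  flip : ∀ x y → (- 1ℚ) *ℚ x +ℚ y ≡ y -ℚ x
  flip = solve-∀ ringℚ
  pointwise : ∀ S → sH (frame k M) S ≡ (sumT w ⊕ (c ⊙ 𝟙 emptyˢ) ⊕ sumT p ⊕ sum𝟙 q) S
  pointwise S = begin
    (- 1ℚ) *ℚ φ fullˢ +ℚ foldr (λ e v → 𝟙 e ⊕ v) 𝟘 (edges (frame k M)) S
      ≡⟨ cong ((- 1ℚ) *ℚ φ fullˢ +ℚ_) (trans (foldr-𝟙 (edges (frame k M)) S) (sym (∑-↭ (edgesIn-full k M) φ))) ⟩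
    (- 1ℚ) *ℚ φ fullˢ +ℚ ∑ (edgesIn k M fullˢ) φ
      ≡⟨ flip (φ fullˢ) _ ⟩
    ∑ (edgesIn k M fullˢ) φ -ℚ φ fullˢ
      ≡⟨ eval φ ⟩
    eval₂ φ w +ℚ (c *ℚ φ emptyˢ +ℚ (eval₂ φ p +ℚ eval₁ φ q))
      ≡⟨ cong₂ _+ℚ_ (sumT≡eval₂ w S) (cong (c *ℚ φ emptyˢ +ℚ_) (cong₂ _+ℚ_ (sumT≡eval₂ p S) (sum𝟙≡eval₁ q S))) ⟨
    sumT w S +ℚ (c *ℚ φ emptyˢ +ℚ (sumT p S +ℚ sum𝟙 q S)) ∎
    where
    open ≡-Reasoning
    -- This test function reads off the coordinate at `S`, turning the identity for all φ into an
    -- equality of vectors.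
    φ = λ A → 𝟙 A S

InC⇒ReflComplex : ∀ {k M} → InC k M → ReflComplex k M
InC⇒ReflComplex base                        = base
InC⇒ReflComplex (step M∈C L X L∈E X⊆L _) = step (InC⇒ReflComplex M∈C) L X L∈E X⊆L

-- Sidorenko's inequality

∏-indicator : ∀ {A : Set} (es : List A) (p : A → Bool) →
  (∏ es (⟦_⟧ ∘ p) ≡ 1ℚ × (∀ {e} → e ∈ es → p e ≡ true)) ⊎
  (∏ es (⟦_⟧ ∘ p) ≡ 0ℚ × ∃ λ e → e ∈ es × p e ≡ false)
∏-indicator []       p = inj₁ (refl , λ ())
∏-indicator (e ∷ es) p with p e in pe | ∏-indicator es p
... | false | _ = inj₂ (ℚ.*-zeroˡ (∏ es (⟦_⟧ ∘ p)) , e , here refl , pe)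
... | true  | inj₁ (eq , all-true) =
  inj₁ (trans (ℚ.*-identityˡ _) eq , λ { (here refl) → pe ; (there m) → all-true m })
... | true  | inj₂ (eq , f , f∈ , pf) = inj₂ (trans (ℚ.*-identityˡ _) eq , f , there f∈ , pf)

*-cancelˡ-≡ : ∀ {r p q} → 0ℚ < r → r *ℚ p ≡ r *ℚ q → p ≡ q
*-cancelˡ-≡ 0<r e = ℚ.≤-antisym (*-cancelˡ-≤ 0<r (ℚ.≤-reflexive e)) (*-cancelˡ-≤ 0<r (ℚ.≤-reflexive (sym e)))

∑-count : ∀ {A : Set} (p : A → Bool) xs → ι (length (filter (λ x → p x Bool.≟ true) xs)) ≡ ∑ xs (⟦_⟧ ∘ p)
∑-count p xs = begin
  ι (length (filter (λ x → p x Bool.≟ true) xs))            ≡⟨ ℚ.*-identityʳ _ ⟨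
  ι (length (filter (λ x → p x Bool.≟ true) xs)) *ℚ 1ℚ      ≡⟨ ∑-const (filter (λ x → p x Bool.≟ true) xs) 1ℚ ⟨
  ∑ (filter (λ x → p x Bool.≟ true) xs) (λ _ → 1ℚ)          ≡⟨ ∑-filter p xs (λ _ → 1ℚ) ⟩
  ∑ xs (λ x → ⟦ p x ⟧ *ℚ 1ℚ)                                ≡⟨ ∑-cong xs (λ {x} _ → ℚ.*-identityʳ ⟦ p x ⟧) ⟩
  ∑ xs (⟦_⟧ ∘ p)                                            ∎
  where open ≡-Reasoning

-- The density is a positive number `d` given with its defining count. Positivity of `d` and of the
-- number of vertices makes every normalising factor invertible.
module Sidorenko (k : ℕ) (G : Hyp) (0<β : 0ℚ < ι (Hyp.n G)) (d : ℚ) (0<d : 0ℚ < d)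
  (d-density : ∑ (allMaps k (Hyp.n G)) (λ z → ⟦ Hyp.E G (image z fullˢ) ⟧) ≡ d *ℚ (ι (Hyp.n G) ^ℚ k)) where

  b : ℕ
  b = Hyp.n G

  β : ℚ
  β = ι b

  γ : ∀ {n} → Vec (Fin b) n → Subset n → Bool
  γ y e = Hyp.E G (image y e)

  γ-agree : ∀ {n} {S e : Subset n} {x y : Vec (Fin b) n} → e ⊆ S → agree S x y ≡ true → γ x e ≡ γ y e
  γ-agree {e = e} e⊆S h = cong (Hyp.E G) (image-agree e (agree-⊆ {S = e} e⊆S h))

  -- Whether `e` is mapped to an edge depends only on the values on `e`, so the count for a single
  -- edge is multiplied by the number of extensions.
  ∑-edge : ∀ {n} (e : Subset n) → card e ≡ k → ∑ (allMaps n b) (λ y → ⟦ γ y e ⟧) ≡ (β ^ℚ n) *ℚ d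
  ∑-edge {n} e refl = *-cancelˡ-≡ (^ℚ-pos (card e) 0<β) (begin
    (β ^ℚ card e) *ℚ ∑ (allMaps n b) (λ y → ⟦ γ y e ⟧)
      ≡⟨ cong ((β ^ℚ card e) *ℚ_) (∑-cong (allMaps n b) (λ {y} _ → cong (⟦_⟧ ∘ Hyp.E G) (image-select e y))) ⟨
    (β ^ℚ card e) *ℚ ∑ (allMaps n b) (λ y → ⟦ γ (select e y) fullˢ ⟧)
      ≡⟨ ∑-select e (λ z → ⟦ γ z fullˢ ⟧) ⟩
    (β ^ℚ n) *ℚ ∑ (allMaps (card e) b) (λ z → ⟦ γ z fullˢ ⟧)
      ≡⟨ cong ((β ^ℚ n) *ℚ_) d-density ⟩
    (β ^ℚ n) *ℚ (d *ℚ (β ^ℚ card e))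
      ≡⟨ shuffle (β ^ℚ n) d (β ^ℚ card e) ⟩
    (β ^ℚ card e) *ℚ ((β ^ℚ n) *ℚ d) ∎)
    where
    open ≡-Reasoning
    shuffle : ∀ p q r → p *ℚ (q *ℚ r) ≡ r *ℚ (p *ℚ q)
    shuffle = solve-∀ ringℚ

  -- The first edge depends on the coordinates in `e`, the others on its complement, so the count
  -- factors exactly. Here the condition on X enters the probabilistic half.
  ∑-disjoint : ∀ {n} (es : List (Subset n)) → Unique es → Disjoint es → (∀ {e} → e ∈ es → card e ≡ k) →
    ∑ (allMaps n b) (λ y → ∏ es (λ e → ⟦ γ y e ⟧)) ≡ (β ^ℚ n) *ℚ (d ^ℚ length es)
  ∑-disjoint {n} []       _ _ _ = ∑-allMaps-const n b 1ℚ
  ∑-disjoint {n} (e ∷ es) (e∉ ∷ u) disj size = *-cancelˡ-≡ (^ℚ-pos n 0<β) (begin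
    (β ^ℚ n) *ℚ ∑ (allMaps n b) (λ y → ⟦ γ y e ⟧ *ℚ ∏ es (λ f → ⟦ γ y f ⟧))
      ≡⟨ ∑-independent e (fullˢ ∖ˢ e) (λ y → ⟦ γ y e ⟧) (λ y → ∏ es (λ f → ⟦ γ y f ⟧)) (∩-∖ e fullˢ)
           (λ h → cong ⟦_⟧ (γ-agree {e = e} (⊆-refl e) h)) (λ h → ∏-local es outside h) ⟩
    ∑ (allMaps n b) (λ y → ⟦ γ y e ⟧) *ℚ ∑ (allMaps n b) (λ y → ∏ es (λ f → ⟦ γ y f ⟧))
      ≡⟨ cong₂ _*ℚ_ (∑-edge e (size (here refl)))
           (∑-disjoint es u (λ p q → disj (there p) (there q)) (λ p → size (there p))) ⟩
    ((β ^ℚ n) *ℚ d) *ℚ ((β ^ℚ n) *ℚ (d ^ℚ length es))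
      ≡⟨ shuffle (β ^ℚ n) d (d ^ℚ length es) ⟩
    (β ^ℚ n) *ℚ ((β ^ℚ n) *ℚ (d *ℚ (d ^ℚ length es))) ∎)
    where
    open ≡-Reasoning
    shuffle : ∀ p q r → (p *ℚ q) *ℚ (p *ℚ r) ≡ p *ℚ (p *ℚ (q *ℚ r))
    shuffle = solve-∀ ringℚ
    outside : ∀ {f} → f ∈ es → f ⊆ (fullˢ ∖ˢ e)
    outside {f} f∈ = case disj (here refl) (there f∈) of λ where
      (inj₁ e≡f) → ⊥-elim (All.lookup e∉ f∈ e≡f)
      (inj₂ ∅)   → ⊆-∖ {S = f} {e} (⊆-full f) ∅
    ∏-local : ∀ fs → (∀ {f} → f ∈ fs → f ⊆ (fullˢ ∖ˢ e)) → ∀ {x y} → agree (fullˢ ∖ˢ e) x y ≡ true →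
      ∏ fs (λ f → ⟦ γ x f ⟧) ≡ ∏ fs (λ f → ⟦ γ y f ⟧)
    ∏-local []       out h = refl
    ∏-local (f ∷ fs) out h =
      cong₂ _*ℚ_ (cong ⟦_⟧ (γ-agree {e = f} (out (here refl)) h)) (∏-local fs (out ∘ there) h)

  -- A finite probability space with a random homomorphism x from the frame of M to G.
  record Model (M : BHyp) : Set₁ where
    field
      Point   : Set
      Ω       : List Point
      w       : Point → ℚ
      w-pos   : ∀ {a} → a ∈ Ω → 0ℚ < w a
      w-total : ∑ Ω w ≡ 1ℚ
      x       : Point → Vec (Fin b) (BHyp.n M)
      x-hom   : ∀ {a} → a ∈ Ω → ∀ {e} → BHyp.E M e ≡ true → card e ≡ k → γ (x a) e ≡ true

    𝔼 : (Point → ℚ) → ℚ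
    𝔼 f = ∑ Ω (λ a → w a *ℚ f a)

    -- The law of the restriction of `x` to `K`, evaluated at the sample itself: the probability
    -- that an independent sample agrees with `a` on `K`. As a random variable it has a reciprocal
    -- that can be averaged.
    μ : Subset (BHyp.n M) → Point → ℚ
    μ K a = 𝔼 (λ c → ⟦ agree K (x a) (x c) ⟧)

    𝔼-cong : ∀ {f g} → (∀ {a} → a ∈ Ω → f a ≡ g a) → 𝔼 f ≡ 𝔼 g
    𝔼-cong h = ∑-cong Ω (λ {a} a∈ → cong (w a *ℚ_) (h a∈))

    𝔼-mono : ∀ {f g} → (∀ {a} → a ∈ Ω → f a ≤ g a) → 𝔼 f ≤ 𝔼 g
    𝔼-mono h = ∑-mono Ω (λ a∈ → *-monoˡ-≤ (ℚ.<⇒≤ (w-pos a∈)) (h a∈))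

    𝔼-const : ∀ c → 𝔼 (λ _ → c) ≡ c
    𝔼-const c = trans (∑-*ʳ Ω c w) (trans (cong (_*ℚ c) w-total) (ℚ.*-identityˡ c))

    𝔼-+ : ∀ f g → 𝔼 (λ a → f a +ℚ g a) ≡ 𝔼 f +ℚ 𝔼 g
    𝔼-+ f g = trans (∑-cong Ω (λ {a} _ → ℚ.*-distribˡ-+ (w a) (f a) (g a))) (∑-+ Ω _ _)

    𝔼-*ˡ : ∀ c f → 𝔼 (λ a → c *ℚ f a) ≡ c *ℚ 𝔼 f
    𝔼-*ˡ c f = trans (∑-cong Ω (λ {a} _ → shuffle (w a) c (f a))) (∑-*ˡ Ω c _)
      where
      shuffle : ∀ p q r → p *ℚ (q *ℚ r) ≡ q *ℚ (p *ℚ r)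
      shuffle = solve-∀ ringℚ

    𝔼-∑ : ∀ {C : Set} (cs : List C) (f : C → Point → ℚ) → 𝔼 (λ a → ∑ cs (λ c → f c a)) ≡ ∑ cs (λ c → 𝔼 (f c))
    𝔼-∑ cs f = trans (∑-cong Ω (λ {a} _ → sym (∑-*ˡ cs (w a) (λ c → f c a)))) (∑-swap Ω cs (λ a c → w a *ℚ f c a))

    -- A sample agrees with itself, so μ is at least the weight of its own point; hence `inv` is a
    -- genuine inverse on `Ω`.
    μ-pos : ∀ K {a} → a ∈ Ω → 0ℚ < μ K a
    μ-pos K {a} a∈ = ℚ.<-≤-trans
      (subst (0ℚ <_) (sym (trans (cong (λ t → w a *ℚ ⟦ t ⟧) (agree-refl K (x a))) (ℚ.*-identityʳ (w a)))) (w-pos a∈))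
      (term≤∑ Ω (λ {c} c∈ → *-nonNeg (ℚ.<⇒≤ (w-pos c∈)) (⟦⟧-nonNeg (agree K (x a) (x c)))) a∈)

    μ-agree : ∀ K {a c} → agree K (x a) (x c) ≡ true → μ K a ≡ μ K c
    μ-agree K {a} {c} h = 𝔼-cong (λ {a′} _ → cong ⟦_⟧ (agree-cong K h (agree-refl K (x a′))))

    homsOn : Subset (BHyp.n M) → ℚ
    homsOn K = ∑ (allMaps (BHyp.n M) b) (λ y → ∏ (edgesIn k M K) (λ e → ⟦ γ y e ⟧))

    -- 𝔼 (1 / μ_K) is the number of maps K → V(G) of positive probability, and each
    -- of them has n^(|V| − |K|) extensions to V.
    𝔼-inv-μ : ∀ K → (β ^ℚ BHyp.n M) *ℚ 𝔼 (inv ∘ μ K) ≤ (β ^ℚ card K) *ℚ homsOn K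
    𝔼-inv-μ K = begin
      (β ^ℚ V) *ℚ 𝔼 (inv ∘ μ K)                          ≡⟨ 𝔼-*ˡ (β ^ℚ V) (inv ∘ μ K) ⟨
      𝔼 (λ a → (β ^ℚ V) *ℚ inv (μ K a))
        -- The power of β is expressed through the maps `y` agreeing with the sample, so that the
        -- sums can be exchanged and each `y` treated alone.
        ≡⟨ 𝔼-cong (λ {a} _ → cong (_*ℚ inv (μ K a)) (sym (∑-agree K (x a)))) ⟩
      𝔼 (λ a → ((β ^ℚ card K) *ℚ ∑ Y (λ y → ⟦ agree K y (x a) ⟧)) *ℚ inv (μ K a))
        ≡⟨ 𝔼-cong (λ {a} _ → trans (ℚ.*-assoc (β ^ℚ card K) _ _) (cong ((β ^ℚ card K) *ℚ_) (sym (∑-*ʳ Y (inv (μ K a)) _)))) ⟩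
      𝔼 (λ a → (β ^ℚ card K) *ℚ ∑ Y (λ y → ⟦ agree K y (x a) ⟧ *ℚ inv (μ K a)))
        ≡⟨ 𝔼-*ˡ (β ^ℚ card K) _ ⟩
      (β ^ℚ card K) *ℚ 𝔼 (λ a → ∑ Y (λ y → ⟦ agree K y (x a) ⟧ *ℚ inv (μ K a)))
        ≡⟨ cong ((β ^ℚ card K) *ℚ_) (𝔼-∑ Y (λ y a → ⟦ agree K y (x a) ⟧ *ℚ inv (μ K a))) ⟩
      (β ^ℚ card K) *ℚ ∑ Y (λ y → 𝔼 (λ a → ⟦ agree K y (x a) ⟧ *ℚ inv (μ K a)))
        ≤⟨ *-monoˡ-≤ (ℚ.<⇒≤ (^ℚ-pos (card K) 0<β)) (∑-mono Y (λ {y} _ → mass y)) ⟩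
      (β ^ℚ card K) *ℚ homsOn K                           ∎
      where
      open ℚ.≤-Reasoning
      V = BHyp.n M
      Y = allMaps V b
      mass : ∀ y → 𝔼 (λ a → ⟦ agree K y (x a) ⟧ *ℚ inv (μ K a)) ≤ ∏ (edgesIn k M K) (λ e → ⟦ γ y e ⟧)
      mass y with ∏-indicator (edgesIn k M K) (γ y)
      -- On the event μ is constantly `P`, so the expectation is `P *ℚ inv P`. It is 1, or 0 when no
      -- sample agrees with `y` on `K`.
      ... | inj₁ (∏≡1 , _) = begin
        𝔼 (λ a → ⟦ agree K y (x a) ⟧ *ℚ inv (μ K a))
          ≡⟨ 𝔼-cong (λ {a} _ → ⟦⟧-cong-* (agree K y (x a)) (λ h → cong inv (sym (at-y h)))) ⟩
        𝔼 (λ a → ⟦ agree K y (x a) ⟧ *ℚ inv P)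
          ≡⟨ 𝔼-cong (λ {a} _ → ℚ.*-comm ⟦ agree K y (x a) ⟧ (inv P)) ⟩
        𝔼 (λ a → inv P *ℚ ⟦ agree K y (x a) ⟧)           ≡⟨ 𝔼-*ˡ (inv P) _ ⟩
        inv P *ℚ P                                         ≡⟨ ℚ.*-comm (inv P) P ⟩
        P *ℚ inv P                                         ≤⟨ *-inv≤1 P ⟩
        1ℚ                                                 ≡⟨ ∏≡1 ⟨
        ∏ (edgesIn k M K) (λ e → ⟦ γ y e ⟧)               ∎
        where
        P = 𝔼 (λ c → ⟦ agree K y (x c) ⟧)
        at-y : ∀ {a} → agree K y (x a) ≡ true → P ≡ μ K a
        at-y h = 𝔼-cong (λ {c} _ → cong ⟦_⟧ (agree-cong K h (agree-refl K (x c))))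
      -- A map breaking an edge inside `K` agrees with no sample on `K`, since samples are
      -- homomorphisms.
      ... | inj₂ (∏≡0 , e , e∈ , ¬γ) = ℚ.≤-reflexive (trans
        (𝔼-cong (λ {a} a∈ → trans (cong (λ t → ⟦ t ⟧ *ℚ inv (μ K a)) (disagree a∈)) (ℚ.*-zeroˡ (inv (μ K a)))))
        (trans (𝔼-const 0ℚ) (sym ∏≡0)))
        where
        disagree : ∀ {a} → a ∈ Ω → agree K y (x a) ≡ false
        disagree {a} a∈ with agree K y (x a) in h
        ... | false = refl
        ... | true  = let p , c , e⊆K = ∈-edgesIn⁻ M K e∈ in
          trans (sym (x-hom a∈ p c)) (trans (sym (γ-agree {e = e} e⊆K h)) ¬γ)

    -- The lower bound that Sidorenko's inequality predicts for the number of homomorphisms on `K`.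
    scale : Subset (BHyp.n M) → ℚ
    scale K = (β ^ℚ card K) *ℚ (d ^ℚ length (edgesIn k M K))

    scale-pos : ∀ K → 0ℚ < scale K
    scale-pos K = *-pos (^ℚ-pos (card K) 0<β) (^ℚ-pos (length (edgesIn k M K)) 0<d)

    -- The product formula as an invariant. The bound 𝔼 h ≤ 1 depends only on the law of `h`, so it
    -- survives a coupling whatever dependence arises between factors.
    record Factored (K : Subset (BHyp.n M)) : Set where
      field
        hs     : List (Point → ℚ)
        hs-pos : All (λ h → ∀ a → a ∈ Ω → 0ℚ < h a) hs
        hs-𝔼   : All (λ h → 𝔼 h ≤ 1ℚ) hs
        factor : ∀ {a} → a ∈ Ω → scale K *ℚ μ K a ≡ ∏ hs (λ h → h a)

    -- The factors average in total to at most their number, so AM-GM leaves at least 1 for the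
    -- expectation of `R`, the reciprocal of the scaled marginal.
    scale≤𝔼-inv-μ : ∀ {K} → Factored K → scale K ≤ 𝔼 (inv ∘ μ K)
    scale≤𝔼-inv-μ {K} F = subst₂ _≤_ (ℚ.*-identityʳ (scale K)) cancel-scale
      (*-monoˡ-≤ (ℚ.<⇒≤ (scale-pos K)) 1≤𝔼R)
      where
      open Factored F
      open ℚ.≤-Reasoning
      R : Point → ℚ
      R a = inv (scale K) *ℚ inv (μ K a)

      R-pos : ∀ {a} → a ∈ Ω → 0ℚ < R a
      R-pos a∈ = *-pos (inv-pos (scale-pos K)) (inv-pos (μ-pos K a∈))

      R-scale : ∀ {a} → a ∈ Ω → R a *ℚ (scale K *ℚ μ K a) ≡ 1ℚ
      R-scale {a} a∈ = trans (shuffle (inv (scale K)) (inv (μ K a)) (scale K) (μ K a))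
        (cong₂ _*ℚ_ (inv-inverseˡ (scale-pos K)) (inv-inverseˡ (μ-pos K a∈)))
        where
        shuffle : ∀ i j s m → (i *ℚ j) *ℚ (s *ℚ m) ≡ (i *ℚ s) *ℚ (j *ℚ m)
        shuffle = solve-∀ ringℚ

      pointwise : ∀ {a} → a ∈ Ω → 1ℚ +ℚ ι (length hs) ≤ R a +ℚ ∑ hs (λ h → h a)
      pointwise {a} a∈ = subst₂ (λ l s → 1ℚ +ℚ ι l ≤ R a +ℚ s)
        (List.length-map (λ h → h a) hs) (∑-map (λ h → h a) hs id)
        (AM-GM.product-one⇒length≤sum (R a) (map (λ h → h a) hs) (R-pos a∈)
          (All.map⁺ (All.map (λ 0<h → 0<h a a∈) hs-pos))
          (trans (cong (R a *ℚ_) (trans (∏-map (λ h → h a) hs id) (sym (factor a∈)))) (R-scale a∈)))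

      ∑𝔼≤ : ∀ {gs : List (Point → ℚ)} → All (λ h → 𝔼 h ≤ 1ℚ) gs → ∑ gs 𝔼 ≤ ι (length gs)
      ∑𝔼≤ []       = ℚ.≤-refl
      ∑𝔼≤ (p ∷ ps) = ℚ.+-mono-≤ p (∑𝔼≤ ps)

      mean : 1ℚ +ℚ ι (length hs) ≤ 𝔼 R +ℚ ι (length hs)
      mean = begin
        1ℚ +ℚ ι (length hs)                      ≡⟨ 𝔼-const _ ⟨
        𝔼 (λ _ → 1ℚ +ℚ ι (length hs))           ≤⟨ 𝔼-mono pointwise ⟩
        𝔼 (λ a → R a +ℚ ∑ hs (λ h → h a))       ≡⟨ 𝔼-+ R (λ a → ∑ hs (λ h → h a)) ⟩
        𝔼 R +ℚ 𝔼 (λ a → ∑ hs (λ h → h a))       ≡⟨ cong (𝔼 R +ℚ_) (𝔼-∑ hs (λ h → h)) ⟩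
        𝔼 R +ℚ ∑ hs 𝔼                           ≤⟨ ℚ.+-monoʳ-≤ (𝔼 R) (∑𝔼≤ hs-𝔼) ⟩
        𝔼 R +ℚ ι (length hs)                     ∎

      1≤𝔼R : 1ℚ ≤ 𝔼 R
      1≤𝔼R = subst₂ _≤_ (plus-minus 1ℚ (ι (length hs))) (plus-minus (𝔼 R) (ι (length hs)))
        (ℚ.+-monoˡ-≤ (- ι (length hs)) mean)
        where
        plus-minus : ∀ p q → (p +ℚ q) +ℚ - q ≡ p
        plus-minus = solve-∀ ringℚ

      cancel-scale : scale K *ℚ 𝔼 R ≡ 𝔼 (inv ∘ μ K)
      cancel-scale = trans (cong (scale K *ℚ_) (𝔼-*ˡ (inv (scale K)) (inv ∘ μ K)))
        (trans (sym (ℚ.*-assoc (scale K) (inv (scale K)) _))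
        (trans (cong (_*ℚ 𝔼 (inv ∘ μ K)) (trans (ℚ.*-comm (scale K) _) (inv-inverseˡ (scale-pos K)))) (ℚ.*-identityˡ _)))

  -- One model serves all edges at once, because the next coupling combines the factorisations of
  -- two different edges.
  record EdgeFactored (M : BHyp) : Set₁ where
    field
      model    : Model M
      factored : ∀ {K} → BHyp.E M K ≡ true → Model.Factored model K

  module Base where

    private
      Nₑ : ℚ
      Nₑ = ∑ (allMaps k b) (λ z → ⟦ γ z fullˢ ⟧)

      0<Nₑ : 0ℚ < Nₑ
      0<Nₑ = subst (0ℚ <_) (sym d-density) (*-pos 0<d (^ℚ-pos k 0<β))

      -- Only maps onto edges of `G` are kept, so that samples are homomorphisms.
      Ω₀ : List (Vec (Fin b) k)
      Ω₀ = filter (λ z → γ z fullˢ Bool.≟ true) (allMaps k b)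

    base-model : Model (trivial k)
    base-model = record
      { Point   = Vec (Fin b) k
      ; Ω       = Ω₀
      ; w       = λ _ → inv Nₑ
      ; w-pos   = λ _ → inv-pos 0<Nₑ
      ; w-total = trans (∑-filter (λ z → γ z fullˢ) (allMaps k b) (λ _ → inv Nₑ))
          (trans (∑-*ʳ (allMaps k b) (inv Nₑ) (λ z → ⟦ γ z fullˢ ⟧)) (trans (ℚ.*-comm Nₑ (inv Nₑ)) (inv-inverseˡ 0<Nₑ)))
      ; x       = id
      ; x-hom   = λ {z} z∈ {e} p _ → subst (λ S → γ z S ≡ true) (sym (=ˢ⇒≡ e fullˢ p))
          (proj₂ (∈-filter⁻ (λ z → γ z fullˢ Bool.≟ true) {xs = allMaps k b} z∈))
      }

    open Model base-model

    μ-full : ∀ {z} → z ∈ Ω₀ → μ fullˢ z ≡ inv Nₑ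
    μ-full {z} z∈ = begin
      ∑ Ω₀ (λ c → inv Nₑ *ℚ ⟦ agree fullˢ z c ⟧)
        ≡⟨ ∑-*ˡ Ω₀ (inv Nₑ) _ ⟩
      inv Nₑ *ℚ ∑ Ω₀ (λ c → ⟦ agree fullˢ z c ⟧)
        ≡⟨ cong (inv Nₑ *ℚ_) (∑-filter (λ c → γ c fullˢ) (allMaps k b) _) ⟩
      inv Nₑ *ℚ ∑ (allMaps k b) (λ c → ⟦ γ c fullˢ ⟧ *ℚ ⟦ agree fullˢ z c ⟧)
        ≡⟨ cong (inv Nₑ *ℚ_) (∑-cong (allMaps k b) (λ {c} _ → only-z c)) ⟩
      inv Nₑ *ℚ ∑ (allMaps k b) (λ c → ⟦ agree fullˢ c z ⟧)
        ≡⟨ cong (inv Nₑ *ℚ_) one ⟩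
      inv Nₑ *ℚ 1ℚ
        ≡⟨ ℚ.*-identityʳ (inv Nₑ) ⟩
      inv Nₑ ∎
      where
      open ≡-Reasoning
      only-z : ∀ c → ⟦ γ c fullˢ ⟧ *ℚ ⟦ agree fullˢ z c ⟧ ≡ ⟦ agree fullˢ c z ⟧
      only-z c = trans (ℚ.*-comm ⟦ γ c fullˢ ⟧ _)
        (trans (⟦⟧-cong-* (agree fullˢ z c) {y = 1ℚ} (λ h → cong ⟦_⟧ (subst (λ v → γ v fullˢ ≡ true) (agree-full⇒≡ {x = z} {c} h)
                 (proj₂ (∈-filter⁻ (λ z → γ z fullˢ Bool.≟ true) {xs = allMaps k b} z∈)))))
        (trans (ℚ.*-identityʳ _) (cong ⟦_⟧ (agree-swap fullˢ z c))))
      one : ∑ (allMaps k b) (λ c → ⟦ agree fullˢ c z ⟧) ≡ 1ℚ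
      one = *-cancelˡ-≡ (^ℚ-pos k 0<β) (trans
        (subst (λ j → (β ^ℚ j) *ℚ ∑ (allMaps k b) (λ c → ⟦ agree fullˢ c z ⟧) ≡ β ^ℚ k) (card-full k) (∑-agree fullˢ z))
        (sym (ℚ.*-identityʳ _)))

    base-factored : EdgeFactored (trivial k)
    base-factored = record { model = base-model ; factored = λ {K} p → fact (=ˢ⇒≡ K fullˢ p) }
      where
      open ≡-Reasoning
      fact : ∀ {K} → K ≡ fullˢ → Factored K
      fact refl = record
        -- The law is uniform on `Nₑ` maps and the scale is `Nₑ`, so the product is 1 and has no
        -- factors.
        { hs = [] ; hs-pos = [] ; hs-𝔼 = []
        ; factor = λ {z} z∈ → begin
            ((β ^ℚ card (fullˢ {k})) *ℚ (d ^ℚ length (edgesIn k (trivial k) fullˢ))) *ℚ μ fullˢ z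
              ≡⟨ cong₂ _*ℚ_ (cong₂ (λ i j → (β ^ℚ i) *ℚ (d ^ℚ j)) (card-full k) (Perm.↭-length (trivial-edgesIn k))) (μ-full z∈) ⟩
            ((β ^ℚ k) *ℚ (d *ℚ 1ℚ)) *ℚ inv Nₑ
              ≡⟨ shuffle (β ^ℚ k) d (inv Nₑ) ⟩
            inv Nₑ *ℚ (d *ℚ (β ^ℚ k))
              ≡⟨ cong (inv Nₑ *ℚ_) d-density ⟨
            inv Nₑ *ℚ Nₑ
              ≡⟨ inv-inverseˡ 0<Nₑ ⟩
            1ℚ ∎
        }
        where
        shuffle : ∀ p q r → (p *ℚ (q *ℚ 1ℚ)) *ℚ r ≡ r *ℚ (q *ℚ p)
        shuffle = solve-∀ ringℚ

  -- Coupling two copies of the model along X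

  module Couple {M : BHyp} (wf : Wellformed k M) (L X : Subset (BHyp.n M))
                (L∈E : BHyp.E M L ≡ true) (X⊆L : X ⊆ L) (X-disjoint : Disjoint (edgesIn k M X))
                (ef : EdgeFactored M) where
    open Step wf L X L∈E X⊆L
    open EdgeFactored ef
    open Model model

    private
      Pair : Set
      Pair = Point × Point

      agreeX : Pair → Bool
      agreeX (a , a′) = agree X (x a) (x a′)

      Ω′ : List Pair
      Ω′ = filter (λ p → agreeX p Bool.≟ true) (cartesianProduct Ω Ω)

      -- Conditional independence given the common restriction to `X`; on `Ω′` both points have the
      -- same μ_X, so dividing by that of the first is symmetric.
      w′ : Pair → ℚ
      w′ (a , a′) = (w a *ℚ w a′) *ℚ inv (μ X a)

      -- The second sample fills only the new vertices; agreement on `X` makes the result a copy of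
      -- `x a′` on all of `L`.
      x′ : Pair → Vec (Fin b) n'
      x′ (a , a′) = x a ++ select D (x a′)

      ∈-Ω′⁻ : ∀ {a a′} → (a , a′) ∈ Ω′ → a ∈ Ω × a′ ∈ Ω × agree X (x a) (x a′) ≡ true
      ∈-Ω′⁻ p∈ =
        let q , h = ∈-filter⁻ (λ p → agreeX p Bool.≟ true) {xs = cartesianProduct Ω Ω} p∈
            a∈ , a′∈ = ∈-cartesianProduct⁻ Ω Ω q
        in a∈ , a′∈ , h

      𝔼′ : (Pair → ℚ) → ℚ
      𝔼′ f = ∑ Ω′ (λ p → w′ p *ℚ f p)

      𝔼′-expand : ∀ f → 𝔼′ f ≡
        ∑ Ω (λ a → ∑ Ω (λ a′ → ⟦ agree X (x a) (x a′) ⟧ *ℚ (w′ (a , a′) *ℚ f (a , a′))))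
      𝔼′-expand f = trans (∑-filter agreeX (cartesianProduct Ω Ω) (λ p → w′ p *ℚ f p))
        (∑-cartesianProduct Ω Ω (λ p → ⟦ agreeX p ⟧ *ℚ (w′ p *ℚ f p)))

    -- Summing out the second sample yields μ_X, which the weight divides by. The marginals carry
    -- the bounds 𝔼 h ≤ 1 to the coupled space.
    marginal₁ : ∀ f → 𝔼′ (f ∘ proj₁) ≡ 𝔼 f
    marginal₁ f = trans (𝔼′-expand (f ∘ proj₁)) (∑-cong Ω λ {a} a∈ → begin
      ∑ Ω (λ a′ → ⟦ agree X (x a) (x a′) ⟧ *ℚ (((w a *ℚ w a′) *ℚ inv (μ X a)) *ℚ f a))
        ≡⟨ ∑-cong Ω (λ {a′} _ → shuffle ⟦ agree X (x a) (x a′) ⟧ (w a) (w a′) (inv (μ X a)) (f a)) ⟩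
      ∑ Ω (λ a′ → ((w a *ℚ f a) *ℚ inv (μ X a)) *ℚ (w a′ *ℚ ⟦ agree X (x a) (x a′) ⟧))
        ≡⟨ ∑-*ˡ Ω ((w a *ℚ f a) *ℚ inv (μ X a)) _ ⟩
      ((w a *ℚ f a) *ℚ inv (μ X a)) *ℚ μ X a
        ≡⟨ ℚ.*-assoc (w a *ℚ f a) (inv (μ X a)) (μ X a) ⟩
      (w a *ℚ f a) *ℚ (inv (μ X a) *ℚ μ X a)
        ≡⟨ cong ((w a *ℚ f a) *ℚ_) (inv-inverseˡ (μ-pos X a∈)) ⟩
      (w a *ℚ f a) *ℚ 1ℚ
        ≡⟨ ℚ.*-identityʳ (w a *ℚ f a) ⟩
      w a *ℚ f a ∎)
      where
      open ≡-Reasoning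
      shuffle : ∀ t p q i r → t *ℚ (((p *ℚ q) *ℚ i) *ℚ r) ≡ ((p *ℚ r) *ℚ i) *ℚ (q *ℚ t)
      shuffle = solve-∀ ringℚ

    marginal₂ : ∀ f → 𝔼′ (f ∘ proj₂) ≡ 𝔼 f
    marginal₂ f = trans (𝔼′-expand (f ∘ proj₂)) (trans (∑-swap Ω Ω _) (∑-cong Ω λ {a′} a′∈ → begin
      ∑ Ω (λ a → ⟦ agree X (x a) (x a′) ⟧ *ℚ (((w a *ℚ w a′) *ℚ inv (μ X a)) *ℚ f a′))
        -- On agreement μ_X is the same at both points, so the two roles become symmetric.
        ≡⟨ ∑-cong Ω (λ {a} _ → ⟦⟧-cong-* (agree X (x a) (x a′))
             (λ h → cong (λ m → ((w a *ℚ w a′) *ℚ inv m) *ℚ f a′) (μ-agree X {a} {a′} h))) ⟩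
      ∑ Ω (λ a → ⟦ agree X (x a) (x a′) ⟧ *ℚ (((w a *ℚ w a′) *ℚ inv (μ X a′)) *ℚ f a′))
        ≡⟨ ∑-cong Ω (λ {a} _ → trans (cong (λ t → ⟦ t ⟧ *ℚ (((w a *ℚ w a′) *ℚ inv (μ X a′)) *ℚ f a′)) (agree-swap X (x a) (x a′)))
             (shuffle ⟦ agree X (x a′) (x a) ⟧ (w a) (w a′) (inv (μ X a′)) (f a′))) ⟩
      ∑ Ω (λ a → ((w a′ *ℚ f a′) *ℚ inv (μ X a′)) *ℚ (w a *ℚ ⟦ agree X (x a′) (x a) ⟧))
        ≡⟨ ∑-*ˡ Ω ((w a′ *ℚ f a′) *ℚ inv (μ X a′)) _ ⟩
      ((w a′ *ℚ f a′) *ℚ inv (μ X a′)) *ℚ μ X a′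
        ≡⟨ ℚ.*-assoc (w a′ *ℚ f a′) (inv (μ X a′)) (μ X a′) ⟩
      (w a′ *ℚ f a′) *ℚ (inv (μ X a′) *ℚ μ X a′)
        ≡⟨ cong ((w a′ *ℚ f a′) *ℚ_) (inv-inverseˡ (μ-pos X a′∈)) ⟩
      (w a′ *ℚ f a′) *ℚ 1ℚ
        ≡⟨ ℚ.*-identityʳ (w a′ *ℚ f a′) ⟩
      w a′ *ℚ f a′ ∎))
      where
      open ≡-Reasoning
      shuffle : ∀ t p q i r → t *ℚ (((p *ℚ q) *ℚ i) *ℚ r) ≡ ((q *ℚ r) *ℚ i) *ℚ (p *ℚ t)
      shuffle = solve-∀ ringℚ

    γ-left : ∀ (y : Vec (Fin b) N) z e → γ (y ++ z) (τ₁ e) ≡ γ y e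
    γ-left y z e = cong (Hyp.E G) (begin
      image (y ++ z) (τ₁ e)             ≡⟨ image≡hit (y ++ z) (τ₁ e) ⟩
      tabulate (hit (y ++ z) (τ₁ e))    ≡⟨ Vec.tabulate-cong (λ v → trans (hit-++ y z e emptyˢ v)
                                             (trans (cong (hit y e v ∨_) (hit-∅ z v)) (Bool.∨-identityʳ _))) ⟩
      tabulate (hit y e)                ≡⟨ image≡hit y e ⟨
      image y e                         ∎)
      where open ≡-Reasoning

    -- The `X` part of `τ₂ e` is read from `y` and the rest from `z`; agreement on `X` makes both
    -- parts values of `z`.
    γ-right : ∀ (y z : Vec (Fin b) N) {e} → e ⊆ L → agree X y z ≡ true → γ (y ++ select D z) (τ₂ e) ≡ γ z e
    γ-right y z {e} e⊆L h = cong (Hyp.E G) (begin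
      image (y ++ select D z) (τ₂ e)            ≡⟨ image≡hit (y ++ select D z) (τ₂ e) ⟩
      tabulate (hit (y ++ select D z) (τ₂ e))   ≡⟨ Vec.tabulate-cong (λ v → trans (hit-++ y (select D z) (e ∩ˢ X) (restrict D e) v)
          (trans (cong₂ _∨_ (hit-agree (e ∩ˢ X) v (agree-⊆ {S = e ∩ˢ X} (∩-⊆ʳ e X) h)) (hit-select D z e v))
                 (hit-split z {e} {L} X v e⊆L))) ⟩
      tabulate (hit z e)                        ≡⟨ image≡hit z e ⟨
      image z e                                 ∎)
      where open ≡-Reasoning

    couple : Model M′
    couple = record
      { Point   = Pair
      ; Ω       = Ω′
      ; w       = w′
      ; w-pos   = λ p∈ → let a∈ , a′∈ , _ = ∈-Ω′⁻ p∈ in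
          *-pos (*-pos (w-pos a∈) (w-pos a′∈)) (inv-pos (μ-pos X a∈))
      ; w-total = trans (∑-cong Ω′ (λ {p} _ → sym (ℚ.*-identityʳ (w′ p))))
          (trans (marginal₁ (λ _ → 1ℚ)) (𝔼-const 1ℚ))
      ; x       = x′
      ; x-hom   = λ p∈ q c → respects p∈ (frameView q c)
      }
      where
      respects : ∀ {p e} → p ∈ Ω′ → FrameView e → γ (x′ p) e ≡ true
      respects {a , a′} p∈ (left {e} e∈E c) = trans (γ-left (x a) _ e) (x-hom (proj₁ (∈-Ω′⁻ p∈)) e∈E c)
      respects {a , a′} p∈ (right {e} e∈E c e⊆L) = let _ , a′∈ , h = ∈-Ω′⁻ p∈ in
        trans (γ-right (x a) (x a′) {e} e⊆L h) (x-hom a′∈ e∈E c)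

    private
      module M′ = Model couple

    agree-left : ∀ K (y z : Vec (Fin b) N) {u v} → agree (τ₁ K) (y ++ u) (z ++ v) ≡ agree K y z
    agree-left K y z {u} {v} = trans (agree-++ K emptyˢ y z u v)
      (trans (cong (agree K y z ∧_) (agree-∅ u v)) (Bool.∧-identityʳ _))

    agree-right : ∀ {K} (y y′ z z′ : Vec (Fin b) N) → K ⊆ L → agree X y y′ ≡ true → agree X z z′ ≡ true →
      agree (τ₂ K) (y ++ select D y′) (z ++ select D z′) ≡ agree K y′ z′
    agree-right {K} y y′ z z′ K⊆L h h′ = trans (agree-++ (K ∩ˢ X) (restrict D K) y z _ _)
      (trans (cong₂ _∧_ (agree-cong (K ∩ˢ X) (weaken h) (weaken h′)) (agree-select D K y′ z′))
             (agree-split {S = K} {L} X y′ z′ K⊆L))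
      where
      weaken : ∀ {u v : Vec (Fin b) N} → agree X u v ≡ true → agree (K ∩ˢ X) u v ≡ true
      weaken = agree-⊆ {S = K ∩ˢ X} (∩-⊆ʳ K X)

    μ-left : ∀ K a a′ → M′.μ (τ₁ K) (a , a′) ≡ μ K a
    μ-left K a a′ = trans
      (M′.𝔼-cong {g = λ p → ⟦ agree K (x a) (x (proj₁ p)) ⟧} (λ { {c , c′} _ → cong ⟦_⟧ (agree-left K (x a) (x c)) }))
      (marginal₁ (λ c → ⟦ agree K (x a) (x c) ⟧))

    μ-right : ∀ {K} → K ⊆ L → ∀ {a a′} → (a , a′) ∈ Ω′ → M′.μ (τ₂ K) (a , a′) ≡ μ K a′
    μ-right {K} K⊆L {a} {a′} p∈ = trans
      (M′.𝔼-cong {g = λ p → ⟦ agree K (x a′) (x (proj₂ p)) ⟧} (λ { {c , c′} q∈ → cong ⟦_⟧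
        (agree-right {K} (x a) (x a′) (x c) (x c′) K⊆L (proj₂ (proj₂ (∈-Ω′⁻ p∈))) (proj₂ (proj₂ (∈-Ω′⁻ q∈)))) }))
      (marginal₂ (λ c → ⟦ agree K (x a′) (x c) ⟧))

    module CoupleUnion {K₁ K₂} (K₁∈E : BHyp.E M K₁ ≡ true) (K₂∈E : BHyp.E M K₂ ≡ true) (K₂⊆L : K₂ ⊆ L)
                       (X⊆ : X ⊆ (K₁ ∩ˢ K₂)) where
      open Union {K₁} {K₂} K₂⊆L X⊆

      U : Subset n'
      U = τ₁ K₁ ∪ˢ τ₂ K₂

      -- The glued map shows only the part of `K₂` outside `X` on the second side. Agreement on its
      -- `X` part follows from `K₁`, which contains `X`.
      agree-union : ∀ (y y′ z z′ : Vec (Fin b) N) → agree X y y′ ≡ true → agree X z z′ ≡ true →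
        agree U (y ++ select D y′) (z ++ select D z′) ≡ agree K₁ y z ∧ agree K₂ y′ z′
      agree-union y y′ z z′ h h′ = begin
        agree U (y ++ select D y′) (z ++ select D z′)
          ≡⟨ cong (λ S → agree S (y ++ select D y′) (z ++ select D z′)) union≡ ⟩
        agree (K₁ ++ restrict D K₂) (y ++ select D y′) (z ++ select D z′)
          ≡⟨ agree-++ K₁ (restrict D K₂) y z _ _ ⟩
        agree K₁ y z ∧ agree (restrict D K₂) (select D y′) (select D z′)
          ≡⟨ cong (agree K₁ y z ∧_) (agree-select D K₂ y′ z′) ⟩
        agree K₁ y z ∧ agree (K₂ ∩ˢ D) y′ z′
          ≡⟨ absorb ⟩
        agree K₁ y z ∧ agree K₂ y′ z′ ∎
        where
        open ≡-Reasoning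
        absorb : agree K₁ y z ∧ agree (K₂ ∩ˢ D) y′ z′ ≡ agree K₁ y z ∧ agree K₂ y′ z′
        absorb = bool-ext
          (λ t → let p , q = ∧-true⁻ t in ∧-true⁺ p (trans (sym (agree-split {S = K₂} {L} X y′ z′ K₂⊆L))
             (∧-true⁺ (agree-⊆ {S = K₂ ∩ˢ X} {X} (∩-⊆ʳ K₂ X) (trans (sym (agree-cong X h h′)) (agree-⊆ {S = X} {K₁} X⊆K₁ p))) q)))
          (λ t → let p , q = ∧-true⁻ t in ∧-true⁺ p (agree-⊆ {S = K₂ ∩ˢ D} {K₂} (∩-⊆ˡ K₂ D) q))

      μ-union : ∀ {a a′} → (a , a′) ∈ Ω′ → M′.μ U (a , a′) ≡ inv (μ X a) *ℚ (μ K₁ a *ℚ μ K₂ a′)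
      μ-union {a} {a′} p∈ = begin
        M′.μ U (a , a′)
          ≡⟨ M′.𝔼-cong {g = λ p → ⟦ both (proj₁ p) (proj₂ p) ⟧} (λ { {c , c′} q∈ → cong ⟦_⟧ (agree-union (x a) (x a′) (x c) (x c′) aX (proj₂ (proj₂ (∈-Ω′⁻ q∈)))) }) ⟩
        𝔼′ (λ (c , c′) → ⟦ both c c′ ⟧)
          ≡⟨ 𝔼′-expand (λ (c , c′) → ⟦ both c c′ ⟧) ⟩
        ∑ Ω (λ c → ∑ Ω (λ c′ → ⟦ agree X (x c) (x c′) ⟧ *ℚ (((w c *ℚ w c′) *ℚ inv (μ X c)) *ℚ ⟦ both c c′ ⟧)))
          ≡⟨ ∑-cong Ω (λ {c} _ → ∑-cong Ω (λ {c′} _ → decouple c c′)) ⟩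
        ∑ Ω (λ c → ∑ Ω (λ c′ → (inv (μ X a) *ℚ (w c *ℚ ⟦ k₁ c ⟧)) *ℚ (w c′ *ℚ ⟦ k₂ c′ ⟧)))
          ≡⟨ ∑-cong Ω (λ {c} _ → ∑-*ˡ Ω (inv (μ X a) *ℚ (w c *ℚ ⟦ k₁ c ⟧)) _) ⟩
        ∑ Ω (λ c → (inv (μ X a) *ℚ (w c *ℚ ⟦ k₁ c ⟧)) *ℚ μ K₂ a′)
          ≡⟨ ∑-*ʳ Ω (μ K₂ a′) _ ⟩
        ∑ Ω (λ c → inv (μ X a) *ℚ (w c *ℚ ⟦ k₁ c ⟧)) *ℚ μ K₂ a′
          ≡⟨ cong (_*ℚ μ K₂ a′) (∑-*ˡ Ω (inv (μ X a)) _) ⟩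
        (inv (μ X a) *ℚ μ K₁ a) *ℚ μ K₂ a′
          ≡⟨ ℚ.*-assoc (inv (μ X a)) (μ K₁ a) (μ K₂ a′) ⟩
        inv (μ X a) *ℚ (μ K₁ a *ℚ μ K₂ a′) ∎
        where
        open ≡-Reasoning
        aX = proj₂ (proj₂ (∈-Ω′⁻ p∈))
        k₁ k₂ : Point → Bool
        k₁ c = agree K₁ (x a) (x c)
        k₂ c = agree K₂ (x a′) (x c)
        both : Point → Point → Bool
        both c c′ = k₁ c ∧ k₂ c′
        -- If `c` agrees with `a` on `K₁` and `c′` with `a′` on `K₂`, then `c` and `c′` agree on `X`
        -- automatically, and μ_X is the same at `c` and `a`. The coupling constraint disappears and
        -- the double sum factors.
        decouple : ∀ c c′ →
          ⟦ agree X (x c) (x c′) ⟧ *ℚ (((w c *ℚ w c′) *ℚ inv (μ X c)) *ℚ ⟦ both c c′ ⟧) ≡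
          (inv (μ X a) *ℚ (w c *ℚ ⟦ k₁ c ⟧)) *ℚ (w c′ *ℚ ⟦ k₂ c′ ⟧)
        decouple c c′ = begin
          ⟦ agree X (x c) (x c′) ⟧ *ℚ (((w c *ℚ w c′) *ℚ inv (μ X c)) *ℚ ⟦ both c c′ ⟧)
            ≡⟨ front ⟦ agree X (x c) (x c′) ⟧ ((w c *ℚ w c′) *ℚ inv (μ X c)) ⟦ both c c′ ⟧ ⟩
          ⟦ both c c′ ⟧ *ℚ (⟦ agree X (x c) (x c′) ⟧ *ℚ ((w c *ℚ w c′) *ℚ inv (μ X c)))
            ≡⟨ ⟦⟧-cong-* (both c c′) (λ t → let p , q = ∧-true⁻ t ; ac = agree-⊆ {S = X} {K₁} X⊆K₁ p in
                 cong₂ (λ s m → ⟦ s ⟧ *ℚ ((w c *ℚ w c′) *ℚ inv m))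
                   (agree-trans X (agree-sym X ac) (agree-trans X aX (agree-⊆ {S = X} {K₂} X⊆K₂ q)))
                   (sym (μ-agree X {a} {c} ac))) ⟩
          ⟦ both c c′ ⟧ *ℚ (1ℚ *ℚ ((w c *ℚ w c′) *ℚ inv (μ X a)))
            ≡⟨ cong (_*ℚ (1ℚ *ℚ ((w c *ℚ w c′) *ℚ inv (μ X a)))) (⟦⟧-∧ (k₁ c) (k₂ c′)) ⟩
          (⟦ k₁ c ⟧ *ℚ ⟦ k₂ c′ ⟧) *ℚ (1ℚ *ℚ ((w c *ℚ w c′) *ℚ inv (μ X a)))
            ≡⟨ split ⟦ k₁ c ⟧ ⟦ k₂ c′ ⟧ (w c) (w c′) (inv (μ X a)) ⟩
          (inv (μ X a) *ℚ (w c *ℚ ⟦ k₁ c ⟧)) *ℚ (w c′ *ℚ ⟦ k₂ c′ ⟧) ∎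
          where
          front : ∀ p q r → p *ℚ (q *ℚ r) ≡ r *ℚ (p *ℚ q)
          front = solve-∀ ringℚ
          split : ∀ s t p q i → (s *ℚ t) *ℚ (1ℚ *ℚ ((p *ℚ q) *ℚ i)) ≡ (i *ℚ (p *ℚ s)) *ℚ (q *ℚ t)
          split = solve-∀ ringℚ

      scale-union : M′.scale U *ℚ scale X ≡ scale K₁ *ℚ scale K₂
      scale-union = begin
        M′.scale U *ℚ scale X
          ≡⟨ interchange (β ^ℚ card U) (d ^ℚ l′) (β ^ℚ card X) (d ^ℚ lX) ⟩
        ((β ^ℚ card U) *ℚ (β ^ℚ card X)) *ℚ ((d ^ℚ l′) *ℚ (d ^ℚ lX))
          ≡⟨ cong₂ _*ℚ_ (^ℚ-+ β (card U) (card X)) (^ℚ-+ d l′ lX) ⟨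
        (β ^ℚ (card U + card X)) *ℚ (d ^ℚ (l′ + lX))
          ≡⟨ cong₂ (λ i j → (β ^ℚ i) *ℚ (d ^ℚ j)) card-union lengths ⟩
        (β ^ℚ (card K₁ + card K₂)) *ℚ (d ^ℚ (l₁ + l₂))
          ≡⟨ cong₂ _*ℚ_ (^ℚ-+ β (card K₁) (card K₂)) (^ℚ-+ d l₁ l₂) ⟩
        ((β ^ℚ card K₁) *ℚ (β ^ℚ card K₂)) *ℚ ((d ^ℚ l₁) *ℚ (d ^ℚ l₂))
          ≡⟨ interchange (β ^ℚ card K₁) (β ^ℚ card K₂) (d ^ℚ l₁) (d ^ℚ l₂) ⟩
        scale K₁ *ℚ scale K₂ ∎
        where
        open ≡-Reasoning
        l′ = length (edgesIn k M′ U)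
        lX = length (edgesIn k M X)
        l₁ = length (edgesIn k M K₁)
        l₂ = length (edgesIn k M K₂)
        interchange : ∀ p q r s → (p *ℚ q) *ℚ (r *ℚ s) ≡ (p *ℚ r) *ℚ (q *ℚ s)
        interchange = solve-∀ ringℚ
        lengths : l′ + lX ≡ l₁ + l₂
        lengths = trans (cong (l′ +_) (sym (List.length-map τ₁ (edgesIn k M X))))
          (trans (sym (List.length-++ (edgesIn k M′ U)))
          (trans (Perm.↭-length (edgesIn-union {K₁} {K₂} K₂⊆L X⊆))
          (trans (List.length-++ (map τ₁ (edgesIn k M K₁)))
                 (cong₂ _+_ (List.length-map τ₁ (edgesIn k M K₁)) (List.length-map τ₂ (edgesIn k M K₂))))))

      hX : Point → ℚ
      hX a = inv (scale X) *ℚ inv (μ X a)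

      -- Up to free vertices, 𝔼 (1 / μ_X) is at most the number of homomorphisms on `X`, and
      -- disjointness makes that number the scale of `X`.
      𝔼-hX : 𝔼 hX ≤ 1ℚ
      𝔼-hX = subst₂ _≤_ (sym (𝔼-*ˡ (inv (scale X)) (inv ∘ μ X))) (inv-inverseˡ (scale-pos X))
        (*-monoˡ-≤ (ℚ.<⇒≤ (inv-pos (scale-pos X))) (*-cancelˡ-≤ (^ℚ-pos N 0<β)
          (subst ((β ^ℚ N) *ℚ 𝔼 (inv ∘ μ X) ≤_) count (𝔼-inv-μ X))))
        where
        shuffle : ∀ p q r → p *ℚ (q *ℚ r) ≡ q *ℚ (p *ℚ r)
        shuffle = solve-∀ ringℚ
        count : (β ^ℚ card X) *ℚ homsOn X ≡ (β ^ℚ N) *ℚ scale X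
        count = trans (cong ((β ^ℚ card X) *ℚ_) (∑-disjoint (edgesIn k M X) (edgesIn-unique k M X) X-disjoint
          (λ e∈ → proj₁ (proj₂ (∈-edgesIn⁻ M X e∈))))) (shuffle (β ^ℚ card X) (β ^ℚ N) _)

      factored-union : Factored K₁ → Factored K₂ → M′.Factored U
      factored-union F₁ F₂ = record
        -- Gluing contributes one new factor; the others are those of `K₁` and `K₂`, read on their
        -- own sides of the pair.
        { hs     = hX ∘ proj₁ ∷ map (_∘ proj₁) F₁.hs List.++ map (_∘ proj₂) F₂.hs
        ; hs-pos = (λ p p∈ → let a∈ = proj₁ (∈-Ω′⁻ p∈) in *-pos (inv-pos (scale-pos X)) (inv-pos (μ-pos X a∈))) ∷
            All.++⁺ (All.map⁺ (All.map (λ 0<h (a , _) p∈ → 0<h a (proj₁ (∈-Ω′⁻ p∈))) F₁.hs-pos))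
                    (All.map⁺ (All.map (λ 0<h (_ , a′) p∈ → 0<h a′ (proj₁ (proj₂ (∈-Ω′⁻ p∈)))) F₂.hs-pos))
        ; hs-𝔼   = subst (_≤ 1ℚ) (sym (marginal₁ hX)) 𝔼-hX ∷
            All.++⁺ (All.map⁺ (All.map (λ {h} → subst (_≤ 1ℚ) (sym (marginal₁ h))) F₁.hs-𝔼))
                    (All.map⁺ (All.map (λ {h} → subst (_≤ 1ℚ) (sym (marginal₂ h))) F₂.hs-𝔼))
        ; factor = λ { {a , a′} p∈ → let a∈ , a′∈ , _ = ∈-Ω′⁻ p∈ in begin
            M′.scale U *ℚ M′.μ U (a , a′)
              ≡⟨ cong (M′.scale U *ℚ_) (μ-union p∈) ⟩
            M′.scale U *ℚ (inv (μ X a) *ℚ (μ K₁ a *ℚ μ K₂ a′))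
              ≡⟨ ℚ.*-identityˡ _ ⟨
            1ℚ *ℚ (M′.scale U *ℚ (inv (μ X a) *ℚ (μ K₁ a *ℚ μ K₂ a′)))
              ≡⟨ cong (_*ℚ (M′.scale U *ℚ (inv (μ X a) *ℚ (μ K₁ a *ℚ μ K₂ a′)))) (inv-inverseˡ (scale-pos X)) ⟨
            (inv (scale X) *ℚ scale X) *ℚ (M′.scale U *ℚ (inv (μ X a) *ℚ (μ K₁ a *ℚ μ K₂ a′)))
              ≡⟨ gather (inv (scale X)) (scale X) (M′.scale U) (inv (μ X a)) (μ K₁ a) (μ K₂ a′) ⟩
            (hX a *ℚ (M′.scale U *ℚ scale X)) *ℚ (μ K₁ a *ℚ μ K₂ a′)
              ≡⟨ cong (λ s → (hX a *ℚ s) *ℚ (μ K₁ a *ℚ μ K₂ a′)) scale-union ⟩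
            (hX a *ℚ (scale K₁ *ℚ scale K₂)) *ℚ (μ K₁ a *ℚ μ K₂ a′)
              ≡⟨ interchange (hX a) (scale K₁) (scale K₂) (μ K₁ a) (μ K₂ a′) ⟩
            hX a *ℚ ((scale K₁ *ℚ μ K₁ a) *ℚ (scale K₂ *ℚ μ K₂ a′))
              ≡⟨ cong (hX a *ℚ_) (cong₂ _*ℚ_ (F₁.factor a∈) (F₂.factor a′∈)) ⟩
            hX a *ℚ (∏ F₁.hs (λ h → h a) *ℚ ∏ F₂.hs (λ h → h a′))
              ≡⟨ cong (hX a *ℚ_) (trans (∏-++ (map (_∘ proj₁) F₁.hs) _ (λ h → h (a , a′)))
                   (cong₂ _*ℚ_ (∏-map (_∘ proj₁) F₁.hs (λ h → h (a , a′))) (∏-map (_∘ proj₂) F₂.hs (λ h → h (a , a′))))) ⟨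
            hX a *ℚ ∏ (map (_∘ proj₁) F₁.hs List.++ map (_∘ proj₂) F₂.hs) (λ h → h (a , a′)) ∎ }
        }
        where
        open ≡-Reasoning
        module F₁ = Factored F₁
        module F₂ = Factored F₂
        gather : ∀ i s u m p q → (i *ℚ s) *ℚ (u *ℚ (m *ℚ (p *ℚ q))) ≡ ((i *ℚ m) *ℚ (u *ℚ s)) *ℚ (p *ℚ q)
        gather = solve-∀ ringℚ
        interchange : ∀ h s t p q → (h *ℚ (s *ℚ t)) *ℚ (p *ℚ q) ≡ h *ℚ ((s *ℚ p) *ℚ (t *ℚ q))
        interchange = solve-∀ ringℚ

    factored-left : ∀ {K} → Factored K → M′.Factored (τ₁ K)
    factored-left {K} F = record
      { hs     = map (_∘ proj₁) hs
      ; hs-pos = All.map⁺ (All.map (λ 0<h (a , _) p∈ → 0<h a (proj₁ (∈-Ω′⁻ p∈))) hs-pos)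
      ; hs-𝔼   = All.map⁺ (All.map (λ {h} → subst (_≤ 1ℚ) (sym (marginal₁ h))) hs-𝔼)
      ; factor = λ { {a , a′} p∈ → trans
          (cong₂ _*ℚ_ (cong₂ (λ i j → (β ^ℚ i) *ℚ (d ^ℚ j)) (card-τ₁ K)
            (trans (Perm.↭-length (edgesIn-left K)) (List.length-map τ₁ (edgesIn k M K)))) (μ-left K a a′))
          (trans (factor (proj₁ (∈-Ω′⁻ p∈))) (sym (∏-map (_∘ proj₁) hs (λ h → h (a , a′))))) }
      }
      where open Factored F

    factored-right : ∀ {K} → K ⊆ L → Factored K → M′.Factored (τ₂ K)
    factored-right {K} K⊆L F = record
      { hs     = map (_∘ proj₂) hs
      ; hs-pos = All.map⁺ (All.map (λ 0<h (_ , a′) p∈ → 0<h a′ (proj₁ (proj₂ (∈-Ω′⁻ p∈)))) hs-pos)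
      ; hs-𝔼   = All.map⁺ (All.map (λ {h} → subst (_≤ 1ℚ) (sym (marginal₂ h))) hs-𝔼)
      ; factor = λ { {a , a′} p∈ → trans
          (cong₂ _*ℚ_ (cong₂ (λ i j → (β ^ℚ i) *ℚ (d ^ℚ j)) (card-τ₂ {K} K⊆L)
            (trans (Perm.↭-length (edgesIn-right {K} K⊆L)) (List.length-map τ₂ (edgesIn k M K)))) (μ-right {K} K⊆L p∈))
          (trans (factor (proj₁ (proj₂ (∈-Ω′⁻ p∈)))) (sym (∏-map (_∘ proj₂) hs (λ h → h (a , a′))))) }
      }
      where open Factored F

    couple-factored : EdgeFactored M′
    couple-factored = record { model = couple ; factored = λ K∈E → go (view K∈E) }
      where
      go : ∀ {K} → View K → M′.Factored K
      go (left K∈E)                        = factored-left (factored K∈E)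
      go (right {K} K∈E K⊆L)               = factored-right {K} K⊆L (factored K∈E)
      go (union {K₁} {K₂} K₁∈E K₂∈E i j)   =
        CoupleUnion.factored-union {K₁} {K₂} K₁∈E K₂∈E i j (factored K₁∈E) (factored K₂∈E)

  InC⇒EdgeFactored : ∀ {M} → InC k M → EdgeFactored M
  InC⇒EdgeFactored base = Base.base-factored
  InC⇒EdgeFactored (step {M} M∈C L X L∈E X⊆L X∈Z) =
    Couple.couple-factored (InC⇒Wellformed M∈C) L X L∈E X⊆L (InZ⇒Disjoint M X X∈Z) (InC⇒EdgeFactored M∈C)

  -- 𝔼 (1 / μ_V) lies between the predicted and the true number of homomorphisms. The extra power of
  -- β cancelled here comes from the extension count in `𝔼-inv-μ`.
  sidorenko-count : ∀ {M} → InC k M →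
    (β ^ℚ BHyp.n M) *ℚ (d ^ℚ length (edgesIn k M fullˢ)) ≤
    ∑ (allMaps (BHyp.n M) b) (λ y → ∏ (edgesIn k M fullˢ) (λ e → ⟦ γ y e ⟧))
  sidorenko-count {M} M∈C = *-cancelˡ-≤ (^ℚ-pos V 0<β) (begin
    (β ^ℚ V) *ℚ ((β ^ℚ V) *ℚ (d ^ℚ length (edgesIn k M fullˢ)))
      ≡⟨ cong (λ j → (β ^ℚ V) *ℚ ((β ^ℚ j) *ℚ (d ^ℚ length (edgesIn k M fullˢ)))) (card-full V) ⟨
    (β ^ℚ V) *ℚ scale fullˢ
      ≤⟨ *-monoˡ-≤ (ℚ.<⇒≤ (^ℚ-pos V 0<β)) (scale≤𝔼-inv-μ (factored (Wellformed.full-edge (InC⇒Wellformed M∈C)))) ⟩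
    (β ^ℚ V) *ℚ 𝔼 (inv ∘ μ fullˢ)
      ≤⟨ 𝔼-inv-μ fullˢ ⟩
    (β ^ℚ card (fullˢ {V})) *ℚ homsOn fullˢ
      ≡⟨ cong (λ j → (β ^ℚ j) *ℚ homsOn fullˢ) (card-full V) ⟩
    (β ^ℚ V) *ℚ homsOn fullˢ ∎)
    where
    open ℚ.≤-Reasoning
    open EdgeFactored (InC⇒EdgeFactored M∈C)
    open Model model
    V = BHyp.n M

-- From counts of homomorphisms to densities

isHom⇒ : ∀ (H G : Hyp) f → isHom H G f ≡ true → ∀ e → Hyp.E H e ≡ true → Hyp.E G (image f e) ≡ true
isHom⇒ H G f h e e∈E =
  subst (λ t → not t ∨ Hyp.E G (image f e) ≡ true) e∈E
    (all⁻ (λ e → not (Hyp.E H e) ∨ Hyp.E G (image f e)) h (∈-allSubsets e))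

⇒isHom : ∀ (H G : Hyp) f → (∀ e → Hyp.E H e ≡ true → Hyp.E G (image f e) ≡ true) → isHom H G f ≡ true
⇒isHom H G f h = all⁺ (λ e → not (Hyp.E H e) ∨ Hyp.E G (image f e)) (allSubsets (Hyp.n H)) (λ {e} _ → at e)
  where
  at : ∀ e → not (Hyp.E H e) ∨ Hyp.E G (image f e) ≡ true
  at e with Hyp.E H e in eq
  ... | false = refl
  ... | true  = h e eq

isHom-eₖ : ∀ k G z → isHom (eₖ k) G z ≡ Hyp.E G (image z fullˢ)
isHom-eₖ k G z = bool-ext
  (λ h → isHom⇒ (eₖ k) G z h fullˢ (=ˢ-refl (fullˢ {k})))
  (λ h → ⇒isHom (eₖ k) G z (λ e p → subst (λ S → Hyp.E G (image z S) ≡ true) (sym (=ˢ⇒≡ e fullˢ p)) h))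

isHom-frame : ∀ k M G y → ⟦ isHom (frame k M) G y ⟧ ≡ ∏ (edgesIn k M fullˢ) (λ e → ⟦ Hyp.E G (image y e) ⟧)
isHom-frame k M G y with ∏-indicator (edgesIn k M fullˢ) (λ e → Hyp.E G (image y e))
... | inj₁ (∏≡1 , all-true) = trans (cong ⟦_⟧ (⇒isHom (frame k M) G y (λ e p →
        let q , c = ∧-true⁻ p in all-true (∈-edgesIn⁺ M fullˢ q (≡ᵇ-true⁻ c) (⊆-full e))))) (sym ∏≡1)
... | inj₂ (∏≡0 , e , e∈ , ¬γ) with isHom (frame k M) G y in h
...   | false = sym ∏≡0
...   | true  = let p , c , _ = ∈-edgesIn⁻ M fullˢ e∈ in
  case trans (sym (isHom⇒ (frame k M) G y h e (∧-true⁺ p (≡ᵇ-true⁺ c)))) ¬γ of λ ()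

hom≡∑ : ∀ H G → ι (hom H G) ≡ ∑ (allMaps (Hyp.n H) (Hyp.n G)) (λ f → ⟦ isHom H G f ⟧)
hom≡∑ H G = ∑-count (isHom H G) (allMaps (Hyp.n H) (Hyp.n G))

t-density : ∀ H G .{{_ : NonZero (Hyp.n G)}} → t H G *ℚ (ι (Hyp.n G) ^ℚ Hyp.n H) ≡ ι (hom H G)
t-density H G = trans (cong (t H G *ℚ_) (sym (ι-^ (Hyp.n G) (Hyp.n H))))
  (/-*-cancel (hom H G) (Hyp.n G ^ Hyp.n H) {{ℕ.m^n≢0 (Hyp.n G) (Hyp.n H)}})

t-nonNeg : ∀ H G .{{_ : NonZero (Hyp.n G)}} → 0ℚ ≤ t H G
t-nonNeg H G = *-cancelˡ-≤ 0<c (subst₂ _≤_ (sym (ℚ.*-zeroʳ c))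
  (trans (sym (t-density H G)) (ℚ.*-comm (t H G) c)) (ι-nonNeg (hom H G)))
  where
  c = ι (Hyp.n G) ^ℚ Hyp.n H
  0<c : 0ℚ < c
  0<c = ^ℚ-pos (Hyp.n H) (ι-pos (Hyp.n G))

filter-cong : ∀ {A : Set} {p q : A → Bool} → (∀ x → p x ≡ q x) → ∀ xs →
              filter (λ x → p x Bool.≟ true) xs ≡ filter (λ x → q x Bool.≟ true) xs
filter-cong {p = p} {q} e []       = refl
filter-cong {p = p} {q} e (x ∷ xs) with p x | q x | e x
... | true  | _ | refl = cong (x ∷_) (filter-cong e xs)
... | false | _ | refl = filter-cong e xs

sidorenko-hom : ∀ {k M} → InC k M → ∀ G .{{_ : NonZero (Hyp.n G)}} d → 0ℚ ≤ d →
  d *ℚ (ι (Hyp.n G) ^ℚ k) ≡ ι (hom (eₖ k) G) →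
  (ι (Hyp.n G) ^ℚ BHyp.n M) *ℚ (d ^ℚ numEdges (frame k M)) ≤ ι (hom (frame k M) G)
sidorenko-hom {k} {M} M∈C G d 0≤d density with ℚ.<-cmp 0ℚ d
... | tri> _ _ d<0 = ⊥-elim (ℚ.<-irrefl refl (ℚ.<-≤-trans d<0 0≤d))
-- The frame has an edge, so a positive power of 0 appears and the left side vanishes.
... | tri≈ _ refl _ = subst (_≤ ι (hom (frame k M) G))
  (sym (trans (cong ((ι (Hyp.n G) ^ℚ BHyp.n M) *ℚ_) (0^ some-edge)) (ℚ.*-zeroʳ (ι (Hyp.n G) ^ℚ BHyp.n M)))) (ι-nonNeg (hom (frame k M) G))
  where
  0^ : ∀ {A : Set} {es : List A} {e} → e ∈ es → 0ℚ ^ℚ length es ≡ 0ℚ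
  0^ {es = _ ∷ es} _ = ℚ.*-zeroˡ (0ℚ ^ℚ length es)
  some-edge = Perm.∈-resp-↭ (edgesIn-full k M) (proj₂ (Wellformed.non-empty (InC⇒Wellformed M∈C)))
... | tri< 0<d _ _ = begin
    (β ^ℚ V) *ℚ (d ^ℚ numEdges (frame k M))
      ≡⟨ cong (λ l → (β ^ℚ V) *ℚ (d ^ℚ l)) (Perm.↭-length (edgesIn-full k M)) ⟨
    (β ^ℚ V) *ℚ (d ^ℚ length (edgesIn k M fullˢ))
      ≤⟨ Sidorenko.sidorenko-count k G (ι-pos (Hyp.n G)) d 0<d d-density M∈C ⟩
    ∑ (allMaps V (Hyp.n G)) (λ y → ∏ (edgesIn k M fullˢ) (λ e → ⟦ Hyp.E G (image y e) ⟧))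
      ≡⟨ ∑-cong (allMaps V (Hyp.n G)) (λ {y} _ → isHom-frame k M G y) ⟨
    ∑ (allMaps V (Hyp.n G)) (λ y → ⟦ isHom (frame k M) G y ⟧)
      ≡⟨ hom≡∑ (frame k M) G ⟨
    ι (hom (frame k M) G) ∎
  where
  open ℚ.≤-Reasoning
  V = BHyp.n M
  β = ι (Hyp.n G)
  d-density : ∑ (allMaps k (Hyp.n G)) (λ z → ⟦ Hyp.E G (image z fullˢ) ⟧) ≡ d *ℚ (β ^ℚ k)
  d-density = trans (∑-cong (allMaps k (Hyp.n G)) (λ {z} _ → cong ⟦_⟧ (sym (isHom-eₖ k G z))))
    (trans (sym (hom≡∑ (eₖ k) G)) (sym density))

sidorenko-frame : ∀ {k M} → InC k M → ∀ G .{{_ : NonZero (Hyp.n G)}} →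
  (t (eₖ k) G ^ℚ numEdges (frame k M)) ≤ t (frame k M) G
sidorenko-frame {k} {M} M∈C G = *-cancelˡ-≤ (^ℚ-pos (BHyp.n M) (ι-pos (Hyp.n G)))
  (ℚ.≤-trans (sidorenko-hom M∈C G (t (eₖ k) G) (t-nonNeg (eₖ k) G) (t-density (eₖ k) G))
    (ℚ.≤-reflexive (trans (sym (t-density (frame k M) G)) (ℚ.*-comm (t (frame k M) G) _))))

-- `SameHyp` compares edge predicates pointwise, so counts are transferred through `filter-cong`.
numEdges-cong : ∀ {n} {E₁ E₂ : Subset n → Bool} → (∀ e → E₁ e ≡ E₂ e) →
  numEdges (record { n = n ; E = E₁ }) ≡ numEdges (record { n = n ; E = E₂ })
numEdges-cong {n} e = cong length (filter-cong e (allSubsets n))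

hom-cong : ∀ {n} {E₁ E₂ : Subset n → Bool} → (∀ e → E₁ e ≡ E₂ e) → ∀ G →
  hom (record { n = n ; E = E₁ }) G ≡ hom (record { n = n ; E = E₂ }) G
hom-cong {n} e G = cong length (filter-cong
  (λ f → cong and (List.map-cong (λ S → cong (λ t → not t ∨ Hyp.E G (image f S)) (e S)) (allSubsets n)))
  (allMaps n (Hyp.n G)))

theorem9p3 : (k : ℕ) (H : Hyp) → InR k H →
    WeaklyThick k H ×
    ((G : Hyp) → Uniform k G → .{{_ : NonZero (Hyp.n G)}} →
    (t (eₖ k) G ^ℚ numEdges H) ≤ t H G)
theorem9p3 k H (M , M∈C , same) =
  (M , InC⇒ReflComplex M∈C , InC⇒WeaklyThick M∈C , same) , λ G _ → sidorenko H same G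
  where
  sidorenko : ∀ H → SameHyp (frame k M) H → ∀ G .{{_ : NonZero (Hyp.n G)}} →
    (t (eₖ k) G ^ℚ numEdges H) ≤ t H G
  -- Matching the equality of vertex numbers makes the `subst` in `SameHyp` compute away.
  sidorenko H (refl , e) G = subst₂ _≤_
    (cong (t (eₖ k) G ^ℚ_) (numEdges-cong e))
    (cong (λ h → (pos h / (Hyp.n G ^ BHyp.n M)) {{ℕ.m^n≢0 (Hyp.n G) (BHyp.n M)}}) (hom-cong e G))
    (sidorenko-frame M∈C G)
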